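{- Let $q,m,k,s_1,\ldots,s_u$ be positive integers such that $q$ is a prime power and $m\leq q$. Assume that there exist a weighing matrix of order $m$ and weight $k$ and an orthogonal design of order $m$ and type $(s_1,\ldots,s_u)$. Then: (1) there exist $m$ mutually unbiased unit orthogonal designs of order $mq$ and type $(ks_1,\ldots,ks_u)$ with parameter $\alpha=k^2$; (2) for every nonempty subset $S\subseteq\{1,\ldots,u\}$ there exist $m$ mutually quasi-unbiased unit weighing matrices for the parameters $\left(mq,\;k\sum_{i\in S}s_i,\;k^2,\;(\sum_{i\in S}s_i)^2\right)$.
   Context: Let $\mathbb{T}=\{c\in\mathbb{C}:|c|=1\}$ and let $W^*$ denote the conjugate transpose. A weighing matrix of order $n$ and weight $k$ is an $n\times n$ $(0,1,-1)$-matrix $W$ with $WW^\top=kI_n$; an orthogonal design of order $n$ and type $(s_1,\ldots,s_u)$ in distinct commuting real indeterminates $x_1,\ldots,x_u$ is an $n\times n$ matrix $D$ with entries in $\{0,\pm x_1,\ldots,\pm x_u\}$ with $DD^\top=(s_1x_1^2+\cdots+s_ux_u^2)I_n$. A unit weighing matrix of order $n$ and weight $k$ is an $n\times n$ matrix $W$ with entries in $\{0\}\cup\mathbb{T}$ such that $WW^*=kI_n$. Two unit weighing matrices $W_1,W_2$ of order $n$ and weight $k$ are quasi-unbiased for parameters $(n,k,l,a)$ if $\frac1{\sqrt a}W_1W_2^*$ is a unit weighing matrix of order $n$ and weight $l$; a family is mutually quasi-unbiased if any two distinct members are. A unit orthogonal design of order $n$ and type $(s_1,\ldots,s_u)$ in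 variables $x_1,\ldots,x_u$ (distinct commuting real indeterminates) is an $n\times n$ matrix with entries in $\{0\}\cup\{\epsilon x_i: 1\le i\le u,\ \epsilon\in\mathbb{T}\}$ with $DD^*=(s_1x_1^2+\cdots+s_ux_u^2)I_n$. Two such designs $D_1,D_2$ (same order, type and variables) are unbiased with parameter $\alpha>0$ if there is an $n\times n$ matrix $W$ with entries in $\{0\}\cup\mathbb{T}$ such that $D_1D_2^*=\frac{s_1x_1^2+\cdots+s_ux_u^2}{\sqrt\alpha}W$; a family is mutually unbiased if any two distinct members are. -}

module Defs where

open import Level using (Level; 0ℓ; _⊔_)
open import Algebra.Bundles using (CommutativeRing)
import Algebra.Consequences.Setoid as Consequences
import Algebra.Properties.Ring as RingProperties
import Algebra.Properties.Semiring.Mult as SemiringMult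
import Algebra.Properties.Semiring.Sum as SemiringSum
import Algebra.Solver.Ring.NaturalCoefficients.Default as SemiringSolver
open import Data.Bool.Base using (if_then_else_)
open import Data.Fin.Base using (Fin)
import Data.Fin.Properties as Fin
open import Data.Fin.Subset using (Subset)
open import Data.Integer.Base as ℤ using (ℤ)
import Data.Integer.Properties as ℤ
open import Data.Nat.Base as ℕ using (ℕ)
import Data.Nat.Properties as ℕ
open import Data.Nat.Primality using (Prime)
open import Data.Product.Base using (∃; ∃₂; _×_; _,_)
open import Data.Rational.Base as ℚ using (ℚ; 0ℚ; 1ℚ; ∣_∣)
import Data.Rational.Properties as ℚ
open import Data.Rational.Solver using (module +-*-Solver)
open import Data.Sum.Base using (_⊎_)
import Data.Vec.Base as Vec
open import Data.Vec.Functional using (Vector)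
open import Relation.Binary.Bundles using (Setoid)
open import Relation.Binary.PropositionalEquality
  using (_≡_; _≢_; refl; sym; trans; cong; cong₂; subst)
open import Relation.Nullary using (¬_; does)

private variable
  a b c ℓ : Level
  A : Set a
  B : Set b
  n u : ℕ

IsPrimePower : ℕ → Set
IsPrimePower q = ∃₂ λ p e → Prime p × 1 ℕ.≤ e × q ≡ p ℕ.^ e

-- Σ_{i ∈ S} s i
subsetSum : Subset u → Vector ℕ u → ℕ
subsetSum S s = sum (λ i → if Vec.lookup S i then s i else 0)
  where open SemiringSum ℕ.+-*-semiring using (sum)

------------------------------------------------------------------------
-- The real numbers: Cauchy sequences of rationals, two of which are
-- equal when their difference tends to 0

Cauchy : (ℕ → ℚ) → Set
Cauchy f = ∀ ε → 0ℚ ℚ.< ε →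
  ∃ λ N → ∀ m n → N ℕ.≤ m → N ℕ.≤ n → ∣ f m ℚ.- f n ∣ ℚ.< ε

record ℝ : Set where
  constructor mkℝ
  field
    seq    : ℕ → ℚ
    cauchy : Cauchy seq

open ℝ public

infix 4 _≈ᴿ_

record _≈ᴿ_ (x y : ℝ) : Set where
  constructor mk≈ᴿ
  field
    close : ∀ ε → 0ℚ ℚ.< ε →
            ∃ λ N → ∀ n → N ℕ.≤ n → ∣ seq x n ℚ.- seq y n ∣ ℚ.< ε

open _≈ᴿ_ public

record NonNegativeᴿ (x : ℝ) : Set where
  constructor mkNonNegativeᴿ
  field
    bound : ∀ ε → 0ℚ ℚ.< ε →
            ∃ λ N → ∀ n → N ℕ.≤ n → ℚ.- ε ℚ.< seq x n

private module Estimates where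

  open +-*-Solver using (solve; _:+_; _:*_; _:-_; :-_; _:=_; con)

  -- Any ε > 0 is a prescribed positive multiple of some δ > 0.
  split : ∀ C → 0ℚ ℚ.< C → ∀ ε → 0ℚ ℚ.< ε →
          ∃ λ δ → 0ℚ ℚ.< δ × C ℚ.* δ ≡ ε
  split C 0<C ε 0<ε = C⁻¹ ℚ.* ε , ℚ.positive⁻¹ _ , eq
    where
    instance
      posC : ℚ.Positive C
      posC = ℚ.positive 0<C
      nzC : ℚ.NonZero C
      nzC = ℚ.pos⇒nonZero C
      posε : ℚ.Positive ε
      posε = ℚ.positive 0<ε
    C⁻¹ : ℚ
    C⁻¹ = ℚ.1/ C
    instance
      posC⁻¹ : ℚ.Positive C⁻¹
      posC⁻¹ = ℚ.1/pos⇒pos C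
      posδ : ℚ.Positive (C⁻¹ ℚ.* ε)
      posδ = ℚ.pos*pos⇒pos C⁻¹ ε
    eq : C ℚ.* (C⁻¹ ℚ.* ε) ≡ ε
    eq = trans (sym (ℚ.*-assoc C C⁻¹ ε))
           (trans (cong (ℚ._* ε) (ℚ.*-inverseʳ C)) (ℚ.*-identityˡ ε))

  halve : ∀ ε → 0ℚ ℚ.< ε → ∃ λ δ → 0ℚ ℚ.< δ × δ ℚ.+ δ ≡ ε
  halve ε 0<ε with split (1ℚ ℚ.+ 1ℚ) (ℚ.positive⁻¹ _) ε 0<ε
  ... | δ , 0<δ , eq = δ , 0<δ , trans (lemma δ) eq
    where
    lemma : ∀ δ → δ ℚ.+ δ ≡ (1ℚ ℚ.+ 1ℚ) ℚ.* δ
    lemma = solve 1 (λ d → d :+ d := (con 1ℚ :+ con 1ℚ) :* d) refl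

  add-close : ∀ {δ ε} → δ ℚ.+ δ ≡ ε → ∀ p q p′ q′ → ∣ p ℚ.- p′ ∣ ℚ.< δ → ∣ q ℚ.- q′ ∣ ℚ.< δ →
              ∣ (p ℚ.+ q) ℚ.- (p′ ℚ.+ q′) ∣ ℚ.< ε
  add-close {δ} {ε} eq p q p′ q′ h k = begin-strict
    ∣ (p ℚ.+ q) ℚ.- (p′ ℚ.+ q′) ∣        ≡⟨ cong ∣_∣ (lemma p q p′ q′) ⟩
    ∣ (p ℚ.- p′) ℚ.+ (q ℚ.- q′) ∣        ≤⟨ ℚ.∣p+q∣≤∣p∣+∣q∣ (p ℚ.- p′) (q ℚ.- q′) ⟩
    ∣ p ℚ.- p′ ∣ ℚ.+ ∣ q ℚ.- q′ ∣        <⟨ ℚ.+-mono-< h k ⟩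
    δ ℚ.+ δ                              ≡⟨ eq ⟩
    ε                                    ∎
    where
    open ℚ.≤-Reasoning
    lemma : ∀ p q p′ q′ →
            (p ℚ.+ q) ℚ.- (p′ ℚ.+ q′) ≡ (p ℚ.- p′) ℚ.+ (q ℚ.- q′)
    lemma = solve 4 (λ p q p′ q′ →
      (p :+ q) :- (p′ :+ q′) := (p :- p′) :+ (q :- q′)) refl

  neg-close : ∀ p p′ → ∣ (ℚ.- p) ℚ.- (ℚ.- p′) ∣ ≡ ∣ p ℚ.- p′ ∣
  neg-close p p′ = trans (cong ∣_∣ (lemma p p′)) (ℚ.∣-p∣≡∣p∣ (p ℚ.- p′))
    where
    lemma : ∀ p p′ → (ℚ.- p) ℚ.- (ℚ.- p′) ≡ ℚ.- (p ℚ.- p′)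
    lemma = solve 2 (λ p p′ → (:- p) :- (:- p′) := :- (p :- p′)) refl

  swap-close : ∀ p p′ → ∣ p ℚ.- p′ ∣ ≡ ∣ p′ ℚ.- p ∣
  swap-close p p′ = trans (cong ∣_∣ (lemma p p′)) (ℚ.∣-p∣≡∣p∣ (p′ ℚ.- p))
    where
    lemma : ∀ p p′ → p ℚ.- p′ ≡ ℚ.- (p′ ℚ.- p)
    lemma = solve 2 (λ p p′ → p :- p′ := :- (p′ :- p)) refl

  trans-close : ∀ {δ ε} → δ ℚ.+ δ ≡ ε → ∀ p q r → ∣ p ℚ.- q ∣ ℚ.< δ → ∣ q ℚ.- r ∣ ℚ.< δ →
                ∣ p ℚ.- r ∣ ℚ.< ε
  trans-close {δ} {ε} eq p q r h k = begin-strict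
    ∣ p ℚ.- r ∣                          ≡⟨ cong ∣_∣ (lemma p q r) ⟩
    ∣ (p ℚ.- q) ℚ.+ (q ℚ.- r) ∣          ≤⟨ ℚ.∣p+q∣≤∣p∣+∣q∣ (p ℚ.- q) (q ℚ.- r) ⟩
    ∣ p ℚ.- q ∣ ℚ.+ ∣ q ℚ.- r ∣          <⟨ ℚ.+-mono-< h k ⟩
    δ ℚ.+ δ                              ≡⟨ eq ⟩
    ε                                    ∎
    where
    open ℚ.≤-Reasoning
    lemma : ∀ p q r → p ℚ.- r ≡ (p ℚ.- q) ℚ.+ (q ℚ.- r)
    lemma = solve 3 (λ p q r → p :- r := (p :- q) :+ (q :- r)) refl

  mul-close : ∀ {P Q δ ε} → (P ℚ.+ Q) ℚ.* δ ≡ ε →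
              ∀ p q p′ q′ → 0ℚ ℚ.< P → 0ℚ ℚ.< Q →
              ∣ p ∣ ℚ.< P → ∣ q′ ∣ ℚ.< Q →
              ∣ p ℚ.- p′ ∣ ℚ.< δ → ∣ q ℚ.- q′ ∣ ℚ.< δ →
              ∣ (p ℚ.* q) ℚ.- (p′ ℚ.* q′) ∣ ℚ.< ε
  mul-close {P} {Q} {δ} {ε} eq p q p′ q′ 0<P 0<Q ∣p∣<P ∣q′∣<Q h k = begin-strict
    ∣ (p ℚ.* q) ℚ.- (p′ ℚ.* q′) ∣
      ≡⟨ cong ∣_∣ (lemma p q p′ q′) ⟩
    ∣ p ℚ.* (q ℚ.- q′) ℚ.+ (p ℚ.- p′) ℚ.* q′ ∣
      ≤⟨ ℚ.∣p+q∣≤∣p∣+∣q∣ (p ℚ.* (q ℚ.- q′)) ((p ℚ.- p′) ℚ.* q′) ⟩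
    ∣ p ℚ.* (q ℚ.- q′) ∣ ℚ.+ ∣ (p ℚ.- p′) ℚ.* q′ ∣
      ≡⟨ cong₂ ℚ._+_ (ℚ.∣p*q∣≡∣p∣*∣q∣ p (q ℚ.- q′)) (ℚ.∣p*q∣≡∣p∣*∣q∣ (p ℚ.- p′) q′) ⟩
    ∣ p ∣ ℚ.* ∣ q ℚ.- q′ ∣ ℚ.+ ∣ p ℚ.- p′ ∣ ℚ.* ∣ q′ ∣
      ≤⟨ ℚ.+-mono-≤
           (ℚ.*-monoʳ-≤-nonNeg ∣ q ℚ.- q′ ∣ (ℚ.<⇒≤ ∣p∣<P))
           (ℚ.*-monoˡ-≤-nonNeg ∣ p ℚ.- p′ ∣ (ℚ.<⇒≤ ∣q′∣<Q)) ⟩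
    P ℚ.* ∣ q ℚ.- q′ ∣ ℚ.+ ∣ p ℚ.- p′ ∣ ℚ.* Q
      <⟨ ℚ.+-mono-< (ℚ.*-monoʳ-<-pos P k) (ℚ.*-monoˡ-<-pos Q h) ⟩
    P ℚ.* δ ℚ.+ δ ℚ.* Q
      ≡⟨ lemma′ P Q δ ⟩
    (P ℚ.+ Q) ℚ.* δ
      ≡⟨ eq ⟩
    ε ∎
    where
    open ℚ.≤-Reasoning
    instance
      posP : ℚ.Positive P
      posP = ℚ.positive 0<P
      posQ : ℚ.Positive Q
      posQ = ℚ.positive 0<Q
      nn₁ : ℚ.NonNegative ∣ q ℚ.- q′ ∣
      nn₁ = ℚ.∣-∣-nonNeg (q ℚ.- q′)
      nn₂ : ℚ.NonNegative ∣ p ℚ.- p′ ∣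
      nn₂ = ℚ.∣-∣-nonNeg (p ℚ.- p′)
    lemma : ∀ p q p′ q′ →
            (p ℚ.* q) ℚ.- (p′ ℚ.* q′) ≡
            p ℚ.* (q ℚ.- q′) ℚ.+ (p ℚ.- p′) ℚ.* q′
    lemma = solve 4 (λ p q p′ q′ →
      (p :* q) :- (p′ :* q′) := p :* (q :- q′) :+ (p :- p′) :* q′) refl
    lemma′ : ∀ P Q δ → P ℚ.* δ ℚ.+ δ ℚ.* Q ≡ (P ℚ.+ Q) ℚ.* δ
    lemma′ = solve 3 (λ P Q d → P :* d :+ d :* Q := (P :+ Q) :* d) refl

  bounded : ∀ x → ∃₂ λ C N → 0ℚ ℚ.< C × (∀ n → N ℕ.≤ n → ∣ seq x n ∣ ℚ.< C)
  bounded x with cauchy x 1ℚ (ℚ.positive⁻¹ _)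
  ... | N , h = 1ℚ ℚ.+ ∣ seq x N ∣ , N ,
                ℚ.+-mono-<-≤ (ℚ.positive⁻¹ 1ℚ) (ℚ.0≤∣p∣ (seq x N)) , below
    where
    lemma : ∀ p q → p ≡ (p ℚ.- q) ℚ.+ q
    lemma = solve 2 (λ p q → p := (p :- q) :+ q) refl
    below : ∀ n → N ℕ.≤ n → ∣ seq x n ∣ ℚ.< 1ℚ ℚ.+ ∣ seq x N ∣
    below n N≤n = begin-strict
      ∣ seq x n ∣
        ≡⟨ cong ∣_∣ (lemma (seq x n) (seq x N)) ⟩
      ∣ (seq x n ℚ.- seq x N) ℚ.+ seq x N ∣
        ≤⟨ ℚ.∣p+q∣≤∣p∣+∣q∣ (seq x n ℚ.- seq x N) (seq x N) ⟩
      ∣ seq x n ℚ.- seq x N ∣ ℚ.+ ∣ seq x N ∣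
        <⟨ ℚ.+-monoˡ-< ∣ seq x N ∣ (h n N N≤n ℕ.≤-refl) ⟩
      1ℚ ℚ.+ ∣ seq x N ∣ ∎
      where open ℚ.≤-Reasoning

  <-self : ∀ p {ε} → 0ℚ ℚ.< ε → ∣ p ℚ.- p ∣ ℚ.< ε
  <-self p = subst (ℚ._< _) (sym (cong ∣_∣ (ℚ.+-inverseʳ p)))

  ≤⊔₁ : ∀ {M N k} → M ℕ.⊔ N ℕ.≤ k → M ℕ.≤ k
  ≤⊔₁ {M} {N} = ℕ.≤-trans (ℕ.m≤m⊔n M N)

  ≤⊔₂ : ∀ {M N k} → M ℕ.⊔ N ℕ.≤ k → N ℕ.≤ k
  ≤⊔₂ {M} {N} = ℕ.≤-trans (ℕ.m≤n⊔m M N)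

open Estimates

infixl 6 _+ᴿ_
infixl 7 _*ᴿ_
infix  8 -ᴿ_

-- Opaque so that conversion checking does not unfold rational arithmetic.
opaque

  constᴿ : ℚ → ℝ
  constᴿ p = mkℝ (λ _ → p) (λ ε 0<ε → 0 , λ _ _ _ _ → <-self p 0<ε)

  _+ᴿ_ : ℝ → ℝ → ℝ
  x +ᴿ y = mkℝ (λ n → seq x n ℚ.+ seq y n) prf
    where
    prf : Cauchy (λ n → seq x n ℚ.+ seq y n)
    prf ε 0<ε =
      let δ , 0<δ , eq = halve ε 0<ε
          M , hx = cauchy x δ 0<δ
          N , hy = cauchy y δ 0<δ
      in M ℕ.⊔ N , λ m n m≥ n≥ →
        add-close eq (seq x m) (seq y m) (seq x n) (seq y n)
          (hx m n (≤⊔₁ {M} {N} m≥) (≤⊔₁ {M} {N} n≥))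
          (hy m n (≤⊔₂ {M} {N} m≥) (≤⊔₂ {M} {N} n≥))

  -ᴿ_ : ℝ → ℝ
  -ᴿ x = mkℝ (λ n → ℚ.- seq x n) prf
    where
    prf : Cauchy (λ n → ℚ.- seq x n)
    prf ε 0<ε = let N , h = cauchy x ε 0<ε in N , λ m n m≥ n≥ →
      subst (ℚ._< ε) (sym (neg-close (seq x m) (seq x n))) (h m n m≥ n≥)

  _*ᴿ_ : ℝ → ℝ → ℝ
  x *ᴿ y = mkℝ (λ n → seq x n ℚ.* seq y n) prf
    where
    prf : Cauchy (λ n → seq x n ℚ.* seq y n)
    prf ε 0<ε =
      let P , K , 0<P , bx = bounded x
          Q , L , 0<Q , by = bounded y
          δ , 0<δ , eq = split (P ℚ.+ Q) (ℚ.+-mono-< 0<P 0<Q) ε 0<ε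
          M , hx = cauchy x δ 0<δ
          N , hy = cauchy y δ 0<δ
      in (K ℕ.⊔ L) ℕ.⊔ (M ℕ.⊔ N) , λ m n m≥ n≥ →
        let KL≤m = ≤⊔₁ {K ℕ.⊔ L} {M ℕ.⊔ N} m≥
            KL≤n = ≤⊔₁ {K ℕ.⊔ L} {M ℕ.⊔ N} n≥
            MN≤m = ≤⊔₂ {K ℕ.⊔ L} {M ℕ.⊔ N} m≥
            MN≤n = ≤⊔₂ {K ℕ.⊔ L} {M ℕ.⊔ N} n≥
        in mul-close eq (seq x m) (seq y m) (seq x n) (seq y n) 0<P 0<Q
             (bx m (≤⊔₁ {K} {L} KL≤m)) (by n (≤⊔₂ {K} {L} KL≤n))
             (hx m n (≤⊔₁ {M} {N} MN≤m) (≤⊔₁ {M} {N} MN≤n))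
             (hy m n (≤⊔₂ {M} {N} MN≤m) (≤⊔₂ {M} {N} MN≤n))

opaque
  unfolding constᴿ _+ᴿ_ -ᴿ_ _*ᴿ_

  pointwise : ∀ {x y} → (∀ n → seq x n ≡ seq y n) → x ≈ᴿ y
  pointwise {x} {y} eq = mk≈ᴿ λ ε 0<ε → 0 , λ n _ →
    subst (λ p → ∣ seq x n ℚ.- p ∣ ℚ.< ε) (eq n) (<-self (seq x n) 0<ε)

  ≈ᴿ-sym : ∀ {x y} → x ≈ᴿ y → y ≈ᴿ x
  ≈ᴿ-sym {x} {y} x≈y = mk≈ᴿ λ ε 0<ε → let N , h = close x≈y ε 0<ε in
    N , λ n n≥ → subst (ℚ._< ε) (swap-close (seq x n) (seq y n)) (h n n≥)

  ≈ᴿ-trans : ∀ {x y z} → x ≈ᴿ y → y ≈ᴿ z → x ≈ᴿ z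
  ≈ᴿ-trans {x} {y} {z} x≈y y≈z = mk≈ᴿ prf
    where
    prf : ∀ ε → 0ℚ ℚ.< ε →
          ∃ λ N → ∀ n → N ℕ.≤ n → ∣ seq x n ℚ.- seq z n ∣ ℚ.< ε
    prf ε 0<ε =
      let δ , 0<δ , eq = halve ε 0<ε
          M , h = close x≈y δ 0<δ
          N , k = close y≈z δ 0<δ
      in M ℕ.⊔ N , λ n n≥ →
        trans-close eq (seq x n) (seq y n) (seq z n)
          (h n (≤⊔₁ {M} {N} n≥)) (k n (≤⊔₂ {M} {N} n≥))

  +ᴿ-cong : ∀ {x y v w} → x ≈ᴿ y → v ≈ᴿ w → (x +ᴿ v) ≈ᴿ (y +ᴿ w)
  +ᴿ-cong {x} {y} {v} {w} x≈y v≈w = mk≈ᴿ prf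
    where
    prf : ∀ ε → 0ℚ ℚ.< ε →
          ∃ λ N → ∀ n → N ℕ.≤ n → ∣ seq (x +ᴿ v) n ℚ.- seq (y +ᴿ w) n ∣ ℚ.< ε
    prf ε 0<ε =
      let δ , 0<δ , eq = halve ε 0<ε
          M , h = close x≈y δ 0<δ
          N , k = close v≈w δ 0<δ
      in M ℕ.⊔ N , λ n n≥ →
        add-close eq (seq x n) (seq v n) (seq y n) (seq w n)
          (h n (≤⊔₁ {M} {N} n≥)) (k n (≤⊔₂ {M} {N} n≥))

  -ᴿ-cong : ∀ {x y} → x ≈ᴿ y → (-ᴿ x) ≈ᴿ (-ᴿ y)
  -ᴿ-cong {x} {y} x≈y = mk≈ᴿ λ ε 0<ε → let N , h = close x≈y ε 0<ε in
    N , λ n n≥ → subst (ℚ._< ε) (sym (neg-close (seq x n) (seq y n))) (h n n≥)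

  *ᴿ-cong : ∀ {x y v w} → x ≈ᴿ y → v ≈ᴿ w → (x *ᴿ v) ≈ᴿ (y *ᴿ w)
  *ᴿ-cong {x} {y} {v} {w} x≈y v≈w = mk≈ᴿ prf
    where
    prf : ∀ ε → 0ℚ ℚ.< ε →
          ∃ λ N → ∀ n → N ℕ.≤ n → ∣ seq (x *ᴿ v) n ℚ.- seq (y *ᴿ w) n ∣ ℚ.< ε
    prf ε 0<ε =
      let P , K , 0<P , bx = bounded x
          Q , L , 0<Q , bw = bounded w
          δ , 0<δ , eq = split (P ℚ.+ Q) (ℚ.+-mono-< 0<P 0<Q) ε 0<ε
          M , h = close x≈y δ 0<δ
          N , k = close v≈w δ 0<δ
      in (K ℕ.⊔ L) ℕ.⊔ (M ℕ.⊔ N) , λ n n≥ →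
        let KL≤n = ≤⊔₁ {K ℕ.⊔ L} {M ℕ.⊔ N} n≥
            MN≤n = ≤⊔₂ {K ℕ.⊔ L} {M ℕ.⊔ N} n≥
        in mul-close eq (seq x n) (seq v n) (seq y n) (seq w n) 0<P 0<Q
             (bx n (≤⊔₁ {K} {L} KL≤n)) (bw n (≤⊔₂ {K} {L} KL≤n))
             (h n (≤⊔₁ {M} {N} MN≤n)) (k n (≤⊔₂ {M} {N} MN≤n))

  ≈ᴿ-refl : ∀ {x} → x ≈ᴿ x
  ≈ᴿ-refl {x} = pointwise {x} {x} λ _ → refl

  +ᴿ-assoc : ∀ x y z → ((x +ᴿ y) +ᴿ z) ≈ᴿ (x +ᴿ (y +ᴿ z))
  +ᴿ-assoc x y z = pointwise {(x +ᴿ y) +ᴿ z} {x +ᴿ (y +ᴿ z)}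
    λ n → ℚ.+-assoc (seq x n) (seq y n) (seq z n)

  +ᴿ-comm : ∀ x y → (x +ᴿ y) ≈ᴿ (y +ᴿ x)
  +ᴿ-comm x y = pointwise {x +ᴿ y} {y +ᴿ x} λ n → ℚ.+-comm (seq x n) (seq y n)

  +ᴿ-identityˡ : ∀ x → (constᴿ 0ℚ +ᴿ x) ≈ᴿ x
  +ᴿ-identityˡ x = pointwise {constᴿ 0ℚ +ᴿ x} {x} λ n → ℚ.+-identityˡ (seq x n)

  -ᴿ-inverseˡ : ∀ x → ((-ᴿ x) +ᴿ x) ≈ᴿ constᴿ 0ℚ
  -ᴿ-inverseˡ x = pointwise {(-ᴿ x) +ᴿ x} {constᴿ 0ℚ} λ n → ℚ.+-inverseˡ (seq x n)

  *ᴿ-assoc : ∀ x y z → ((x *ᴿ y) *ᴿ z) ≈ᴿ (x *ᴿ (y *ᴿ z))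
  *ᴿ-assoc x y z = pointwise {(x *ᴿ y) *ᴿ z} {x *ᴿ (y *ᴿ z)}
    λ n → ℚ.*-assoc (seq x n) (seq y n) (seq z n)

  *ᴿ-comm : ∀ x y → (x *ᴿ y) ≈ᴿ (y *ᴿ x)
  *ᴿ-comm x y = pointwise {x *ᴿ y} {y *ᴿ x} λ n → ℚ.*-comm (seq x n) (seq y n)

  *ᴿ-identityˡ : ∀ x → (constᴿ 1ℚ *ᴿ x) ≈ᴿ x
  *ᴿ-identityˡ x = pointwise {constᴿ 1ℚ *ᴿ x} {x} λ n → ℚ.*-identityˡ (seq x n)

  distribᴿˡ : ∀ x y z → (x *ᴿ (y +ᴿ z)) ≈ᴿ (x *ᴿ y +ᴿ x *ᴿ z)
  distribᴿˡ x y z = pointwise {x *ᴿ (y +ᴿ z)} {x *ᴿ y +ᴿ x *ᴿ z}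
    λ n → ℚ.*-distribˡ-+ (seq x n) (seq y n) (seq z n)

ℝ-setoid : Setoid 0ℓ 0ℓ
ℝ-setoid = record
  { Carrier = ℝ ; _≈_ = _≈ᴿ_
  ; isEquivalence = record { refl = ≈ᴿ-refl ; sym = ≈ᴿ-sym ; trans = ≈ᴿ-trans } }

ℝ-commutativeRing : CommutativeRing 0ℓ 0ℓ
ℝ-commutativeRing = record
  { Carrier = ℝ ; _≈_ = _≈ᴿ_ ; _+_ = _+ᴿ_ ; _*_ = _*ᴿ_ ; -_ = -ᴿ_
  ; 0# = constᴿ 0ℚ ; 1# = constᴿ 1ℚ
  ; isCommutativeRing = record
    { isRing = record
      { +-isAbelianGroup = record
        { isGroup = record
          { isMonoid = record
            { isSemigroup = record
              { isMagma = record
                { isEquivalence = Setoid.isEquivalence ℝ-setoid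
                ; ∙-cong = +ᴿ-cong
                }
              ; assoc = +ᴿ-assoc
              }
            ; identity = comm∧idˡ⇒id +ᴿ-comm +ᴿ-identityˡ
            }
          ; inverse = comm∧invˡ⇒inv +ᴿ-comm -ᴿ-inverseˡ
          ; ⁻¹-cong = -ᴿ-cong
          }
        ; comm = +ᴿ-comm
        }
      ; *-cong = *ᴿ-cong
      ; *-assoc = *ᴿ-assoc
      ; *-identity = comm∧idˡ⇒id *ᴿ-comm *ᴿ-identityˡ
      ; distrib = comm∧distrˡ⇒distr +ᴿ-cong *ᴿ-comm distribᴿˡ
      }
    ; *-comm = *ᴿ-comm
    }
  }
  where open Consequences ℝ-setoid

-- r = √x
IsSqrt : ℝ → ℝ → Set
IsSqrt r x = NonNegativeᴿ r × (r *ᴿ r) ≈ᴿ x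

-- t = 1 / √x; this forces x > 0.
IsInverseSqrt : ℝ → ℝ → Set
IsInverseSqrt t x = ∃ λ r → IsSqrt r x × (t *ᴿ r) ≈ᴿ constᴿ 1ℚ

------------------------------------------------------------------------
-- R[i] = R[x] / (x² + 1)

record Gaussian (A : Set a) : Set a where
  constructor _+i_
  field
    re : A
    im : A

open Gaussian public

module _ (R : CommutativeRing c ℓ) where

  private
    module R = CommutativeRing R
    open SemiringSolver R.commutativeSemiring
      using (solve; _:+_; _:*_; _:=_)
    open RingProperties R.ring using (-1*x≈-x; -0#≈0#)

    -1# : R.Carrier
    -1# = R.- R.1#

    -- Writing x - y as x + (-1) y makes the identities below instances
    -- of commutative semiring identities.
    infixl 6 _⊟_
    _⊟_ : R.Carrier → R.Carrier → R.Carrier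
    x ⊟ y = x R.+ -1# R.* y

    -≈⊟ : ∀ {x x′ y y′} → x R.≈ x′ → y R.≈ y′ → x R.- y R.≈ x′ ⊟ y′
    -≈⊟ p q = R.+-cong p (R.trans (R.-‿cong q) (R.sym (-1*x≈-x _)))

    *-congˡ : ∀ {x y z} → y R.≈ z → x R.* y R.≈ x R.* z
    *-congˡ = R.*-cong R.refl

    *-congʳ : ∀ {x y z} → y R.≈ z → y R.* x R.≈ z R.* x
    *-congʳ p = R.*-cong p R.refl

    ⊟≈ : ∀ {x y} → x R.- y R.≈ x ⊟ y
    ⊟≈ = -≈⊟ R.refl R.refl

  record _≈ᴳ_ (z w : Gaussian R.Carrier) : Set ℓ where
    constructor _,ᴳ_
    field
      re≈ : re z R.≈ re w
      im≈ : im z R.≈ im w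

  gaussianRing : CommutativeRing c ℓ
  gaussianRing = record
    { Carrier = Gaussian R.Carrier
    ; _≈_ = _≈ᴳ_
    ; _+_ = λ z w → (re z R.+ re w) +i (im z R.+ im w)
    ; _*_ = λ z w → (re z R.* re w R.- im z R.* im w)
                 +i (re z R.* im w R.+ im z R.* re w)
    ; -_  = λ z → (R.- re z) +i (R.- im z)
    ; 0#  = R.0# +i R.0#
    ; 1#  = R.1# +i R.0#
    ; isCommutativeRing = record
      { isRing = record
        { +-isAbelianGroup = record
          { isGroup = record
            { isMonoid = record
              { isSemigroup = record
                { isMagma = record
                  { isEquivalence = record
                    { refl  = R.refl ,ᴳ R.refl
                    ; sym   = λ (p ,ᴳ q) → R.sym p ,ᴳ R.sym q
                    ; trans = λ (p ,ᴳ q) (p′ ,ᴳ q′) → R.trans p p′ ,ᴳ R.trans q q′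
                    }
                  ; ∙-cong = λ (p ,ᴳ q) (p′ ,ᴳ q′) → R.+-cong p p′ ,ᴳ R.+-cong q q′
                  }
                ; assoc = λ x y z → R.+-assoc _ _ _ ,ᴳ R.+-assoc _ _ _
                }
              ; identity = (λ z → R.+-identityˡ _ ,ᴳ R.+-identityˡ _)
                         , (λ z → R.+-identityʳ _ ,ᴳ R.+-identityʳ _)
              }
            ; inverse = (λ z → R.-‿inverseˡ _ ,ᴳ R.-‿inverseˡ _)
                      , (λ z → R.-‿inverseʳ _ ,ᴳ R.-‿inverseʳ _)
            ; ⁻¹-cong = λ (p ,ᴳ q) → R.-‿cong p ,ᴳ R.-‿cong q
            }
          ; comm = λ z w → R.+-comm _ _ ,ᴳ R.+-comm _ _
          }
        ; *-cong = λ (p ,ᴳ q) (p′ ,ᴳ q′) →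
               R.+-cong (R.*-cong p p′) (R.-‿cong (R.*-cong q q′))
            ,ᴳ R.+-cong (R.*-cong p q′) (R.*-cong q p′)
        ; *-assoc = λ (a +i b) (c +i d) (e +i f) →
               R.trans (-≈⊟ (*-congʳ ⊟≈) R.refl)
                 (R.trans
                   (solve 7 (λ a b c d e f n →
                        (a :* c :+ n :* (b :* d)) :* e :+ n :* ((a :* d :+ b :* c) :* f)
                     := a :* (c :* e :+ n :* (d :* f)) :+ n :* (b :* (c :* f :+ d :* e)))
                     R.refl a b c d e f -1#)
                   (R.sym (-≈⊟ (*-congˡ ⊟≈) R.refl)))
            ,ᴳ R.trans (R.+-cong (*-congʳ ⊟≈) R.refl)
                 (R.trans
                   (solve 7 (λ a b c d e f n →
                        (a :* c :+ n :* (b :* d)) :* f :+ (a :* d :+ b :* c) :* e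
                     := a :* (c :* f :+ d :* e) :+ b :* (c :* e :+ n :* (d :* f)))
                     R.refl a b c d e f -1#)
                   (R.sym (R.+-cong R.refl (*-congˡ ⊟≈))))
        ; *-identity = (λ z → *-identityˡ z)
                     , (λ z → R.trans (R.+-cong (R.*-comm _ _) (R.-‿cong (R.*-comm _ _)))
                                      (_≈ᴳ_.re≈ (*-identityˡ z))
                           ,ᴳ R.trans (R.+-cong (R.*-comm _ _) (R.*-comm _ _))
                                (R.trans (R.+-comm _ _) (_≈ᴳ_.im≈ (*-identityˡ z))))
        ; distrib =
            (λ (a +i b) (c +i d) (e +i f) →
               R.trans ⊟≈
                 (R.trans
                   (solve 7 (λ a b c d e f n →
                        a :* (c :+ e) :+ n :* (b :* (d :+ f))
                     := (a :* c :+ n :* (b :* d)) :+ (a :* e :+ n :* (b :* f)))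
                     R.refl a b c d e f -1#)
                   (R.sym (R.+-cong ⊟≈ ⊟≈)))
            ,ᴳ solve 6 (λ a b c d e f →
                    a :* (d :+ f) :+ b :* (c :+ e)
                 := (a :* d :+ b :* c) :+ (a :* f :+ b :* e))
                 R.refl a b c d e f)
          , (λ (a +i b) (c +i d) (e +i f) →
               R.trans ⊟≈
                 (R.trans
                   (solve 7 (λ a b c d e f n →
                        (c :+ e) :* a :+ n :* ((d :+ f) :* b)
                     := (c :* a :+ n :* (d :* b)) :+ (e :* a :+ n :* (f :* b)))
                     R.refl a b c d e f -1#)
                   (R.sym (R.+-cong ⊟≈ ⊟≈)))
            ,ᴳ solve 6 (λ a b c d e f →
                    (c :+ e) :* b :+ (d :+ f) :* a
                 := (c :* b :+ d :* a) :+ (e :* b :+ f :* a))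
                 R.refl a b c d e f)
        }
      ; *-comm = λ z w →
             R.+-cong (R.*-comm _ _) (R.-‿cong (R.*-comm _ _))
          ,ᴳ R.trans (R.+-comm _ _) (R.+-cong (R.*-comm _ _) (R.*-comm _ _))
      }
    }
    where
    *-identityˡ : ∀ z → ((R.1# R.* re z R.- R.0# R.* im z)
                      +i (R.1# R.* im z R.+ R.0# R.* re z)) ≈ᴳ z
    *-identityˡ z =
         R.trans (R.+-cong (R.*-identityˡ _)
                   (R.trans (R.-‿cong (R.zeroˡ _)) -0#≈0#))
           (R.+-identityʳ _)
      ,ᴳ R.trans (R.+-cong (R.*-identityˡ _) (R.zeroˡ _)) (R.+-identityʳ _)

ℂ : Set
ℂ = Gaussian ℝ

ℂ-commutativeRing : CommutativeRing 0ℓ 0ℓ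
ℂ-commutativeRing = gaussianRing ℝ-commutativeRing

fromReal : ℝ → ℂ
fromReal x = x +i constᴿ 0ℚ

conjugate : ℂ → ℂ
conjugate z = re z +i (-ᴿ im z)

-- r = |z|
IsModulus : ℝ → ℂ → Set
IsModulus r z = IsSqrt r (re z *ᴿ re z +ᴿ im z *ᴿ im z)

-- z ∈ 𝕋
OnUnitCircle : ℂ → Set
OnUnitCircle z = IsModulus (constᴿ 1ℚ) z

------------------------------------------------------------------------
-- The polynomial ring R[x₀, …, xᵤ₋₁], as the free commutative
-- R-algebra on u generators: terms modulo the least congruence that
-- satisfies the commutative ring axioms and makes con a homomorphism.

infixl 6 _+ᴾ_
infixl 7 _*ᴾ_
infix  8 -ᴾ_

data Poly (A : Set a) (u : ℕ) : Set a where
  con  : A → Poly A u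
  var  : Fin u → Poly A u
  _+ᴾ_ : Poly A u → Poly A u → Poly A u
  _*ᴾ_ : Poly A u → Poly A u → Poly A u
  -ᴾ_  : Poly A u → Poly A u

mapPoly : (A → B) → Poly A u → Poly B u
mapPoly f (con x)  = con (f x)
mapPoly f (var i)  = var i
mapPoly f (p +ᴾ q) = mapPoly f p +ᴾ mapPoly f q
mapPoly f (p *ᴾ q) = mapPoly f p *ᴾ mapPoly f q
mapPoly f (-ᴾ p)   = -ᴾ mapPoly f p

module _ (R : CommutativeRing c ℓ) (u : ℕ) where

  private
    module R = CommutativeRing R
    P : Set c
    P = Poly R.Carrier u

  infix 4 _≈ᴾ_

  data _≈ᴾ_ : P → P → Set (c ⊔ ℓ) where
    ≈ᴾ-refl      : ∀ {p} → p ≈ᴾ p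
    ≈ᴾ-sym       : ∀ {p q} → p ≈ᴾ q → q ≈ᴾ p
    ≈ᴾ-trans     : ∀ {p q r} → p ≈ᴾ q → q ≈ᴾ r → p ≈ᴾ r
    +ᴾ-cong      : ∀ {p p′ q q′} → p ≈ᴾ p′ → q ≈ᴾ q′ → p +ᴾ q ≈ᴾ p′ +ᴾ q′
    *ᴾ-cong      : ∀ {p p′ q q′} → p ≈ᴾ p′ → q ≈ᴾ q′ → p *ᴾ q ≈ᴾ p′ *ᴾ q′
    -ᴾ-cong      : ∀ {p p′} → p ≈ᴾ p′ → -ᴾ p ≈ᴾ -ᴾ p′
    +ᴾ-assoc     : ∀ p q r → (p +ᴾ q) +ᴾ r ≈ᴾ p +ᴾ (q +ᴾ r)
    +ᴾ-comm      : ∀ p q → p +ᴾ q ≈ᴾ q +ᴾ p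
    +ᴾ-identityˡ : ∀ p → con R.0# +ᴾ p ≈ᴾ p
    -ᴾ-inverseˡ  : ∀ p → (-ᴾ p) +ᴾ p ≈ᴾ con R.0#
    *ᴾ-assoc     : ∀ p q r → (p *ᴾ q) *ᴾ r ≈ᴾ p *ᴾ (q *ᴾ r)
    *ᴾ-comm      : ∀ p q → p *ᴾ q ≈ᴾ q *ᴾ p
    *ᴾ-identityˡ : ∀ p → con R.1# *ᴾ p ≈ᴾ p
    distribᴾˡ    : ∀ p q r → p *ᴾ (q +ᴾ r) ≈ᴾ p *ᴾ q +ᴾ p *ᴾ r
    con-cong     : ∀ {x y} → x R.≈ y → con x ≈ᴾ con y
    con-+        : ∀ x y → con (x R.+ y) ≈ᴾ con x +ᴾ con y
    con-*        : ∀ x y → con (x R.* y) ≈ᴾ con x *ᴾ con y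

  polynomialRing : CommutativeRing c (c ⊔ ℓ)
  polynomialRing = record
    { Carrier = P ; _≈_ = _≈ᴾ_ ; _+_ = _+ᴾ_ ; _*_ = _*ᴾ_ ; -_ = -ᴾ_
    ; 0# = con R.0# ; 1# = con R.1#
    ; isCommutativeRing = record
      { isRing = record
        { +-isAbelianGroup = record
          { isGroup = record
            { isMonoid = record
              { isSemigroup = record
                { isMagma = record
                  { isEquivalence = record
                    { refl = ≈ᴾ-refl ; sym = ≈ᴾ-sym ; trans = ≈ᴾ-trans }
                  ; ∙-cong = +ᴾ-cong
                  }
                ; assoc = +ᴾ-assoc
                }
              ; identity = +ᴾ-identityˡ
                         , λ p → ≈ᴾ-trans (+ᴾ-comm p _) (+ᴾ-identityˡ p)
              }
            ; inverse = -ᴾ-inverseˡ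
                      , λ p → ≈ᴾ-trans (+ᴾ-comm p _) (-ᴾ-inverseˡ p)
            ; ⁻¹-cong = -ᴾ-cong
            }
          ; comm = +ᴾ-comm
          }
        ; *-cong = *ᴾ-cong
        ; *-assoc = *ᴾ-assoc
        ; *-identity = *ᴾ-identityˡ
                     , λ p → ≈ᴾ-trans (*ᴾ-comm p _) (*ᴾ-identityˡ p)
        ; distrib = distribᴾˡ
                  , λ p q r → ≈ᴾ-trans (*ᴾ-comm (q +ᴾ r) p)
                      (≈ᴾ-trans (distribᴾˡ p q r)
                        (+ᴾ-cong (*ᴾ-comm p q) (*ᴾ-comm p r)))
        }
      ; *-comm = *ᴾ-comm
      }
    }

ℝ[_] ℂ[_] : ℕ → CommutativeRing 0ℓ 0ℓ
ℝ[ u ] = polynomialRing ℝ-commutativeRing u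
ℂ[ u ] = polynomialRing ℂ-commutativeRing u

-- The indeterminates are real, so conjugation fixes them.
conjugateᴾ : Poly ℂ u → Poly ℂ u
conjugateᴾ = mapPoly conjugate

Matrix : Set a → ℕ → Set a
Matrix A n = Vector (Vector A n) n

module Mat (R : CommutativeRing c ℓ) where

  open CommutativeRing R
  open SemiringMult semiring using () renaming (_×_ to _·_)
  open SemiringSum semiring using (sum)

  infix  4 _≈ₘ_
  infixl 7 _*ₘ_
  infixl 7 _•ₘ_

  _≈ₘ_ : Matrix Carrier n → Matrix Carrier n → Set ℓ
  X ≈ₘ Y = ∀ i j → X i j ≈ Y i j

  _*ₘ_ : Matrix Carrier n → Matrix Carrier n → Matrix Carrier n
  (X *ₘ Y) i j = sum (λ l → X i l * Y l j)

  _•ₘ_ : Carrier → Matrix Carrier n → Matrix Carrier n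
  (x •ₘ X) i j = x * X i j

  Iₘ : Matrix Carrier n
  Iₘ i j = if does (i Fin.≟ j) then 1# else 0#

  fromℕ : ℕ → Carrier
  fromℕ k = k · 1#

transpose : Matrix A n → Matrix A n
transpose X i j = X j i

module ℤM = Mat ℤ.+-*-commutativeRing
module ℝM = Mat ℝ-commutativeRing
module ℂM = Mat ℂ-commutativeRing
module ℝ[X]M (u : ℕ) = Mat ℝ[ u ]
module ℂ[X]M (u : ℕ) = Mat ℂ[ u ]

-- X ᴴ and X ᴴᴾ are the conjugate transpose X*.
_ᴴ : Matrix ℂ n → Matrix ℂ n
(X ᴴ) i j = conjugate (X j i)

_ᴴᴾ : Matrix (Poly ℂ u) n → Matrix (Poly ℂ u) n
(X ᴴᴾ) i j = conjugateᴾ (X j i)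

-- s₀x₀² + ⋯ + sᵤ₋₁xᵤ₋₁²
quadraticForm : (R : CommutativeRing c ℓ) → Vector ℕ u → Poly (CommutativeRing.Carrier R) u
quadraticForm {u = u} R s = sum (λ i → s i · (var i *ᴾ var i))
  where
  open CommutativeRing (polynomialRing R u)
  open SemiringMult semiring using () renaming (_×_ to _·_)
  open SemiringSum semiring using (sum)

record IsWeighingMatrix (k : ℕ) (W : Matrix ℤ n) : Set where
  open ℤM
  field
    entries     : ∀ i j → W i j ≡ ℤ.0ℤ ⊎ W i j ≡ ℤ.1ℤ ⊎ W i j ≡ ℤ.-1ℤ
    orthogonal  : W *ₘ transpose W ≈ₘ ℤ.+ k •ₘ Iₘ

record IsOrthogonalDesign (s : Vector ℕ u) (D : Matrix (Poly ℝ u) n) : Set where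
  open CommutativeRing ℝ[ u ] using (_≈_; 0#)
  open ℝ[X]M u
  field
    entries    : ∀ i j → D i j ≈ 0# ⊎ (∃ λ l → D i j ≈ var l ⊎ D i j ≈ -ᴾ var l)
    orthogonal : D *ₘ transpose D ≈ₘ quadraticForm ℝ-commutativeRing s •ₘ Iₘ

HasZeroOrUnitEntries : Matrix ℂ n → Set
HasZeroOrUnitEntries W = ∀ i j → W i j ≈ 0# ⊎ OnUnitCircle (W i j)
  where open CommutativeRing ℂ-commutativeRing

record IsUnitWeighingMatrix (k : ℕ) (W : Matrix ℂ n) : Set where
  open ℂM
  field
    entries    : HasZeroOrUnitEntries W
    orthogonal : W *ₘ (W ᴴ) ≈ₘ fromℕ k •ₘ Iₘ

record IsUnitOrthogonalDesign (s : Vector ℕ u) (D : Matrix (Poly ℂ u) n) : Set where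
  open CommutativeRing ℂ[ u ] using (_≈_; 0#)
  open ℂ[X]M u
  field
    entries    : ∀ i j → D i j ≈ 0# ⊎
                   (∃₂ λ ε l → OnUnitCircle ε × D i j ≈ con ε *ᴾ var l)
    orthogonal : D *ₘ (D ᴴᴾ) ≈ₘ quadraticForm ℂ-commutativeRing s •ₘ Iₘ

-- (1/√a) W₁W₂* is a unit weighing matrix of weight l.
QuasiUnbiased : (l : ℕ) (a : ℝ) (W₁ W₂ : Matrix ℂ n) → Set
QuasiUnbiased l a W₁ W₂ =
  ∃ λ t → IsInverseSqrt t a × IsUnitWeighingMatrix l (fromReal t •ₘ (W₁ *ₘ (W₂ ᴴ)))
  where open ℂM

-- D₁D₂* = ((s₀x₀² + ⋯ + sᵤ₋₁xᵤ₋₁²)/√α) W with W having entries in {0} ∪ 𝕋.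
Unbiased : (s : Vector ℕ u) (α : ℝ) (D₁ D₂ : Matrix (Poly ℂ u) n) → Set
Unbiased {u} s α D₁ D₂ =
  ∃₂ λ t W → IsInverseSqrt t α × HasZeroOrUnitEntries W ×
    D₁ *ₘ (D₂ ᴴᴾ) ≈ₘ
      (con (fromReal t) *ᴾ quadraticForm ℂ-commutativeRing s) •ₘ (λ i j → con (W i j))
  where open ℂ[X]M u

-- A family of N mutually (quasi-)unbiased matrices consists of N
-- different matrices.  This is not implied by the condition on pairs:
-- for some parameters a matrix is (quasi-)unbiased with itself.

record MutuallyQuasiUnbiased (n k l : ℕ) (a : ℝ) {N : ℕ}
                             (W : Vector (Matrix ℂ n) N) : Set where
  field
    unitWeighing : ∀ i → IsUnitWeighingMatrix k (W i)
    distinct     : ∀ i j → i ≢ j → ¬ (W i ℂM.≈ₘ W j)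
    unbiased     : ∀ i j → i ≢ j → QuasiUnbiased l a (W i) (W j)

record MutuallyUnbiased (n : ℕ) (s : Vector ℕ u) (α : ℝ) {N : ℕ}
                        (D : Vector (Matrix (Poly ℂ u) n) N) : Set where
  open ℂ[X]M u using (_≈ₘ_)
  field
    unitDesign : ∀ i → IsUnitOrthogonalDesign s (D i)
    distinct   : ∀ i j → i ≢ j → ¬ (D i ≈ₘ D j)
    unbiased   : ∀ i j → i ≢ j → Unbiased s α (D i) (D j)

{-# OPTIONS --safe #-}
module Submission where

-- Let F be a field with q elements, and choose m slopes and m abscissas in F;
-- if m < q, take nonzero slopes.  For a slope a, let X a be the matrix whose
-- rows are indexed by pairs (i , c) and whose columns are indexed by points
-- (j , y), with entry W i j if y = a j + c and 0 otherwise.  Two lines with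
-- different slopes meet in at most one point, so the entries of X a (X b)ᵀ
-- are 0 and ±1, and X a (X b)ᵀ is a weighing matrix of weight k².  The designs
-- are X a K with K = D ⊗ I (m < q) or K = I ⊗ D (m = q); then
-- (X a K) (X b K)ᵀ = (s₁x₁² + ⋯ + sᵤxᵤ²) X a (X b)ᵀ.  All matrices are real,
-- and the weighing matrices result from the designs by setting xᵢ = 1 for
-- i ∈ S and xᵢ = 0 otherwise.
--
-- For q = pᵉ, the field F is a quotient of R = 𝔽ₚ[x] / (x ^ q - x), in which
-- z ^ q = z holds identically.  The product g of the differences
-- x ^ (p ^ d) - x with 0 < d < e is nonzero in R, for it has degree < q.  So
-- there is a field quotient F of R in which g is nonzero.  In F, the image of
-- x has e different conjugates, so its powers 1, x, …, x ^ (e - 1) are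
-- independent over 𝔽ₚ and F has at least q elements; it has at most q, since
-- all of them are roots of X ^ q - X.

open import Level using (Level; 0ℓ; _⊔_)
open import Algebra.Bundles using (CommutativeRing)
open import Algebra.Morphism.Structures using (module RingMorphisms)
import Algebra.Properties.CommutativeSemigroup as CommutativeSemigroupProperties
import Algebra.Properties.CommutativeSemiring.Binomial as Binomial
import Algebra.Properties.CommutativeSemiring.Exp as Exp
import Algebra.Properties.Ring as RingProperties
import Algebra.Properties.Semiring.Mult as SemiringMult
import Algebra.Properties.Semiring.Sum as SemiringSum
open import Data.Bool.Base using (if_then_else_)
open import Data.Fin.Base as Fin using (Fin; zero; suc; toℕ; combine; remQuot; _↑ˡ_; _↑ʳ_)
import Data.Fin.Properties as Fin
open import Data.Fin.Subset using (Subset; Nonempty; ⊤; inside; outside)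
open import Data.Fin.Subset.Properties using (∈⊤)
open import Data.Integer.Base as ℤ using (ℤ)
import Data.Integer.DivMod as ℤ
open import Data.Integer.Divisibility.Signed as Signed using (divides; ∣m∣n⇒∣m+n; ∣m⇒∣-m; ∣n⇒∣m*n)
import Data.Integer.Properties as ℤ
import Data.Integer.Solver as ℤ
open import Data.Nat.Base as ℕ using (ℕ; zero; suc; z≤n; s≤s; _!)
open import Data.Nat.Combinatorics using (_C_; k![n∸k]!∣n!; nCn≡1)
open import Data.Nat.Combinatorics.Specification using (nCk≡n!/k![n-k]!)
open import Data.Nat.Coprimality using (coprime-Bézout; prime⇒coprime)
open import Data.Nat.DivMod using (m/n*n≡m)
open import Data.Nat.Divisibility using (_∣_; divides; ∣⇒≤; m∣m*n)
open import Data.Nat.GCD using (module Bézout)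
open import Data.Nat.Primality using (Prime; euclidsLemma; prime⇒nonZero; prime⇒nonTrivial)
import Data.Nat.Properties as ℕ
open import Data.Product.Base using (∃; ∃₂; _×_; _,_; proj₁; proj₂)
open import Data.Rational.Base as ℚ using (ℚ; 0ℚ; 1ℚ)
import Data.Rational.Properties as ℚ
open import Data.Sum.Base using (_⊎_; inj₁; inj₂; [_,_]′)
import Data.Vec.Base as Vec
open import Data.Vec.Functional using (Vector)
open import Data.Vec.Properties using ([]=⇒lookup)
open import Function.Base using (_∘_)
open import Relation.Binary.Definitions using (Decidable; tri<; tri≈; tri>)
open import Relation.Binary.PropositionalEquality as ≡ using (_≡_; _≢_)
import Relation.Binary.Reasoning.Setoid as SetoidReasoning
open import Relation.Binary.Structures using (IsEquivalence)
open import Relation.Nullary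
  using (¬_; ¬?; Dec; yes; no; contradiction; decidable-stable; _×-dec_)

open import Defs

-- The entries of X a K must be single terms ±xᵢ or 0, and this decides the form of K. In X a (D ⊗
-- I), the line of a row meets a given height in at most one point unless its slope is zero. For m =
-- q every element of F is a slope, zero included, and a horizontal line would produce a whole entry
-- of W D. But then D has order q and can act on the second coordinate instead, where a line has one
-- point over each abscissa.
--
-- The designs must also be shown to differ. The factor K disappears from Gram products, so X a K =
-- X b K forces X b (X a)ᵀ = k I, and this forces X a = X b.
--
-- The passage through R takes the place of an irreducible polynomial of degree e. As z ^ q = z,
-- every z ^ (q - 1) is idempotent, and the field quotient is found by multiplying g with such
-- idempotents as long as the product remains nonzero. The quotient is by the annihilator of that
-- product f: y and z are identified when f y = f z, so equality stays decidable.

private variable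
  a b c ℓ ℓ₁ ℓ₂ : Level

-- Sums and polynomials

module FiniteSums (R : CommutativeRing c ℓ) where
  open CommutativeRing R hiding (zero)
  open SemiringSum semiring public
  open Mat R using (Iₘ) public
  open SetoidReasoning setoid

  sum-zero : ∀ {n} {f : Vector Carrier n} → (∀ i → f i ≈ 0#) → sum f ≈ 0#
  sum-zero {n} f≈0 = trans (sum-cong-≋ f≈0) (sum-replicate-zero n)

  Iₘ-diagonal : ∀ {n} (i : Fin n) → Iₘ i i ≡ 1#
  Iₘ-diagonal i with i Fin.≟ i
  ... | yes _  = ≡.refl
  ... | no i≢i = contradiction ≡.refl i≢i

  Iₘ-off : ∀ {n} {i j : Fin n} → i ≢ j → Iₘ i j ≡ 0#
  Iₘ-off {i = i} {j} i≢j with i Fin.≟ j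
  ... | yes i≡j = contradiction i≡j i≢j
  ... | no _    = ≡.refl

  Iₘ-sym : ∀ {n} (i j : Fin n) → Iₘ i j ≡ Iₘ j i
  Iₘ-sym i j with i Fin.≟ j
  ... | yes ≡.refl = ≡.sym (Iₘ-diagonal i)
  ... | no i≢j     = ≡.sym (Iₘ-off (i≢j ∘ ≡.sym))

  sum-single : ∀ {n} (i : Fin n) {f : Vector Carrier n} →
               (∀ j → j ≢ i → f j ≈ 0#) → sum f ≈ f i
  sum-single zero {f} f≈0 =
    trans (+-congˡ (sum-zero λ j → f≈0 (suc j) λ ())) (+-identityʳ _)
  sum-single (suc i) {f} f≈0 =
    trans (+-cong (f≈0 zero λ ()) (sum-single i λ j j≢i → f≈0 (suc j) (j≢i ∘ Fin.suc-injective)))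
          (+-identityˡ _)

  sum-Iₘ : ∀ {n} (i : Fin n) (f : Vector Carrier n) → sum (λ j → Iₘ i j * f j) ≈ f i
  sum-Iₘ i f = begin
    sum (λ j → Iₘ i j * f j)
      ≈⟨ sum-single i (λ j j≢i → trans (*-congʳ (reflexive (Iₘ-off (j≢i ∘ ≡.sym)))) (zeroˡ _)) ⟩
    Iₘ i i * f i              ≈⟨ *-congʳ (reflexive (Iₘ-diagonal i)) ⟩
    1# * f i                  ≈⟨ *-identityˡ _ ⟩
    f i                       ∎

-- Polynomials of degree < n, given by their coefficients.
module Evaluation (R : CommutativeRing c ℓ) where
  open CommutativeRing R hiding (zero)
  open FiniteSums R
  open Exp commutativeSemiring using (_^_)
  open RingProperties ring using (+-inverseʳ-unique; x∙y⁻¹≈ε⇒x≈y)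
  open CommutativeSemigroupProperties +-commutativeSemigroup using (interchange)
  open SetoidReasoning setoid

  eval : ∀ {n} → Vector Carrier n → Carrier → Carrier
  eval {zero}  f x = 0#
  eval {suc n} f x = f zero + x * eval (f ∘ suc) x

  eval-sum : ∀ {n} (f : Vector Carrier n) x → eval f x ≈ sum (λ i → f i * x ^ toℕ i)
  eval-sum {zero}  f x = refl
  eval-sum {suc n} f x = +-cong (sym (*-identityʳ _)) (begin
    x * eval (f ∘ suc) x                         ≈⟨ *-congˡ (eval-sum (f ∘ suc) x) ⟩
    x * sum (λ i → f (suc i) * x ^ toℕ i)        ≈⟨ *-distribˡ-sum x (λ i → f (suc i) * x ^ toℕ i) ⟩
    sum (λ i → x * (f (suc i) * x ^ toℕ i))      ≈⟨ sum-cong-≋ (λ i → begin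
      x * (f (suc i) * x ^ toℕ i)                  ≈⟨ *-assoc _ _ _ ⟨
      x * f (suc i) * x ^ toℕ i                    ≈⟨ *-congʳ (*-comm _ _) ⟩
      f (suc i) * x * x ^ toℕ i                    ≈⟨ *-assoc _ _ _ ⟩
      f (suc i) * (x * x ^ toℕ i)                  ∎) ⟩
    sum (λ i → f (suc i) * (x * x ^ toℕ i))      ∎)

  eval-cong : ∀ {n} {f g : Vector Carrier n} {x y} → (∀ i → f i ≈ g i) → x ≈ y → eval f x ≈ eval g y
  eval-cong {zero}  f≈g x≈y = refl
  eval-cong {suc n} f≈g x≈y = +-cong (f≈g zero) (*-cong x≈y (eval-cong (f≈g ∘ suc) x≈y))

  eval-+ : ∀ {n} (f g : Vector Carrier n) x → eval (λ i → f i + g i) x ≈ eval f x + eval g x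
  eval-+ {zero}  f g x = sym (+-identityˡ _)
  eval-+ {suc n} f g x = begin
    (f zero + g zero) + x * eval (λ i → f (suc i) + g (suc i)) x
      ≈⟨ +-congˡ (*-congˡ (eval-+ (f ∘ suc) (g ∘ suc) x)) ⟩
    (f zero + g zero) + x * (eval (f ∘ suc) x + eval (g ∘ suc) x)
      ≈⟨ +-congˡ (distribˡ _ _ _) ⟩
    (f zero + g zero) + (x * eval (f ∘ suc) x + x * eval (g ∘ suc) x)       ≈⟨ interchange _ _ _ _ ⟩
    (f zero + x * eval (f ∘ suc) x) + (g zero + x * eval (g ∘ suc) x)       ∎

  eval-zero : ∀ {n} {f : Vector Carrier n} {x} → (∀ i → f i ≈ 0#) → eval f x ≈ 0#
  eval-zero {zero}  f≈0 = refl
  eval-zero {suc n} f≈0 =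
    trans (+-cong (f≈0 zero) (trans (*-congˡ (eval-zero (f≈0 ∘ suc))) (zeroʳ _))) (+-identityˡ _)

  eval-neg : ∀ {n} (f : Vector Carrier n) x → eval (λ i → - f i) x ≈ - eval f x
  eval-neg f x = +-inverseʳ-unique (eval f x) (eval (λ i → - f i) x)
    (trans (sym (eval-+ f (λ i → - f i) x)) (eval-zero λ i → -‿inverseʳ (f i)))

  -- The quotient of f by x - a.
  quotient : ∀ {n} → Vector Carrier (suc n) → Carrier → Vector Carrier n
  quotient {suc n} f a zero    = eval (f ∘ suc) a
  quotient {suc n} f a (suc i) = quotient (f ∘ suc) a i

  -- Synthetic division. If f = f₀ + x F, then the remainder F(a) becomes the constant coefficient
  -- of the quotient, because x F(a) = a F(a) + (x - a) F(a).
  eval-quotient : ∀ {n} (f : Vector Carrier (suc n)) a x →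
                  eval f x ≈ eval f a + (x - a) * eval (quotient f a) x
  eval-quotient {zero} f a x = begin
    f zero + x * 0#                        ≈⟨ +-congˡ (zeroʳ _) ⟩
    f zero + 0#                            ≈⟨ +-congˡ (zeroʳ _) ⟨
    f zero + a * 0#                        ≈⟨ +-identityʳ _ ⟨
    (f zero + a * 0#) + 0#                 ≈⟨ +-congˡ (zeroʳ _) ⟨
    (f zero + a * 0#) + (x - a) * 0#       ∎
  eval-quotient {suc n} f a x = begin
    f zero + x * eval (f ∘ suc) x
      ≈⟨ +-congˡ (*-congˡ (eval-quotient (f ∘ suc) a x)) ⟩
    f zero + x * (F + (x - a) * G)                 ≈⟨ +-congˡ (distribˡ _ _ _) ⟩
    f zero + (x * F + x * ((x - a) * G))           ≈⟨ +-congˡ (+-cong x*F x*[x-a]*G) ⟩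
    f zero + ((a * F + (x - a) * F) + (x - a) * (x * G)) ≈⟨ +-congˡ (+-assoc _ _ _) ⟩
    f zero + (a * F + ((x - a) * F + (x - a) * (x * G))) ≈⟨ +-assoc _ _ _ ⟨
    (f zero + a * F) + ((x - a) * F + (x - a) * (x * G)) ≈⟨ +-congˡ (distribˡ _ _ _) ⟨
    (f zero + a * F) + (x - a) * (F + x * G)       ∎
    where
    F = eval (f ∘ suc) a
    G = eval (quotient (f ∘ suc) a) x
    x*F : x * F ≈ a * F + (x - a) * F
    x*F = begin
      x * F                    ≈⟨ *-congʳ (+-identityˡ x) ⟨
      (0# + x) * F             ≈⟨ *-congʳ (+-congʳ (-‿inverseʳ a)) ⟨
      ((a - a) + x) * F        ≈⟨ *-congʳ (+-assoc _ _ _) ⟩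
      (a + (- a + x)) * F      ≈⟨ *-congʳ (+-congˡ (+-comm _ _)) ⟩
      (a + (x - a)) * F        ≈⟨ distribʳ _ _ _ ⟩
      a * F + (x - a) * F      ∎
    x*[x-a]*G : x * ((x - a) * G) ≈ (x - a) * (x * G)
    x*[x-a]*G = begin
      x * ((x - a) * G)  ≈⟨ *-assoc _ _ _ ⟨
      x * (x - a) * G    ≈⟨ *-congʳ (*-comm _ _) ⟩
      (x - a) * x * G    ≈⟨ *-assoc _ _ _ ⟩
      (x - a) * (x * G)  ∎

  -- The coefficients of `quotient f a` are the values at a of the successive tails of f, so each of
  -- them is the remainder of the next tail. Division by x - a therefore loses nothing, and
  -- coefficients can be recovered from quotient and remainder.
  quotient-zero : ∀ {n} (f : Vector Carrier (suc n)) a → eval f a ≈ 0# →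
                  (∀ i → quotient f a i ≈ 0#) → ∀ i → f i ≈ 0#
  quotient-zero {zero}  f a fa≈0 q≈0 zero = begin
    f zero            ≈⟨ +-identityʳ _ ⟨
    f zero + 0#       ≈⟨ +-congˡ (zeroʳ _) ⟨
    f zero + a * 0#   ≈⟨ fa≈0 ⟩
    0#                ∎
  quotient-zero {suc n} f a fa≈0 q≈0 zero = begin
    f zero                           ≈⟨ +-identityʳ _ ⟨
    f zero + 0#                      ≈⟨ +-congˡ (zeroʳ _) ⟨
    f zero + a * 0#                  ≈⟨ +-congˡ (*-congˡ (q≈0 zero)) ⟨
    f zero + a * eval (f ∘ suc) a    ≈⟨ fa≈0 ⟩
    0#                               ∎
  quotient-zero {suc n} f a fa≈0 q≈0 (suc i) =
    quotient-zero (f ∘ suc) a (q≈0 zero) (q≈0 ∘ suc) i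

  module _ (domain : ∀ {x y} → x * y ≈ 0# → x ≈ 0# ⊎ y ≈ 0#) where

    -- With n coefficients, the degree is below the number of roots. Division by x - a₀ leaves the
    -- other roots to the quotient, since in a domain the nonzero factor aᵢ - a₀ can be cancelled.
    too-many-roots : ∀ {n} (f a : Vector Carrier n) → (∀ i j → a i ≈ a j → i ≡ j) →
                     (∀ i → eval f (a i) ≈ 0#) → ∀ i → f i ≈ 0#
    too-many-roots {suc n} f a distinct root =
      quotient-zero f (a zero) (root zero)
        (too-many-roots (quotient f (a zero)) (a ∘ suc)
          (λ i j eq → Fin.suc-injective (distinct (suc i) (suc j) eq))
          λ i → [ (λ eq → contradiction (distinct (suc i) zero (x∙y⁻¹≈ε⇒x≈y _ _ eq)) λ ()) , (λ eq → eq) ]′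
                (domain (begin
                  (a (suc i) - a zero) * eval (quotient f (a zero)) (a (suc i))  ≈⟨ +-identityˡ _ ⟨
                  0# + (a (suc i) - a zero) * eval (quotient f (a zero)) (a (suc i))
                    ≈⟨ +-congʳ (root zero) ⟨
                  eval f (a zero) + (a (suc i) - a zero) * eval (quotient f (a zero)) (a (suc i))
                    ≈⟨ eval-quotient f (a zero) (a (suc i)) ⟨
                  eval f (a (suc i))                                             ≈⟨ root (suc i) ⟩
                  0#                                                             ∎)))

-- Finite fields

prime-∣! : ∀ {p} → Prime p → ∀ n → p ∣ n ! → p ℕ.≤ n
prime-∣! {p} pp zero p∣1 =
  contradiction (ℕ.nonTrivial⇒n>1 p {{prime⇒nonTrivial pp}}) (ℕ.≤⇒≯ (∣⇒≤ p∣1))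
prime-∣! pp (suc n) p∣ with euclidsLemma (suc n) (n !) pp p∣
... | inj₁ p∣1+n = ∣⇒≤ p∣1+n
... | inj₂ p∣n!  = ℕ.m≤n⇒m≤1+n (prime-∣! pp n p∣n!)

-- The prime p divides p ! = (p C k) · k ! · (p - k) !, but neither of the factorials on the right,
-- both being of numbers below p.
prime-∣C : ∀ {p} → Prime p → ∀ {k} → 0 ℕ.< k → k ℕ.< p → p ∣ p C k
prime-∣C {p@(suc p′)} pp {k@(suc k′)} 0<k k<p
  with euclidsLemma (p C k) (k ! ℕ.* (p ℕ.∸ k) !) pp (≡.subst (p ∣_) p!≡ (m∣m*n (p′ !)))
  where
  instance _ = k ℕ.!* (p ℕ.∸ k) !≢0
  p!≡ : p ! ≡ (p C k) ℕ.* (k ! ℕ.* (p ℕ.∸ k) !)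
  p!≡ = ≡.sym (≡.trans
    (≡.cong (ℕ._* (k ! ℕ.* (p ℕ.∸ k) !)) (nCk≡n!/k![n-k]! (ℕ.<⇒≤ k<p)))
    (m/n*n≡m (k![n∸k]!∣n! (ℕ.<⇒≤ k<p))))
... | inj₁ p∣C = p∣C
... | inj₂ p∣k!*[p-k]! with euclidsLemma (k !) ((p ℕ.∸ k) !) pp p∣k!*[p-k]!
...   | inj₁ p∣k!     = contradiction (prime-∣! pp k p∣k!) (ℕ.<⇒≱ k<p)
...   | inj₂ p∣[p-k]! = contradiction (prime-∣! pp (p ℕ.∸ k) p∣[p-k]!) (ℕ.<⇒≱ (ℕ.∸-monoʳ-< 0<k (ℕ.<⇒≤ k<p)))

-- Prime characteristic and the Frobenius map

module Characteristic
  (R : CommutativeRing c ℓ) {p : ℕ} (p-prime : Prime p)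
  (p·1≈0 : CommutativeRing._≈_ R (Mat.fromℕ R p) (CommutativeRing.0# R))
  where

  open CommutativeRing R hiding (zero)
  open FiniteSums R
  open Mat R using (fromℕ) public
  open Evaluation R
  open Exp commutativeSemiring
  open SemiringMult semiring using (×-congʳ; ×-congˡ; ×-assocˡ; ×-assoc-*; ×-homo-1; ×1-homo-*) renaming (_×_ to _·_)
  open RingProperties ring using (+-inverseʳ-unique)
  open SetoidReasoning setoid

  private instance
    p≢0 : ℕ.NonZero p
    p≢0 = prime⇒nonZero p-prime

  p∣n⇒n·x≈0 : ∀ {n} → p ∣ n → ∀ x → n · x ≈ 0#
  p∣n⇒n·x≈0 {n} (divides k n≡k*p) x = begin
    n · x              ≈⟨ ×-congˡ (≡.trans n≡k*p (ℕ.*-comm k p)) ⟩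
    (p ℕ.* k) · x      ≈⟨ ×-assocˡ x p k ⟨
    p · (k · x)        ≈⟨ ×-congʳ p (*-identityˡ _) ⟨
    p · (1# * (k · x)) ≈⟨ ×-assoc-* p 1# (k · x) ⟨
    fromℕ p * (k · x)  ≈⟨ *-congʳ p·1≈0 ⟩
    0# * (k · x)       ≈⟨ zeroˡ _ ⟩
    0#                 ∎

  fromℕ-multiple : ∀ a b → fromℕ b ≈ 0# → fromℕ (a ℕ.* b) ≈ 0#
  fromℕ-multiple a b b≈0 = trans (×1-homo-* a b) (trans (*-congˡ b≈0) (zeroʳ _))

  -- By Bézout, 1 is an integer combination of the coprime numbers n and p, so it would vanish
  -- together with n.
  fromℕ-nonzero : ¬ (1# ≈ 0#) → ∀ {n} → 0 ℕ.< n → n ℕ.< p → ¬ (fromℕ n ≈ 0#)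
  fromℕ-nonzero 1≉0 {n} 0<n n<p n≈0 with coprime-Bézout (prime⇒coprime p-prime {{ℕ.>-nonZero 0<n}} n<p)
  ... | Bézout.+- x y eq = 1≉0 (begin
    1#                                  ≈⟨ +-identityʳ _ ⟨
    1# + 0#                             ≈⟨ +-congˡ (fromℕ-multiple y n n≈0) ⟨
    1# + fromℕ (y ℕ.* n)                ≈⟨ ×-congˡ eq ⟩
    fromℕ (x ℕ.* p)                     ≈⟨ fromℕ-multiple x p p·1≈0 ⟩
    0#                                  ∎)
  ... | Bézout.-+ x y eq = 1≉0 (begin
    1#                                  ≈⟨ +-identityʳ _ ⟨
    1# + 0#                             ≈⟨ +-congˡ (fromℕ-multiple x p p·1≈0) ⟨
    1# + fromℕ (x ℕ.* p)                ≈⟨ ×-congˡ eq ⟩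
    fromℕ (y ℕ.* n)                     ≈⟨ fromℕ-multiple y n n≈0 ⟩
    0#                                  ∎)

  ^p-+ : ∀ x y → (x + y) ^ p ≈ x ^ p + y ^ p
  ^p-+ x y = expand p ≡.refl
    where
    module B = Binomial commutativeSemiring
    -- The exponent is generalised to `n` because splitting off the first and the last binomial term
    -- needs a visible successor.
    expand : ∀ n → n ≡ p → (x + y) ^ n ≈ x ^ n + y ^ n
    expand zero    0≡p = contradiction (≡.sym 0≡p) (ℕ.≢-nonZero⁻¹ p)
    expand (suc n) ≡.refl = begin
      (x + y) ^ suc n                           ≈⟨ B.theorem (suc n) x y ⟩
      term zero + sum (term ∘ suc)
        ≈⟨ +-cong first (trans (sum-single (Fin.fromℕ n) middle) top) ⟩
      y ^ suc n + x ^ suc n                     ≈⟨ +-comm _ _ ⟩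
      x ^ suc n + y ^ suc n                     ∎
      where
      term : Fin (suc (suc n)) → Carrier
      term = B.binomialTerm x y (suc n)
      first : term zero ≈ y ^ suc n
      first = trans (×-homo-1 _) (*-identityˡ _)
      middle : ∀ j → j ≢ Fin.fromℕ n → term (suc j) ≈ 0#
      middle j j≢n = p∣n⇒n·x≈0 (prime-∣C p-prime (s≤s z≤n) (s≤s (ℕ.≤∧≢⇒< (ℕ.≤-pred (Fin.toℕ<n j))
        λ j≡n → j≢n (Fin.toℕ-injective (≡.trans j≡n (≡.sym (Fin.toℕ-fromℕ n))))))) _
      top : term (suc (Fin.fromℕ n)) ≈ x ^ suc n
      top = top′ (Fin.toℕ-fromℕ n)
        where
        top′ : ∀ {k} → k ≡ n → (suc n C suc k) · (x ^ suc k * y ^ (n ℕ.∸ k)) ≈ x ^ suc n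
        top′ ≡.refl = begin
          (suc n C suc n) · (x ^ suc n * y ^ (n ℕ.∸ n)) ≈⟨ ×-congˡ (nCn≡1 (suc n)) ⟩
          1 · (x ^ suc n * y ^ (n ℕ.∸ n))               ≈⟨ ×-homo-1 _ ⟩
          x ^ suc n * y ^ (n ℕ.∸ n)                     ≈⟨ *-congˡ (^-congʳ y (ℕ.n∸n≡0 n)) ⟩
          x ^ suc n * 1#                                ≈⟨ *-identityʳ _ ⟩
          x ^ suc n                                     ∎

  1^ : ∀ n → 1# ^ n ≈ 1#
  1^ zero    = refl
  1^ (suc n) = trans (*-identityˡ _) (1^ n)

  0^ : ∀ n .{{_ : ℕ.NonZero n}} → 0# ^ n ≈ 0#
  0^ (suc n) = zeroˡ _

  -- Fermat's little theorem, by induction on n from the additivity of the p-th power.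
  fromℕ^p : ∀ n → fromℕ n ^ p ≈ fromℕ n
  fromℕ^p zero    = 0^ p
  fromℕ^p (suc n) = trans (^p-+ 1# (fromℕ n)) (+-cong (1^ p) (fromℕ^p n))

  frobenius : ℕ → Carrier → Carrier
  frobenius d x = x ^ (p ℕ.^ d)

  frobenius-suc : ∀ d x → frobenius (suc d) x ≈ frobenius d (x ^ p)
  frobenius-suc d x = sym (^-assocʳ x p (p ℕ.^ d))

  frobenius-cong : ∀ d {x y} → x ≈ y → frobenius d x ≈ frobenius d y
  frobenius-cong d = ^-congˡ (p ℕ.^ d)

  frobenius-compose : ∀ d d′ x → frobenius d (frobenius d′ x) ≈ frobenius (d ℕ.+ d′) x
  frobenius-compose d d′ x = trans (^-assocʳ x (p ℕ.^ d′) (p ℕ.^ d))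
    (^-congʳ x (≡.trans (≡.sym (ℕ.^-distribˡ-+-* p d′ d)) (≡.cong (p ℕ.^_) (ℕ.+-comm d′ d))))

  frobenius-+ : ∀ d x y → frobenius d (x + y) ≈ frobenius d x + frobenius d y
  frobenius-+ zero    x y = trans (*-identityʳ _) (sym (+-cong (*-identityʳ _) (*-identityʳ _)))
  frobenius-+ (suc d) x y = begin
    frobenius (suc d) (x + y)                    ≈⟨ frobenius-suc d _ ⟩
    frobenius d ((x + y) ^ p)                    ≈⟨ frobenius-cong d (^p-+ x y) ⟩
    frobenius d (x ^ p + y ^ p)                  ≈⟨ frobenius-+ d _ _ ⟩
    frobenius d (x ^ p) + frobenius d (y ^ p)    ≈⟨ +-cong (frobenius-suc d x) (frobenius-suc d y) ⟨
    frobenius (suc d) x + frobenius (suc d) y    ∎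

  frobenius-* : ∀ d x y → frobenius d (x * y) ≈ frobenius d x * frobenius d y
  frobenius-* d x y = ^-distrib-* x y (p ℕ.^ d)

  frobenius-0 : ∀ d → frobenius d 0# ≈ 0#
  frobenius-0 d = 0^ (p ℕ.^ d) {{ℕ.m^n≢0 p d}}

  frobenius-neg : ∀ d x → frobenius d (- x) ≈ - frobenius d x
  frobenius-neg d x = +-inverseʳ-unique _ _ (begin
    frobenius d x + frobenius d (- x)  ≈⟨ frobenius-+ d x (- x) ⟨
    frobenius d (x - x)                ≈⟨ frobenius-cong d (-‿inverseʳ x) ⟩
    frobenius d 0#                     ≈⟨ frobenius-0 d ⟩
    0#                                 ∎)

  frobenius-fromℕ : ∀ d n → frobenius d (fromℕ n) ≈ fromℕ n
  frobenius-fromℕ zero    n = *-identityʳ _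
  frobenius-fromℕ (suc d) n =
    trans (frobenius-suc d _) (trans (frobenius-cong d (fromℕ^p n)) (frobenius-fromℕ d n))

  -- If the Frobenius map fixes the coefficients, it acts on the argument alone. Hence conjugates of
  -- a root are again roots, and a ring generated over 𝔽ₚ by a fixed element is fixed elementwise.
  frobenius-eval : ∀ d {n} (f : Vector Carrier n) x → (∀ i → frobenius d (f i) ≈ f i) →
                   frobenius d (eval f x) ≈ eval f (frobenius d x)
  frobenius-eval d {zero}  f x fixed = frobenius-0 d
  frobenius-eval d {suc n} f x fixed = trans (frobenius-+ d _ _)
    (+-cong (fixed zero)
      (trans (frobenius-* d x _) (*-congˡ (frobenius-eval d (f ∘ suc) x (fixed ∘ suc)))))

-- Quotient rings

module _ (R : CommutativeRing c ℓ) where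
  open CommutativeRing R

  module _
    {_~_ : Carrier → Carrier → Set ℓ}
    (~-isEquivalence : IsEquivalence _~_)
    (≈⇒~ : ∀ {x y} → x ≈ y → x ~ y)
    (+-cong~ : ∀ {x y u v} → x ~ y → u ~ v → (x + u) ~ (y + v))
    (*-cong~ : ∀ {x y u v} → x ~ y → u ~ v → (x * u) ~ (y * v))
    (-‿cong~ : ∀ {x y} → x ~ y → (- x) ~ (- y))
    where

    quotientRing : CommutativeRing c ℓ
    quotientRing = record
      { Carrier = Carrier ; _≈_ = _~_ ; _+_ = _+_ ; _*_ = _*_ ; -_ = -_ ; 0# = 0# ; 1# = 1#
      ; isCommutativeRing = record
        { isRing = record
          { +-isAbelianGroup = record
            { isGroup = record
              { isMonoid = record
                { isSemigroup = record
                  { isMagma = record { isEquivalence = ~-isEquivalence ; ∙-cong = +-cong~ }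
                  ; assoc = λ x y z → ≈⇒~ (+-assoc x y z)
                  }
                ; identity = (λ x → ≈⇒~ (+-identityˡ x)) , (λ x → ≈⇒~ (+-identityʳ x))
                }
              ; inverse = (λ x → ≈⇒~ (-‿inverseˡ x)) , (λ x → ≈⇒~ (-‿inverseʳ x))
              ; ⁻¹-cong = -‿cong~
              }
            ; comm = λ x y → ≈⇒~ (+-comm x y)
            }
          ; *-cong = *-cong~
          ; *-assoc = λ x y z → ≈⇒~ (*-assoc x y z)
          ; *-identity = (λ x → ≈⇒~ (*-identityˡ x)) , (λ x → ≈⇒~ (*-identityʳ x))
          ; distrib = (λ x y z → ≈⇒~ (distribˡ x y z)) , (λ x y z → ≈⇒~ (distribʳ x y z))
          }
        ; *-comm = λ x y → ≈⇒~ (*-comm x y)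
        }
      }

module ModAnnihilator (R : CommutativeRing c ℓ) (f : CommutativeRing.Carrier R) where
  open CommutativeRing R hiding (zero)
  open RingProperties ring using (-‿distribʳ-*)
  open SetoidReasoning setoid

  -- The quotient by the annihilator of f: the difference x - y annihilates f exactly when f x = f
  -- y. In this form equality is decidable whenever it is decidable in R.
  R/Ann : CommutativeRing c ℓ
  R/Ann = quotientRing R {λ x y → f * x ≈ f * y}
    (record { refl = refl ; sym = sym ; trans = trans })
    *-congˡ
    (λ {x} {y} {u} {v} x~y u~v → begin
      f * (x + u)      ≈⟨ distribˡ _ _ _ ⟩
      f * x + f * u    ≈⟨ +-cong x~y u~v ⟩
      f * y + f * v    ≈⟨ distribˡ _ _ _ ⟨
      f * (y + v)      ∎)
    (λ {x} {y} {u} {v} x~y u~v → begin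
      f * (x * u)      ≈⟨ *-assoc _ _ _ ⟨
      (f * x) * u      ≈⟨ *-congʳ x~y ⟩
      (f * y) * u      ≈⟨ *-assoc _ _ _ ⟩
      f * (y * u)      ≈⟨ *-congˡ (*-comm _ _) ⟩
      f * (u * y)      ≈⟨ *-assoc _ _ _ ⟨
      (f * u) * y      ≈⟨ *-congʳ u~v ⟩
      (f * v) * y      ≈⟨ *-assoc _ _ _ ⟩
      f * (v * y)      ≈⟨ *-congˡ (*-comm _ _) ⟩
      f * (y * v)      ∎)
    (λ {x} {y} x~y → begin
      f * - x          ≈⟨ -‿distribʳ-* _ _ ⟨
      - (f * x)        ≈⟨ -‿cong x~y ⟩
      - (f * y)        ≈⟨ -‿distribʳ-* _ _ ⟩
      f * - y          ∎)

  private module Q = Exp (CommutativeRing.commutativeSemiring R/Ann)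
  open Exp commutativeSemiring

  R/Ann-^ : ∀ x n → x Q.^ n ≡ x ^ n
  R/Ann-^ x zero    = ≡.refl
  R/Ann-^ x (suc n) = ≡.cong (x *_) (R/Ann-^ x n)

  R/Ann-fromℕ : ∀ n → Mat.fromℕ R/Ann n ≡ Mat.fromℕ R n
  R/Ann-fromℕ zero    = ≡.refl
  R/Ann-fromℕ (suc n) = ≡.cong (1# +_) (R/Ann-fromℕ n)

-- Counting the elements of the field

1<p^e : ∀ {p e} → Prime p → 0 ℕ.< e → 1 ℕ.< p ℕ.^ e
1<p^e {p} {e} p-prime 0<e = ℕ.<-≤-trans (ℕ.nonTrivial⇒n>1 p {{prime⇒nonTrivial p-prime}})
  (≡.subst (ℕ._≤ p ℕ.^ e) (ℕ.^-identityʳ p) (ℕ.^-monoʳ-≤ p {{prime⇒nonZero p-prime}} 0<e))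

-- `conjugate≢` and `x^q≈x` are the two halves of the count: the e conjugates of `generator` give at
-- least p ^ e elements, the roots of X ^ q - X at most as many.
record PrimitiveDomain (p e : ℕ) : Set₁ where
  field
    ring : CommutativeRing 0ℓ 0ℓ
  open CommutativeRing ring public hiding (ring; zero)
  open Mat ring using (fromℕ) public
  open Exp commutativeSemiring using (_^_) public
  field
    _≟_       : Decidable _≈_
    1≉0       : ¬ (1# ≈ 0#)
    p·1≈0     : fromℕ p ≈ 0#
    domain    : ∀ {x y} → x * y ≈ 0# → x ≈ 0# ⊎ y ≈ 0#
    x^q≈x     : ∀ x → x ^ (p ℕ.^ e) ≈ x
    generator : Carrier
    conjugate≢ : ∀ d → 0 ℕ.< d → d ℕ.< e → ¬ (generator ^ (p ℕ.^ d) ≈ generator)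

-- `to` and `from` identify `Fin q` with the carrier modulo `≈`, so that lines become functions on
-- indices, compared by propositional equality.
record FiniteDomain (q : ℕ) : Set₁ where
  field
    ring : CommutativeRing 0ℓ 0ℓ
  open CommutativeRing ring public hiding (ring; zero)
  field
    domain     : ∀ {x y} → x * y ≈ 0# → x ≈ 0# ⊎ y ≈ 0#
    to         : Fin q → Carrier
    from       : Carrier → Fin q
    from-cong  : ∀ {x y} → x ≈ y → from x ≡ from y
    to∘from    : ∀ x → to (from x) ≈ x
    from∘to    : ∀ i → from (to i) ≡ i

finiteDomain : ∀ {p e} → Prime p → 0 ℕ.< e → PrimitiveDomain p e → FiniteDomain (p ℕ.^ e)
finiteDomain {p} {e} p-prime 0<e K = record
  { ring = K.ring ; domain = domain ; to = to ; from = from ; from-cong = from-cong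
  ; to∘from = to∘from ; from∘to = λ i → to-injective (to∘from (to i)) }
  where
  module K = PrimitiveDomain K
  open K hiding (ring)
  open Characteristic K.ring p-prime p·1≈0 using (frobenius; frobenius-cong; frobenius-compose;
    frobenius-+; frobenius-neg; frobenius-0; frobenius-fromℕ; frobenius-eval; fromℕ-nonzero)
  open Evaluation K.ring
  open FiniteSums K.ring
  open RingProperties (CommutativeRing.ring K.ring) using (x∙y⁻¹≈ε⇒x≈y; -0#≈0#)
  open SemiringMult (CommutativeRing.semiring K.ring) using (×-homo-+)
  open SetoidReasoning (CommutativeRing.setoid K.ring)

  q = p ℕ.^ e

  instance
    _ = prime⇒nonZero p-prime

  x^n≈0⇒x≈0 : ∀ n {x} → x ^ n ≈ 0# → x ≈ 0#
  x^n≈0⇒x≈0 zero    1≈0 = contradiction 1≈0 1≉0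
  x^n≈0⇒x≈0 (suc n) x*x^n≈0 with domain x*x^n≈0
  ... | inj₁ x≈0   = x≈0
  ... | inj₂ x^n≈0 = x^n≈0⇒x≈0 n x^n≈0

  -- The map is additive, and its kernel is trivial because a domain has no nilpotent elements.
  frobenius-injective : ∀ d {x y} → frobenius d x ≈ frobenius d y → x ≈ y
  frobenius-injective d {x} {y} eq = x∙y⁻¹≈ε⇒x≈y _ _ (x^n≈0⇒x≈0 (p ℕ.^ d) (begin
    frobenius d (x - y)               ≈⟨ frobenius-+ d x (- y) ⟩
    frobenius d x + frobenius d (- y) ≈⟨ +-cong eq (frobenius-neg d y) ⟩
    frobenius d y - frobenius d y     ≈⟨ -‿inverseʳ _ ⟩
    0#                                ∎))

  -- Cancelling the injective `frobenius i` leaves the generator equal to its conjugate of index j -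
  -- i.
  conjugates-< : ∀ {i j} → i ℕ.< j → j ℕ.< e → ¬ (frobenius i generator ≈ frobenius j generator)
  conjugates-< {i} {j} i<j j<e eq =
    conjugate≢ (j ℕ.∸ i) (ℕ.m<n⇒0<n∸m i<j) (ℕ.≤-<-trans (ℕ.m∸n≤m j i) j<e)
      (frobenius-injective i (begin
        frobenius i (frobenius (j ℕ.∸ i) generator) ≈⟨ frobenius-compose i (j ℕ.∸ i) generator ⟩
        frobenius (i ℕ.+ (j ℕ.∸ i)) generator
          ≡⟨ ≡.cong (λ d → frobenius d generator) (ℕ.m+[n∸m]≡n (ℕ.<⇒≤ i<j)) ⟩
        frobenius j generator                       ≈⟨ eq ⟨
        frobenius i generator                       ∎))

  conjugates-distinct : ∀ (i j : Fin e) → frobenius (toℕ i) generator ≈ frobenius (toℕ j) generator → i ≡ j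
  conjugates-distinct i j eq with ℕ.<-cmp (toℕ i) (toℕ j)
  ... | tri< i<j _ _ = contradiction eq (conjugates-< i<j (Fin.toℕ<n j))
  ... | tri≈ _ i≡j _ = Fin.toℕ-injective i≡j
  ... | tri> _ _ j<i = contradiction (sym eq) (conjugates-< j<i (Fin.toℕ<n i))

  fromℕ-injective-< : ∀ {a b} → a ℕ.< b → b ℕ.< p → ¬ (fromℕ a ≈ fromℕ b)
  fromℕ-injective-< {a} {b} a<b b<p eq =
    fromℕ-nonzero 1≉0 (ℕ.m<n⇒0<n∸m a<b) (ℕ.≤-<-trans (ℕ.m∸n≤m b a) b<p)
      (begin
        fromℕ (b ℕ.∸ a)                               ≈⟨ +-identityˡ _ ⟨
        0# + fromℕ (b ℕ.∸ a)                          ≈⟨ +-congʳ (-‿inverseˡ (fromℕ a)) ⟨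
        (- fromℕ a + fromℕ a) + fromℕ (b ℕ.∸ a)       ≈⟨ +-assoc _ _ _ ⟩
        - fromℕ a + (fromℕ a + fromℕ (b ℕ.∸ a))       ≈⟨ +-congˡ (×-homo-+ 1# a (b ℕ.∸ a)) ⟨
        - fromℕ a + fromℕ (a ℕ.+ (b ℕ.∸ a))
          ≡⟨ ≡.cong (λ n → - fromℕ a + fromℕ n) (ℕ.m+[n∸m]≡n (ℕ.<⇒≤ a<b)) ⟩
        - fromℕ a + fromℕ b                           ≈⟨ +-congˡ eq ⟨
        - fromℕ a + fromℕ a                           ≈⟨ -‿inverseˡ _ ⟩
        0#                                            ∎)

  fromℕ-injective : ∀ (i j : Fin p) → fromℕ (toℕ i) ≈ fromℕ (toℕ j) → i ≡ j
  fromℕ-injective i j eq with ℕ.<-cmp (toℕ i) (toℕ j)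
  ... | tri< i<j _ _ = contradiction eq (fromℕ-injective-< i<j (Fin.toℕ<n j))
  ... | tri≈ _ i≡j _ = Fin.toℕ-injective i≡j
  ... | tri> _ _ j<i = contradiction (sym eq) (fromℕ-injective-< j<i (Fin.toℕ<n i))

  -- Base-p digits, read as coefficients in 𝔽ₚ; `to` then runs through the polynomials of degree < e
  -- in the generator.
  digits : Fin q → Vector Carrier e
  digits i j = fromℕ (toℕ (Fin.finToFun {p} {e} i j))

  to : Fin q → Carrier
  to i = eval (digits i) generator

  -- The Frobenius conjugates of the generator are e distinct roots of a
  -- polynomial of degree < e.
  to-injective : ∀ {i j} → to i ≈ to j → i ≡ j
  to-injective {i} {j} eq = ≡.trans (≡.sym (Fin.funToFin-finToFin {e} {p} i))
    (≡.trans (funToFin-cong (λ l → fromℕ-injective _ _ (x∙y⁻¹≈ε⇒x≈y _ _ (difference≈0 l))))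
      (Fin.funToFin-finToFin {e} {p} j))
    where
    funToFin-cong : ∀ {m n} {f g : Fin m → Fin n} → (∀ l → f l ≡ g l) → Fin.funToFin f ≡ Fin.funToFin g
    funToFin-cong {zero}  f≗g = ≡.refl
    funToFin-cong {suc m} f≗g = ≡.cong₂ Fin.combine (f≗g zero) (funToFin-cong (f≗g ∘ suc))
    difference : Vector Carrier e
    difference l = digits i l - digits j l
    root : eval difference generator ≈ 0#
    root = begin
      eval difference generator
        ≈⟨ eval-+ (digits i) (λ l → - digits j l) generator ⟩
      to i + eval (λ l → - digits j l) generator
        ≈⟨ +-cong eq (eval-neg (digits j) generator) ⟩
      to j - to j                                                       ≈⟨ -‿inverseʳ _ ⟩
      0#                                                                ∎
    fixed : ∀ d l → frobenius d (difference l) ≈ difference l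
    fixed d l = trans (frobenius-+ d _ _)
      (+-cong (frobenius-fromℕ d (toℕ (Fin.finToFun {p} {e} i l)))
          (trans (frobenius-neg d _) (-‿cong (frobenius-fromℕ d (toℕ (Fin.finToFun {p} {e} j l))))))
    difference≈0 : ∀ l → difference l ≈ 0#
    difference≈0 = too-many-roots domain difference (λ l → frobenius (toℕ l) generator) conjugates-distinct
      λ l → begin
        eval difference (frobenius (toℕ l) generator)
          ≈⟨ frobenius-eval (toℕ l) difference generator (fixed (toℕ l)) ⟨
        frobenius (toℕ l) (eval difference generator) ≈⟨ frobenius-cong (toℕ l) root ⟩
        frobenius (toℕ l) 0#                          ≈⟨ frobenius-0 (toℕ l) ⟩
        0#                                            ∎

  1<q : 1 ℕ.< q
  1<q = 1<p^e p-prime 0<e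

  x^q-x : Vector Carrier (suc q)
  x^q-x i = Iₘ (Fin.fromℕ q) i - Iₘ (Fin.fromℕ< {1} (s≤s (ℕ.<⇒≤ 1<q))) i

  x^q-x-root : ∀ x → eval x^q-x x ≈ 0#
  x^q-x-root x = begin
    eval x^q-x x                              ≈⟨ eval-+ (Iₘ top) (λ i → - Iₘ one i) x ⟩
    eval (Iₘ top) x + eval (λ i → - Iₘ one i) x ≈⟨ +-congˡ (eval-neg (Iₘ one) x) ⟩
    eval (Iₘ top) x - eval (Iₘ one) x         ≈⟨ +-cong (monomial top) (-‿cong (monomial one)) ⟩
    x ^ toℕ top - x ^ toℕ one
      ≡⟨ ≡.cong₂ (λ m n → x ^ m - x ^ n) (Fin.toℕ-fromℕ q) (Fin.toℕ-fromℕ< (s≤s (ℕ.<⇒≤ 1<q))) ⟩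
    x ^ q - x ^ 1                             ≈⟨ +-cong (x^q≈x x) (-‿cong (*-identityʳ x)) ⟩
    x - x                                     ≈⟨ -‿inverseʳ x ⟩
    0#                                        ∎
    where
    top one : Fin (suc q)
    top = Fin.fromℕ q
    one = Fin.fromℕ< {1} (s≤s (ℕ.<⇒≤ 1<q))
    monomial : ∀ j → eval (Iₘ j) x ≈ x ^ toℕ j
    monomial j = trans (eval-sum (Iₘ j) x) (sum-Iₘ j (λ i → x ^ toℕ i))

  x^q-x-nonzero : ¬ (∀ i → x^q-x i ≈ 0#)
  x^q-x-nonzero x^q-x≈0 = 1≉0 (begin
    1#                                    ≈⟨ +-identityʳ _ ⟨
    1# + 0#                               ≈⟨ +-congˡ -0#≈0# ⟨
    1# - 0#
      ≡⟨ ≡.cong₂ _-_ (Iₘ-diagonal (Fin.fromℕ q)) (Iₘ-off one≢top) ⟨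
    x^q-x (Fin.fromℕ q)                   ≈⟨ x^q-x≈0 (Fin.fromℕ q) ⟩
    0#                                    ∎)
    where
    one≢top : Fin.fromℕ< {1} (s≤s (ℕ.<⇒≤ 1<q)) ≢ Fin.fromℕ q
    one≢top eq = ℕ.<⇒≢ 1<q (≡.trans (≡.sym (Fin.toℕ-fromℕ< (s≤s (ℕ.<⇒≤ 1<q))))
        (≡.trans (≡.cong toℕ eq) (Fin.toℕ-fromℕ q)))

  -- An element missed by `to` would be one root more than X ^ q - X, of degree q, can have.
  to-surjective : ∀ x → ∃ λ i → to i ≈ x
  to-surjective x with Fin.any? (λ i → to i ≟ x)
  ... | yes found = found
  ... | no ¬found = contradiction (too-many-roots domain x^q-x roots distinct (x^q-x-root ∘ roots))
      x^q-x-nonzero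
    where
    roots : Vector Carrier (suc q)
    roots zero    = x
    roots (suc i) = to i
    distinct : ∀ i j → roots i ≈ roots j → i ≡ j
    distinct zero    zero    _  = ≡.refl
    distinct zero    (suc j) eq = contradiction (j , sym eq) ¬found
    distinct (suc i) zero    eq = contradiction (i , eq) ¬found
    distinct (suc i) (suc j) eq = ≡.cong suc (to-injective eq)

  from : Carrier → Fin q
  from x = proj₁ (to-surjective x)

  to∘from : ∀ x → to (from x) ≈ x
  to∘from x = proj₂ (to-surjective x)

  from-cong : ∀ {x y} → x ≈ y → from x ≡ from y
  from-cong {x} {y} x≈y = to-injective (trans (to∘from x) (trans x≈y (sym (to∘from y))))

-- A field quotient of a ring in which z ^ q = z

module Absorbing (R : CommutativeRing c ℓ) where
  open CommutativeRing R hiding (zero)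
  open Exp commutativeSemiring
  open SetoidReasoning setoid

  module _ {r : ℕ} (absorb : ∀ x → x ^ (2 ℕ.+ r) ≈ x) (_≟_ : Decidable _≈_) where

    -- With q = 2 + r the exponent is q - 1, and x ^ (q - 1) · x ^ (q - 1) = x ^ q · x ^ (q - 2) = x
    -- ^ (q - 1).
    idempotent : ∀ x → x ^ suc r * x ^ suc r ≈ x ^ suc r
    idempotent x = begin
      x * x ^ r * (x * x ^ r)    ≈⟨ *-assoc _ _ _ ⟩
      x * (x ^ r * (x * x ^ r))  ≈⟨ *-congˡ (*-comm _ _) ⟩
      x * (x * x ^ r * x ^ r)    ≈⟨ *-assoc _ _ _ ⟨
      x * (x * x ^ r) * x ^ r    ≈⟨ *-congʳ (absorb x) ⟩
      x * x ^ r                  ∎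

    -- f arises from g by multiplication with each idempotent x i ^ (1 + r)
    -- that does not annihilate the product reached so far.  Modulo the
    -- annihilator of f, every x i is then either zero or invertible.
    select : ∀ {n} (x : Vector Carrier n) g → ¬ (g ≈ 0#) →
             ∃₂ λ f h → f ≈ g * h × ¬ (f ≈ 0#) × (∀ i → f * x i ≈ 0# ⊎ f * x i ^ suc r ≈ f)
    select {zero} x g g≉0 = g , 1# , sym (*-identityʳ g) , g≉0 , λ ()
    select {suc n} x g g≉0 with select (x ∘ suc) g g≉0
    ... | f , h , f≈gh , f≉0 , f-selects with (f * x zero) ≟ 0#
    ...   | yes fx≈0 = f , h , f≈gh , f≉0 , λ { zero → inj₁ fx≈0 ; (suc i) → f-selects i }
    ...   | no fx≉0 = f * y , h * y , trans (*-congʳ f≈gh) (*-assoc _ _ _) , fy≉0 ,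
        λ { zero    → inj₂ (trans (*-assoc _ _ _) (*-congˡ (idempotent (x zero))))
          ; (suc i) → [ (λ eq → inj₁ (trans (swap (x (suc i))) (trans (*-congʳ eq) (zeroˡ y))))
                      , (λ eq → inj₂ (trans (swap (x (suc i) ^ suc r)) (*-congʳ eq))) ]′ (f-selects i) }
      where
      y = x zero ^ suc r
      swap : ∀ z → f * y * z ≈ f * z * y
      swap z = trans (*-assoc _ _ _) (trans (*-congˡ (*-comm _ _)) (sym (*-assoc _ _ _)))
      fy≉0 : ¬ (f * y ≈ 0#)
      fy≉0 fy≈0 = fx≉0 (begin
        f * x zero         ≈⟨ *-congˡ (absorb (x zero)) ⟨
        f * (x zero * y)   ≈⟨ *-congˡ (*-comm _ _) ⟩
        f * (y * x zero)   ≈⟨ *-assoc _ _ _ ⟨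
        f * y * x zero     ≈⟨ *-congʳ fy≈0 ⟩
        0# * x zero        ≈⟨ zeroˡ _ ⟩
        0#                 ∎)

module ConjugateProduct (R : CommutativeRing c ℓ) where
  open CommutativeRing R hiding (zero)
  open Exp commutativeSemiring

  conjugateProduct : ℕ → Carrier → ℕ → Carrier
  conjugateProduct p x zero    = 1#
  conjugateProduct p x (suc d) = conjugateProduct p x d * (x ^ (p ℕ.^ suc d) - x)

module GeneratedRing (R : CommutativeRing 0ℓ 0ℓ) where
  open CommutativeRing R hiding (zero)
  open Evaluation R
  open ConjugateProduct R
  open Mat R using (fromℕ)
  open Exp commutativeSemiring
  open SetoidReasoning setoid

  module _
    {p e : ℕ} (p-prime : Prime p) (_≟_ : Decidable _≈_) (p·1≈0 : fromℕ p ≈ 0#)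
    (x : Carrier) (x^q≈x : x ^ (p ℕ.^ suc e) ≈ x)
    (generate : ∀ y → ∃ λ (k : Fin (p ℕ.^ suc e) → Fin p) → y ≈ eval (λ i → fromℕ (toℕ (k i))) x)
    (separated : ¬ (conjugateProduct p x e ≈ 0#))
    where

    open Characteristic R p-prime p·1≈0 hiding (fromℕ)

    private
      q : ℕ
      q = p ℕ.^ suc e

      r : ℕ
      r = q ℕ.∸ 2

      2+r≡q : 2 ℕ.+ r ≡ q
      2+r≡q = ℕ.m+[n∸m]≡n (1<p^e p-prime (s≤s (z≤n {e})))

    -- Every y is a polynomial in x over 𝔽ₚ, and raising to the power q fixes the coefficients as
    -- well as x.
    y^q≈y : ∀ y → y ^ q ≈ y
    y^q≈y y = let k , y≈ = generate y in begin
      frobenius (suc e) y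
        ≈⟨ frobenius-cong (suc e) y≈ ⟩
      frobenius (suc e) (eval (λ i → fromℕ (toℕ (k i))) x)
        ≈⟨ frobenius-eval (suc e) _ x (λ i → frobenius-fromℕ (suc e) (toℕ (k i))) ⟩
      eval (λ i → fromℕ (toℕ (k i))) (frobenius (suc e) x)
        ≈⟨ eval-cong {f = λ i → fromℕ (toℕ (k i))} (λ _ → refl) x^q≈x ⟩
      eval (λ i → fromℕ (toℕ (k i))) x                                       ≈⟨ y≈ ⟨
      y                                                                      ∎

    absorb : ∀ y → y ^ (2 ℕ.+ r) ≈ y
    absorb y = trans (^-congʳ y 2+r≡q) (y^q≈y y)

    open Absorbing R using (select)

    -- A finite list of the whole ring, possibly with repetitions, for `select` to run through.
    element : Vector Carrier (p ℕ.^ q)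
    element i = eval (λ j → fromℕ (toℕ (Fin.finToFun {p} {q} i j))) x

    element-surjective : ∀ y → ∃ λ i → y ≈ element i
    element-surjective y = let k , y≈ = generate y in Fin.funToFin k , trans y≈
      (eval-cong {f = λ j → fromℕ (toℕ (k j))}
        (λ j → reflexive (≡.cong (fromℕ ∘ toℕ) (≡.sym (Fin.finToFun-funToFin k j)))) refl)

    -- The product contains the factor x ^ (p ^ d) - x, which f annihilates by hypothesis.
    conjugateProduct-zero : ∀ f {d} d′ → 0 ℕ.< d → d ℕ.≤ d′ → f * x ^ (p ℕ.^ d) ≈ f * x →
                            f * conjugateProduct p x d′ ≈ 0#
    conjugateProduct-zero f zero (s≤s _) () eq
    conjugateProduct-zero f {d} (suc d′) 0<d d≤d′ eq with d ℕ.≟ suc d′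
    ... | yes ≡.refl = begin
      f * (conjugateProduct p x d′ * (x ^ (p ℕ.^ d) - x))  ≈⟨ *-congˡ (*-comm _ _) ⟩
      f * ((x ^ (p ℕ.^ d) - x) * conjugateProduct p x d′)  ≈⟨ *-assoc _ _ _ ⟨
      f * (x ^ (p ℕ.^ d) - x) * conjugateProduct p x d′
        ≈⟨ *-congʳ (trans (distribˡ _ _ _) (+-cong eq (sym (-‿distribʳ-* f x)))) ⟩
      (f * x - f * x) * conjugateProduct p x d′            ≈⟨ *-congʳ (-‿inverseʳ _) ⟩
      0# * conjugateProduct p x d′                         ≈⟨ zeroˡ _ ⟩
      0#                                                 ∎
      where open RingProperties ring using (-‿distribʳ-*)
    ... | no d≢1+d′ = begin
      f * (conjugateProduct p x d′ * (x ^ (p ℕ.^ suc d′) - x))  ≈⟨ *-assoc _ _ _ ⟨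
      f * conjugateProduct p x d′ * (x ^ (p ℕ.^ suc d′) - x)
        ≈⟨ *-congʳ (conjugateProduct-zero f d′ 0<d (ℕ.≤-pred (ℕ.≤∧≢⇒< d≤d′ d≢1+d′)) eq) ⟩
      0# * (x ^ (p ℕ.^ suc d′) - x)                           ≈⟨ zeroˡ _ ⟩
      0#                                                      ∎

    primitiveDomain : PrimitiveDomain p (suc e)
    primitiveDomain with select {r} absorb _≟_ element (conjugateProduct p x e) separated
    ... | f , h , f≈gh , f≉0 , selects = record
      { ring = R/Ann
      ; _≟_ = λ y z → (f * y) ≟ (f * z)
      ; 1≉0 = λ f1≈f0 → f≉0 (trans (sym (*-identityʳ f)) (trans f1≈f0 (zeroʳ f)))
      ; p·1≈0 = *-congˡ (trans (reflexive (R/Ann-fromℕ p)) p·1≈0)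
      ; domain = domain
      ; x^q≈x = λ y → *-congˡ (trans (reflexive (R/Ann-^ y q)) (y^q≈y y))
      ; generator = x
      ; conjugate≢ = λ d 0<d d<e eq → f≉0 (f≈0 (conjugateProduct-zero f e 0<d (ℕ.≤-pred d<e)
          (trans (*-congˡ (reflexive (≡.sym (R/Ann-^ x (p ℕ.^ d))))) eq)))
      }
      where
      open ModAnnihilator R f
      g = conjugateProduct p x e
      -- Since g ^ q = g, multiplication by g ^ (q - 1) is the identity on multiples of g. As f = g
      -- h is one of them, f = g ^ (q - 1) f, which vanishes with f g.
      f≈0 : f * g ≈ 0# → f ≈ 0#
      f≈0 fg≈0 = begin
        f                                ≈⟨ f≈gh ⟩
        g * h                            ≈⟨ *-congʳ (absorb g) ⟨
        g * (g * g ^ r) * h              ≈⟨ *-congʳ (*-comm _ _) ⟩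
        g * g ^ r * g * h                ≈⟨ *-assoc _ _ _ ⟩
        g * g ^ r * (g * h)              ≈⟨ *-congˡ f≈gh ⟨
        g * g ^ r * f                    ≈⟨ *-comm _ _ ⟩
        f * (g * g ^ r)                  ≈⟨ *-assoc _ _ _ ⟨
        f * g * g ^ r                    ≈⟨ *-congʳ fg≈0 ⟩
        0# * g ^ r                       ≈⟨ zeroˡ _ ⟩
        0#                               ∎
      -- If y is not zero in the quotient, its inverse there is y ^ r, because f y y ^ r = f; it
      -- cancels y from y z.
      domain : ∀ {y z} → f * (y * z) ≈ f * 0# → f * y ≈ f * 0# ⊎ f * z ≈ f * 0#
      domain {y} {z} fyz≈0 with element-surjective y
      ... | i , y≈ with selects i
      ...   | inj₁ fi≈0 = inj₁ (trans (*-congˡ y≈) (trans fi≈0 (sym (zeroʳ f))))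
      ...   | inj₂ fi≈f = inj₂ (begin
        f * z                     ≈⟨ *-congʳ fi≈f ⟨
        f * element i ^ suc r * z ≈⟨ *-congʳ (*-congˡ (^-congˡ (suc r) (sym y≈))) ⟩
        f * (y * y ^ r) * z       ≈⟨ *-assoc _ _ _ ⟩
        f * (y * y ^ r * z)
          ≈⟨ *-congˡ (trans (*-assoc _ _ _) (trans (*-congˡ (*-comm _ _)) (sym (*-assoc _ _ _)))) ⟩
        f * (y * z * y ^ r)       ≈⟨ *-assoc _ _ _ ⟨
        f * (y * z) * y ^ r       ≈⟨ *-congʳ (trans fyz≈0 (zeroʳ f)) ⟩
        0# * y ^ r                ≈⟨ zeroˡ _ ⟩
        0#                        ≈⟨ zeroʳ f ⟨
        f * 0#                    ∎)

-- The ring A[x] / (x ^ q - x) as a monoid algebra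

module MonoidAlgebra (A : CommutativeRing c ℓ) {n : ℕ} (_⊕_ : Fin n → Fin n → Fin n) (ε : Fin n)
  (⊕-assoc : ∀ i j k → (i ⊕ j) ⊕ k ≡ i ⊕ (j ⊕ k)) (⊕-comm : ∀ i j → i ⊕ j ≡ j ⊕ i)
  (⊕-identityˡ : ∀ i → ε ⊕ i ≡ i)
  where

  open CommutativeRing A hiding (zero)
  open FiniteSums A
  open SetoidReasoning setoid

  private V = Vector Carrier n

  -- Equations between products are tested against all functions φ, which
  -- turns products into iterated sums.
  ⟪_,_⟫ : V → V → Carrier
  ⟪ f , φ ⟫ = sum (λ i → f i * φ i)

  ⟪⟫-cong : ∀ {f g φ ψ} → (∀ i → f i ≈ g i) → (∀ i → φ i ≈ ψ i) → ⟪ f , φ ⟫ ≈ ⟪ g , ψ ⟫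
  ⟪⟫-cong f≈g φ≈ψ = sum-cong-≋ λ i → *-cong (f≈g i) (φ≈ψ i)

  ⟪⟫-comm : ∀ f φ → ⟪ f , φ ⟫ ≈ ⟪ φ , f ⟫
  ⟪⟫-comm f φ = sum-cong-≋ λ i → *-comm (f i) (φ i)

  ⟪⟫-+ˡ : ∀ f g φ → ⟪ (λ i → f i + g i) , φ ⟫ ≈ ⟪ f , φ ⟫ + ⟪ g , φ ⟫
  ⟪⟫-+ˡ f g φ = trans (sum-cong-≋ λ i → distribʳ (φ i) (f i) (g i))
    (∑-distrib-+ (λ i → f i * φ i) (λ i → g i * φ i))

  ⟪⟫-Iₘ : ∀ k φ → ⟪ Iₘ k , φ ⟫ ≈ φ k
  ⟪⟫-Iₘ = sum-Iₘ

  ⟪⟫-fubini : ∀ f g (φ : Fin n → V) → ⟪ f , (λ i → ⟪ g , φ i ⟫) ⟫ ≈ ⟪ g , (λ j → ⟪ f , (λ i → φ i j) ⟫) ⟫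
  ⟪⟫-fubini f g φ = begin
    sum (λ i → f i * sum (λ j → g j * φ i j))
      ≈⟨ sum-cong-≋ (λ i → *-distribˡ-sum (f i) (λ j → g j * φ i j)) ⟩
    sum (λ i → sum (λ j → f i * (g j * φ i j)))    ≈⟨ ∑-comm (λ i j → f i * (g j * φ i j)) ⟩
    sum (λ j → sum (λ i → f i * (g j * φ i j)))
      ≈⟨ sum-cong-≋ (λ j → sum-cong-≋ λ i → x∙yz≈y∙xz (f i) (g j) (φ i j)) ⟩
    sum (λ j → sum (λ i → g j * (f i * φ i j)))
      ≈⟨ sum-cong-≋ (λ j → *-distribˡ-sum (g j) (λ i → f i * φ i j)) ⟨
    sum (λ j → g j * sum (λ i → f i * φ i j))      ∎
    where open CommutativeSemigroupProperties *-commutativeSemigroup using (x∙yz≈y∙xz)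

  ⟪⟫-ext : ∀ {f g} → (∀ φ → ⟪ f , φ ⟫ ≈ ⟪ g , φ ⟫) → ∀ k → f k ≈ g k
  ⟪⟫-ext {f} {g} eq k = trans (sym (coefficient f)) (trans (eq (Iₘ k)) (coefficient g))
    where
    coefficient : ∀ f → ⟪ f , Iₘ k ⟫ ≈ f k
    coefficient f = trans (⟪⟫-comm f (Iₘ k)) (⟪⟫-Iₘ k f)

  infixl 7 _⋆_
  -- Convolution, with `Iₘ (i ⊕ j) k` as the indicator of i ⊕ j = k. As a nested pairing it can be
  -- reordered by `⟪⟫-fubini`.
  _⋆_ : V → V → V
  (f ⋆ g) k = ⟪ f , (λ i → ⟪ g , (λ j → Iₘ (i ⊕ j) k) ⟫) ⟫

  -- The sum over k is moved innermost, where the indicator collapses it. A product is thus tested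
  -- by evaluating φ at i ⊕ j, and the laws of `⊕` pass to `⋆`.
  ⟪⟫-⋆ : ∀ f g φ → ⟪ f ⋆ g , φ ⟫ ≈ ⟪ f , (λ i → ⟪ g , (λ j → φ (i ⊕ j)) ⟫) ⟫
  ⟪⟫-⋆ f g φ = begin
    ⟪ f ⋆ g , φ ⟫                                                         ≈⟨ ⟪⟫-comm (f ⋆ g) φ ⟩
    ⟪ φ , (λ k → ⟪ f , (λ i → ⟪ g , (λ j → Iₘ (i ⊕ j) k) ⟫) ⟫) ⟫          ≈⟨ ⟪⟫-fubini φ f _ ⟩
    ⟪ f , (λ i → ⟪ φ , (λ k → ⟪ g , (λ j → Iₘ (i ⊕ j) k) ⟫) ⟫) ⟫
      ≈⟨ ⟪⟫-cong {f} (λ _ → refl) (λ i → trans (⟪⟫-fubini φ g _)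
      (⟪⟫-cong {g} (λ _ → refl) (λ j → trans (⟪⟫-comm φ (Iₘ (i ⊕ j))) (⟪⟫-Iₘ (i ⊕ j) φ)))) ⟩
    ⟪ f , (λ i → ⟪ g , (λ j → φ (i ⊕ j)) ⟫) ⟫                             ∎

  ⋆-cong : ∀ {f f′ g g′} → (∀ i → f i ≈ f′ i) → (∀ i → g i ≈ g′ i) → ∀ k → (f ⋆ g) k ≈ (f′ ⋆ g′) k
  ⋆-cong f≈ g≈ k = ⟪⟫-cong f≈ λ i → ⟪⟫-cong g≈ λ j → refl

  Iₘ-⋆ : ∀ a b k → (Iₘ a ⋆ Iₘ b) k ≈ Iₘ (a ⊕ b) k
  Iₘ-⋆ a b k = trans (⟪⟫-Iₘ a _) (⟪⟫-Iₘ b _)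

  ⋆-assoc : ∀ f g h k → ((f ⋆ g) ⋆ h) k ≈ (f ⋆ (g ⋆ h)) k
  ⋆-assoc f g h = ⟪⟫-ext λ φ → begin
    ⟪ (f ⋆ g) ⋆ h , φ ⟫                                                        ≈⟨ ⟪⟫-⋆ (f ⋆ g) h φ ⟩
    ⟪ f ⋆ g , (λ i → ⟪ h , (λ k → φ (i ⊕ k)) ⟫) ⟫                              ≈⟨ ⟪⟫-⋆ f g _ ⟩
    ⟪ f , (λ i → ⟪ g , (λ j → ⟪ h , (λ k → φ ((i ⊕ j) ⊕ k)) ⟫) ⟫) ⟫
      ≈⟨ ⟪⟫-cong {f} (λ _ → refl) (λ i → ⟪⟫-cong {g} (λ _ → refl) λ j →
      ⟪⟫-cong {h} (λ _ → refl) λ k → reflexive (≡.cong φ (⊕-assoc i j k))) ⟩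
    ⟪ f , (λ i → ⟪ g , (λ j → ⟪ h , (λ k → φ (i ⊕ (j ⊕ k))) ⟫) ⟫) ⟫
      ≈⟨ ⟪⟫-cong {f} (λ _ → refl) (λ i → ⟪⟫-⋆ g h (λ j → φ (i ⊕ j))) ⟨
    ⟪ f , (λ i → ⟪ g ⋆ h , (λ j → φ (i ⊕ j)) ⟫) ⟫                              ≈⟨ ⟪⟫-⋆ f (g ⋆ h) φ ⟨
    ⟪ f ⋆ (g ⋆ h) , φ ⟫                                                        ∎

  ⋆-comm : ∀ f g k → (f ⋆ g) k ≈ (g ⋆ f) k
  ⋆-comm f g k = trans (⟪⟫-fubini f g _)
    (⟪⟫-cong {g} (λ _ → refl) λ j → ⟪⟫-cong {f} (λ _ → refl) λ i → reflexive
        (≡.cong (λ l → Iₘ l k) (⊕-comm i j)))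

  ⋆-identityˡ : ∀ f k → (Iₘ ε ⋆ f) k ≈ f k
  ⋆-identityˡ f = ⟪⟫-ext λ φ → begin
    ⟪ Iₘ ε ⋆ f , φ ⟫                       ≈⟨ ⟪⟫-⋆ (Iₘ ε) f φ ⟩
    ⟪ Iₘ ε , (λ i → ⟪ f , (λ j → φ (i ⊕ j)) ⟫) ⟫ ≈⟨ ⟪⟫-Iₘ ε _ ⟩
    ⟪ f , (λ j → φ (ε ⊕ j)) ⟫
      ≈⟨ ⟪⟫-cong {f} (λ _ → refl) (λ j → reflexive (≡.cong φ (⊕-identityˡ j))) ⟩
    ⟪ f , φ ⟫                              ∎

  ⋆-distribʳ : ∀ h f g k → ((λ i → f i + g i) ⋆ h) k ≈ (f ⋆ h) k + (g ⋆ h) k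
  ⋆-distribʳ h f g k = ⟪⟫-+ˡ f g _

  monoidAlgebra : CommutativeRing c ℓ
  monoidAlgebra = record
    { Carrier = V ; _≈_ = λ f g → ∀ k → f k ≈ g k
    ; _+_ = λ f g k → f k + g k ; _*_ = _⋆_ ; -_ = λ f k → - f k ; 0# = λ _ → 0# ; 1# = Iₘ ε
    ; isCommutativeRing = record
      { isRing = record
        { +-isAbelianGroup = record
          { isGroup = record
            { isMonoid = record
              { isSemigroup = record
                { isMagma = record
                  { isEquivalence = record
                    { refl = λ _ → refl ; sym = λ eq k → sym (eq k) ; trans = λ eq eq′ k → trans (eq k)
                        (eq′ k) }
                  ; ∙-cong = λ eq eq′ k → +-cong (eq k) (eq′ k)
                  }
                ; assoc = λ f g h k → +-assoc _ _ _
                }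
              ; identity = (λ f k → +-identityˡ _) , (λ f k → +-identityʳ _)
              }
            ; inverse = (λ f k → -‿inverseˡ _) , (λ f k → -‿inverseʳ _)
            ; ⁻¹-cong = λ eq k → -‿cong (eq k)
            }
          ; comm = λ f g k → +-comm _ _
          }
        ; *-cong = ⋆-cong
        ; *-assoc = ⋆-assoc
        ; *-identity = ⋆-identityˡ , λ f k → trans (⋆-comm f (Iₘ ε) k) (⋆-identityˡ f k)
        ; distrib = (λ h f g k → trans (⋆-comm h _ k)
            (trans (⋆-distribʳ h f g k) (+-cong (⋆-comm f h k) (⋆-comm g h k))))
                  , ⋆-distribʳ
        }
      ; *-comm = ⋆-comm
      }
    }

-- The exponents of x in A[x] / (x ^ q - x).
module Exponents (q : ℕ) (1<q : 1 ℕ.< q) where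

  step : Fin q → Fin q
  step i with suc (toℕ i) ℕ.<? q
  ... | yes 1+i<q = Fin.fromℕ< 1+i<q
  -- Since x ^ q = x, the successor of q - 1 is 1 and not 0; the exponent 0 is the successor of
  -- nothing.
  ... | no  _     = Fin.fromℕ< 1<q

  reduce : ℕ → Fin q
  reduce zero    = Fin.fromℕ< (ℕ.<⇒≤ 1<q)
  reduce (suc n) = step (reduce n)

  toℕ-reduce : ∀ {n} → n ℕ.< q → toℕ (reduce n) ≡ n
  toℕ-reduce {zero}  _ = Fin.toℕ-fromℕ< (ℕ.<⇒≤ 1<q)
  toℕ-reduce {suc n} 1+n<q with suc (toℕ (reduce n)) ℕ.<? q
  ... | yes 1+r<q = ≡.trans (Fin.toℕ-fromℕ< 1+r<q) (≡.cong suc (toℕ-reduce (ℕ.<⇒≤ 1+n<q)))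
  ... | no  1+r≮q = contradiction (≡.subst (ℕ._< q) (≡.cong suc (≡.sym (toℕ-reduce (ℕ.<⇒≤ 1+n<q)))) 1+n<q) 1+r≮q

  reduce-toℕ : ∀ i → reduce (toℕ i) ≡ i
  reduce-toℕ i = Fin.toℕ-injective (toℕ-reduce (Fin.toℕ<n i))

  reduce-q : reduce q ≡ reduce 1
  reduce-q = Fin.toℕ-injective (≡.trans (wrap q ≡.refl) (≡.sym (toℕ-reduce 1<q)))
    where
    wrap : ∀ n → n ≡ q → toℕ (reduce n) ≡ 1
    wrap zero    0≡q = contradiction (≡.subst (1 ℕ.<_) (≡.sym 0≡q) 1<q) λ ()
    wrap (suc n) 1+n≡q with suc (toℕ (reduce n)) ℕ.<? q
    ... | yes 1+r<q = contradiction (≡.trans (≡.cong suc (toℕ-reduce (≡.subst (n ℕ.<_) 1+n≡q ℕ.≤-refl)))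
        1+n≡q) (ℕ.<⇒≢ 1+r<q)
    ... | no  _     = Fin.toℕ-fromℕ< 1<q

  -- As `reduce` iterates `step`, only a = 0 has content. This gives the associativity of `⊕`
  -- without a case distinction on overflow.
  reduce-+ : ∀ a b → reduce (a ℕ.+ toℕ (reduce b)) ≡ reduce (a ℕ.+ b)
  reduce-+ zero    b = reduce-toℕ (reduce b)
  reduce-+ (suc a) b = ≡.cong step (reduce-+ a b)

  infixl 6 _⊕_
  _⊕_ : Fin q → Fin q → Fin q
  i ⊕ j = reduce (toℕ i ℕ.+ toℕ j)

  ⊕-comm : ∀ i j → i ⊕ j ≡ j ⊕ i
  ⊕-comm i j = ≡.cong reduce (ℕ.+-comm (toℕ i) (toℕ j))

  ⊕-assoc : ∀ i j k → (i ⊕ j) ⊕ k ≡ i ⊕ (j ⊕ k)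
  ⊕-assoc i j k = begin
    reduce (toℕ (i ⊕ j) ℕ.+ toℕ k)              ≡⟨ ≡.cong reduce (ℕ.+-comm (toℕ (i ⊕ j)) (toℕ k)) ⟩
    reduce (toℕ k ℕ.+ toℕ (i ⊕ j))              ≡⟨ reduce-+ (toℕ k) (toℕ i ℕ.+ toℕ j) ⟩
    reduce (toℕ k ℕ.+ (toℕ i ℕ.+ toℕ j))        ≡⟨ ≡.cong reduce (ℕ.+-comm (toℕ k) _) ⟩
    reduce ((toℕ i ℕ.+ toℕ j) ℕ.+ toℕ k)
      ≡⟨ ≡.cong reduce (ℕ.+-assoc (toℕ i) (toℕ j) (toℕ k)) ⟩
    reduce (toℕ i ℕ.+ (toℕ j ℕ.+ toℕ k))        ≡⟨ reduce-+ (toℕ i) (toℕ j ℕ.+ toℕ k) ⟨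
    reduce (toℕ i ℕ.+ toℕ (j ⊕ k))              ∎
    where open ≡.≡-Reasoning

  ⊕-identityˡ : ∀ i → reduce 0 ⊕ i ≡ i
  ⊕-identityˡ i = ≡.trans (≡.cong (λ m → reduce (m ℕ.+ toℕ i)) (Fin.toℕ-fromℕ< (ℕ.<⇒≤ 1<q))) (reduce-toℕ i)

module _ (A : CommutativeRing 0ℓ 0ℓ) where
  private
    module A = CommutativeRing A

  module _ {p e : ℕ} (p-prime : Prime p)
    (_≟_ : Decidable A._≈_) (1≉0 : ¬ (A.1# A.≈ A.0#)) (p·1≈0 : Mat.fromℕ A p A.≈ A.0#)
    (residue : ∀ a → ∃ λ (i : Fin p) → a A.≈ Mat.fromℕ A (toℕ i))
    where

    private
      q : ℕ
      q = p ℕ.^ suc e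

      1<q : 1 ℕ.< q
      1<q = 1<p^e p-prime (s≤s (z≤n {e}))

      1<p : 1 ℕ.< p
      1<p = ℕ.nonTrivial⇒n>1 p {{prime⇒nonTrivial p-prime}}

      instance
        p≢0 : ℕ.NonZero p
        p≢0 = prime⇒nonZero p-prime

      open Exponents q 1<q
      open MonoidAlgebra A _⊕_ (reduce 0) ⊕-assoc ⊕-comm ⊕-identityˡ

      -- R = A[x] / (x ^ q - x)
      R : CommutativeRing 0ℓ 0ℓ
      R = monoidAlgebra

      module R = CommutativeRing R
      open CommutativeRing A hiding (zero)
      open FiniteSums A
      module RSums = FiniteSums R
      open Evaluation R using (eval; eval-sum)
      open Exp R.commutativeSemiring using (_^_)
      open ConjugateProduct R
      open SetoidReasoning A.setoid
      open RingProperties ring using (-0#≈0#)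

      x : R.Carrier
      x = Iₘ (reduce 1)

      x^ : ∀ n k → (x ^ n) k ≈ Iₘ (reduce n) k
      x^ zero    k = refl
      x^ (suc n) k = begin
        (x ⋆ x ^ n) k                        ≈⟨ ⋆-cong {x} (λ _ → refl) (x^ n) k ⟩
        (x ⋆ Iₘ (reduce n)) k                ≈⟨ Iₘ-⋆ (reduce 1) (reduce n) k ⟩
        Iₘ (reduce 1 ⊕ reduce n) k
          ≡⟨ ≡.cong (λ i → Iₘ i k) (≡.trans (≡.cong (λ a → reduce (a ℕ.+ toℕ (reduce n)))
              (toℕ-reduce 1<q)) (reduce-+ 1 n)) ⟩
        Iₘ (reduce (suc n)) k                ∎

      fromℕ-⋆ : ∀ m f k → (Mat.fromℕ R m ⋆ f) k ≈ Mat.fromℕ A m * f k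
      fromℕ-⋆ zero    f k = trans (R.zeroˡ f k) (sym (zeroˡ _))
      fromℕ-⋆ (suc m) f k = begin
        (Mat.fromℕ R (suc m) ⋆ f) k
          ≈⟨ ⋆-distribʳ f (Iₘ (reduce 0)) (Mat.fromℕ R m) k ⟩
        (Iₘ (reduce 0) ⋆ f) k + (Mat.fromℕ R m ⋆ f) k ≈⟨ +-cong (⋆-identityˡ f k) (fromℕ-⋆ m f k) ⟩
        f k + Mat.fromℕ A m * f k                 ≈⟨ +-congʳ (*-identityˡ (f k)) ⟨
        1# * f k + Mat.fromℕ A m * f k            ≈⟨ distribʳ _ _ _ ⟨
        Mat.fromℕ A (suc m) * f k                 ∎

      sum-pointwise : ∀ {n} (f : Fin n → R.Carrier) k → RSums.sum f k ≡ sum (λ i → f i k)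
      sum-pointwise {zero}  f k = ≡.refl
      sum-pointwise {suc n} f k = ≡.cong (f zero k +_) (sum-pointwise (f ∘ suc) k)

      -- The powers x ^ i with i < q are the unit vectors `Iₘ i`, so the coefficients sought are the
      -- values of f, each represented by its residue.
      generate : ∀ f → ∃ λ (r : Fin q → Fin p) → f R.≈ eval (λ i → Mat.fromℕ R (toℕ (r i))) x
      generate f = (λ i → proj₁ (residue (f i))) , λ k → sym (begin
        eval (λ i → Mat.fromℕ R (m i)) x k
          ≈⟨ eval-sum (λ i → Mat.fromℕ R (m i)) x k ⟩
        RSums.sum (λ i → Mat.fromℕ R (m i) ⋆ x ^ toℕ i) k
          ≡⟨ sum-pointwise (λ i → Mat.fromℕ R (m i) ⋆ x ^ toℕ i) k ⟩
        sum (λ i → (Mat.fromℕ R (m i) ⋆ x ^ toℕ i) k)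
          ≈⟨ sum-cong-≋ (λ i → trans (fromℕ-⋆ (m i) (x ^ toℕ i) k)
          (*-cong (sym (proj₂ (residue (f i)))) (trans (x^ (toℕ i) k)
              (reflexive (≡.cong (λ j → Iₘ j k) (reduce-toℕ i)))))) ⟩
        sum (λ i → f i * Iₘ i k)
          ≈⟨ sum-cong-≋ (λ i → trans (*-comm _ _) (*-congʳ (reflexive (Iₘ-sym i k)))) ⟩
        sum (λ i → Iₘ k i * f i)                              ≈⟨ sum-Iₘ k f ⟩
        f k                                                   ∎)
        where
        m : Fin q → ℕ
        m i = toℕ (proj₁ (residue (f i)))

      -- The degree is that of the representative with exponents below q. Multiplication respects it
      -- only while no exponent wraps around, which is the reason for the bounds by q in the lemmas
      -- on products.
      DegreeBelow : ℕ → R.Carrier → Set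
      DegreeBelow N f = ∀ k → N ℕ.≤ toℕ k → f k ≈ 0#

      Monic : ℕ → R.Carrier → Set
      Monic N f = ∃ λ g → DegreeBelow N g × f R.≈ (x ^ N) R.+ g

      DegreeBelow-x^ : ∀ {n N} → n ℕ.< N → n ℕ.< q → DegreeBelow N (x ^ n)
      DegreeBelow-x^ {n} n<N n<q k N≤k = trans (x^ n k) (reflexive (Iₘ-off λ n≡k →
        ℕ.<⇒≱ n<N (≡.subst (_ ℕ.≤_) (≡.trans (≡.cong toℕ (≡.sym n≡k)) (toℕ-reduce n<q)) N≤k)))

      DegreeBelow-x^-⋆ : ∀ n {N f} → n ℕ.+ N ℕ.≤ q → DegreeBelow N f → DegreeBelow (n ℕ.+ N) (x ^ n ⋆ f)
      DegreeBelow-x^-⋆ n {N} {f} n+N≤q f-low k n+N≤k = begin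
        (x ^ n ⋆ f) k                                   ≈⟨ ⋆-cong {g = f} (x^ n) (λ _ → refl) k ⟩
        (Iₘ (reduce n) ⋆ f) k                           ≈⟨ ⟪⟫-Iₘ (reduce n) _ ⟩
        ⟪ f , (λ j → Iₘ (reduce n ⊕ j) k) ⟫             ≈⟨ sum-zero term≈0 ⟩
        0#                                              ∎
        where
        term≈0 : ∀ j → f j * Iₘ (reduce n ⊕ j) k ≈ 0#
        term≈0 j with N ℕ.≤? toℕ j
        ... | yes N≤j = trans (*-congʳ (f-low j N≤j)) (zeroˡ _)
        ... | no  N≰j = trans (*-congˡ (reflexive (Iₘ-off λ n⊕j≡k → ℕ.<⇒≱ n+j<n+N
            (≡.subst (n ℕ.+ N ℕ.≤_) (≡.trans (≡.cong toℕ (≡.sym n⊕j≡k)) toℕ-n⊕j) n+N≤k)))) (zeroʳ _)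
          where
          n+j<n+N : n ℕ.+ toℕ j ℕ.< n ℕ.+ N
          n+j<n+N = ℕ.+-monoʳ-< n (ℕ.≰⇒> N≰j)
          toℕ-n⊕j : toℕ (reduce n ⊕ j) ≡ n ℕ.+ toℕ j
          toℕ-n⊕j = ≡.trans (≡.cong toℕ (≡.trans (⊕-comm (reduce n) j)
              (≡.trans (reduce-+ (toℕ j) n) (≡.cong reduce (ℕ.+-comm (toℕ j) n)))))
            (toℕ-reduce (ℕ.<-≤-trans n+j<n+N n+N≤q))

      DegreeBelow-+ : ∀ {N f g} → DegreeBelow N f → DegreeBelow N g → DegreeBelow N (f R.+ g)
      DegreeBelow-+ f-low g-low k N≤k = trans (+-cong (f-low k N≤k) (g-low k N≤k)) (+-identityʳ _)

      DegreeBelow-neg : ∀ {N f} → DegreeBelow N f → DegreeBelow N (R.- f)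
      DegreeBelow-neg f-low k N≤k = trans (-‿cong (f-low k N≤k)) -0#≈0#

      DegreeBelow-≤ : ∀ {M N f} → M ℕ.≤ N → DegreeBelow M f → DegreeBelow N f
      DegreeBelow-≤ M≤N f-low k N≤k = f-low k (ℕ.≤-trans M≤N N≤k)

      DegreeBelow-cong : ∀ {N f g} → f R.≈ g → DegreeBelow N f → DegreeBelow N g
      DegreeBelow-cong f≈g f-low k N≤k = trans (sym (f≈g k)) (f-low k N≤k)

      -- The leading terms give x ^ (n + N). The rest is x ^ n g - x f, and x f stays below this
      -- degree because N + 1 < n + N.
      Monic-* : ∀ {n N f} → 1 ℕ.< n → n ℕ.+ N ℕ.< q → Monic N f → Monic (n ℕ.+ N) (f ⋆ (x ^ n R.- x))
      Monic-* {n} {N} {f} 1<n n+N<q (g , g-low , f≈) = h , h-low , λ k → sym (begin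
        ((x ^ (n ℕ.+ N)) R.+ h) k                                    ≈⟨ factored k ⟩
        (f ⋆ (x ^ n R.- x)) k                                        ∎)
        where
        open RingProperties R.ring using (-‿distribʳ-*)
        h : R.Carrier
        h = (x ^ n ⋆ g) R.+ (R.- (x ⋆ f))
        xf-low : DegreeBelow (n ℕ.+ N) (x ⋆ f)
        xf-low = DegreeBelow-cong {f = x ^ suc N R.+ x ^ 1 ⋆ g}
          (R.trans (R.+-congˡ {x ^ suc N} (R.*-congʳ {g} (R.*-identityʳ x)))
            (R.trans (R.sym (R.distribˡ x (x ^ N) g)) (R.*-congˡ {x} (R.sym f≈))))
          (DegreeBelow-+ (DegreeBelow-x^ (ℕ.+-monoˡ-< N 1<n) (ℕ.<-trans (ℕ.+-monoˡ-< N 1<n) n+N<q))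
            (DegreeBelow-≤ (ℕ.+-monoˡ-≤ N (ℕ.<⇒≤ 1<n))
              (DegreeBelow-x^-⋆ 1 (ℕ.<⇒≤ (ℕ.<-trans (ℕ.+-monoˡ-< N 1<n) n+N<q)) g-low)))
        h-low : DegreeBelow (n ℕ.+ N) h
        h-low = DegreeBelow-+ (DegreeBelow-x^-⋆ n (ℕ.<⇒≤ n+N<q) g-low) (DegreeBelow-neg xf-low)
        factored : (x ^ (n ℕ.+ N)) R.+ h R.≈ f ⋆ (x ^ n R.- x)
        factored = RR.begin
          (x ^ (n ℕ.+ N)) R.+ ((x ^ n ⋆ g) R.- (x ⋆ f))
            RR.≈⟨ R.sym (R.+-assoc (x ^ (n ℕ.+ N)) (x ^ n ⋆ g) (R.- (x ⋆ f))) ⟩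
          ((x ^ (n ℕ.+ N)) R.+ (x ^ n ⋆ g)) R.- (x ⋆ f)
            RR.≈⟨ R.+-congʳ { (R.- (x ⋆ f)) } (R.+-congʳ {x ^ n ⋆ g}
                (Exp.^-homo-* R.commutativeSemiring x n N)) ⟩
          ((x ^ n ⋆ x ^ N) R.+ (x ^ n ⋆ g)) R.- (x ⋆ f)
            RR.≈⟨ R.+-congʳ { (R.- (x ⋆ f)) } (R.sym (R.distribˡ (x ^ n) (x ^ N) g)) ⟩
          (x ^ n ⋆ ((x ^ N) R.+ g)) R.- (x ⋆ f)
            RR.≈⟨ R.+-congʳ { (R.- (x ⋆ f)) } (R.*-congˡ {x ^ n} (R.sym f≈)) ⟩
          (x ^ n ⋆ f) R.- (x ⋆ f)
            RR.≈⟨ R.+-cong (R.*-comm (x ^ n) f) (R.-‿cong (R.*-comm x f)) ⟩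
          (f ⋆ x ^ n) R.- (f ⋆ x)
            RR.≈⟨ R.+-congˡ {f ⋆ x ^ n} (-‿distribʳ-* f x) ⟩
          (f ⋆ x ^ n) R.+ (f ⋆ (R.- x))
            RR.≈⟨ R.sym (R.distribˡ f (x ^ n) (R.- x)) ⟩
          f ⋆ (x ^ n R.- x)                                RR.∎
          where module RR = SetoidReasoning R.setoid

      Monic-nonzero : ∀ {N f} → N ℕ.< q → Monic N f → ¬ (f R.≈ R.0#)
      Monic-nonzero {N} {f} N<q (g , g-low , f≈) f≈0 = 1≉0 (begin
        1#                                            ≈⟨ +-identityʳ _ ⟨
        1# + 0#                                       ≡⟨ ≡.cong (_+ 0#) (Iₘ-diagonal (reduce N)) ⟨
        Iₘ (reduce N) (reduce N) + 0#
          ≈⟨ +-cong (x^ N (reduce N)) (g-low (reduce N) (ℕ.≤-reflexive (≡.sym (toℕ-reduce N<q)))) ⟨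
        (x ^ N) (reduce N) + g (reduce N)             ≈⟨ f≈ (reduce N) ⟨
        f (reduce N)                                  ≈⟨ f≈0 (reduce N) ⟩
        0#                                            ∎)

      degree : ℕ → ℕ
      degree zero    = 0
      degree (suc d) = p ℕ.^ suc d ℕ.+ degree d

      -- Adding the next power of p at most doubles the bound, and 2 ≤ p.
      degree-< : ∀ d → degree d ℕ.< p ℕ.^ suc d
      degree-< zero    = ℕ.m^n>0 p 1
      degree-< (suc d) = ℕ.<-≤-trans (ℕ.+-monoʳ-< (p ℕ.^ suc d) (degree-< d))
        (ℕ.≤-trans (ℕ.≤-reflexive (≡.cong (p ℕ.^ suc d ℕ.+_) (≡.sym (ℕ.+-identityʳ _))))
          (ℕ.*-monoˡ-≤ (p ℕ.^ suc d) 1<p))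

      conjugateProduct-monic : ∀ d → d ℕ.≤ e → Monic (degree d) (conjugateProduct p x d)
      conjugateProduct-monic zero    _   = R.0# , (λ _ _ → refl) , R.sym (R.+-identityʳ R.1#)
      conjugateProduct-monic (suc d) d<e = Monic-*
        (1<p^e p-prime (s≤s (z≤n {d})))
        (ℕ.<-≤-trans (degree-< (suc d)) (ℕ.^-monoʳ-≤ p (s≤s d<e)))
        (conjugateProduct-monic d (ℕ.<⇒≤ d<e))

    primitiveDomainOver : PrimitiveDomain p (suc e)
    primitiveDomainOver = GeneratedRing.primitiveDomain R {p} {e} p-prime
      (λ f g → Fin.all? (λ k → f k ≟ g k))
      (λ k → trans (sym (R.*-identityʳ (Mat.fromℕ R p) k))
          (trans (fromℕ-⋆ p R.1# k) (trans (*-congʳ p·1≈0) (zeroˡ _))))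
      x
      (λ k → trans (x^ q k) (trans (reflexive (≡.cong (λ i → Iₘ i k) reduce-q)) refl))
      generate
      (Monic-nonzero (degree-< e) (conjugateProduct-monic e ℕ.≤-refl))

-- The integers modulo p

module IntegersMod {p : ℕ} (p-prime : Prime p) where

  infix 4 _≡ₚ_
  _≡ₚ_ : ℤ → ℤ → Set
  a ≡ₚ b = ℤ.+ p Signed.∣ a ℤ.- b

  open ℤ.+-*-Solver

  private
    instance
      p≢0 : ℕ.NonZero p
      p≢0 = prime⇒nonZero p-prime

    ≡⇒≡ₚ : ∀ {a b} → a ≡ b → a ≡ₚ b
    ≡⇒≡ₚ {a} ≡.refl = divides (ℤ.+ 0) (ℤ.+-inverseʳ a)

    via : ∀ {a b} → a ≡ b → ℤ.+ p Signed.∣ a → ℤ.+ p Signed.∣ b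
    via ≡.refl p∣a = p∣a

  ℤ/p : CommutativeRing 0ℓ 0ℓ
  ℤ/p = quotientRing ℤ.+-*-commutativeRing {_≡ₚ_}
    (record
      { refl  = λ {a} → ≡⇒≡ₚ {a} ≡.refl
      ; sym   = λ {a} {b} a~b → via (solve 2 (λ a b → :- (a :- b) := b :- a) ≡.refl a b) (∣m⇒∣-m a~b)
      ; trans = λ {a} {b} {d} a~b b~d →
          via (solve 3 (λ a b d → (a :- b) :+ (b :- d) := a :- d) ≡.refl a b d) (∣m∣n⇒∣m+n a~b b~d)
      })
    ≡⇒≡ₚ
    (λ {a} {b} {d} {f} a~b d~f →
      via (solve 4 (λ a b d f → (a :- b) :+ (d :- f) := (a :+ d) :- (b :+ f)) ≡.refl a b d f)
          (∣m∣n⇒∣m+n a~b d~f))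
    (λ {a} {b} {d} {f} a~b d~f →
      via (solve 4 (λ a b d f → d :* (a :- b) :+ b :* (d :- f) := (a :* d) :- (b :* f)) ≡.refl a b d f)
        (∣m∣n⇒∣m+n (∣n⇒∣m*n d a~b) (∣n⇒∣m*n b d~f)))
    (λ {a} {b} a~b → via (solve 2 (λ a b → :- (a :- b) := (:- a) :- (:- b)) ≡.refl a b) (∣m⇒∣-m a~b))

  fromℕ≡+ : ∀ n → Mat.fromℕ ℤ/p n ≡ ℤ.+ n
  fromℕ≡+ zero    = ≡.refl
  fromℕ≡+ (suc n) = ≡.cong (λ a → ℤ.1ℤ ℤ.+ a) (fromℕ≡+ n)

  residue : ∀ a → ∃ λ (i : Fin p) → a ≡ₚ Mat.fromℕ ℤ/p (toℕ i)
  residue a = Fin.fromℕ< (ℤ.n%ℕd<d a p) , divides (a ℤ./ℕ p) (≡.trans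
    (≡.cong₂ ℤ._-_ (ℤ.a≡a%ℕn+[a/ℕn]*n a p) (≡.trans (fromℕ≡+ _)
        (≡.cong (λ n → ℤ.+ n) (Fin.toℕ-fromℕ< (ℤ.n%ℕd<d a p)))))
    (solve 2 (λ r s → (r :+ s) :- r := s) ≡.refl (ℤ.+ (a ℤ.%ℕ p)) (a ℤ./ℕ p ℤ.* ℤ.+ p)))

  primitiveDomain : ∀ e → PrimitiveDomain p (suc e)
  primitiveDomain e = primitiveDomainOver ℤ/p {p} {e} p-prime
    (λ a b → ℤ.+ p Signed.∣? (a ℤ.- b))
    (λ p∣1 → ℕ.<⇒≱ (ℕ.nonTrivial⇒n>1 p {{prime⇒nonTrivial p-prime}}) (∣⇒≤ (Signed.∣⇒∣ᵤ p∣1)))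
    (≡.subst (_≡ₚ ℤ.0ℤ) (≡.sym (fromℕ≡+ p)) (divides ℤ.1ℤ
        (≡.trans (ℤ.+-identityʳ (ℤ.+ p)) (≡.sym (ℤ.*-identityˡ (ℤ.+ p))))))
    residue

finiteDomainOfPrimePower : ∀ {q} → IsPrimePower q → FiniteDomain q
finiteDomainOfPrimePower (p , suc e , p-prime , 1≤e , ≡.refl) =
  finiteDomain p-prime 1≤e (IntegersMod.primitiveDomain p-prime e)

-- Matrices over a commutative ring

module MatrixProperties (R : CommutativeRing c ℓ) where
  open CommutativeRing R hiding (zero)
  open FiniteSums R
  open Mat R hiding (Iₘ)
  open SetoidReasoning setoid

  -- The source of the entry conditions on the matrix products: an entry is zero or a single term
  -- because at most one index satisfies the incidence condition `P`.
  sum-atMostOne : ∀ {n} (f : Vector Carrier n) {P : Fin n → Set} → (∀ l → Dec (P l)) →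
                  (∀ l → ¬ P l → f l ≈ 0#) → (∀ l l′ → P l → P l′ → l ≡ l′) →
                  sum f ≈ 0# ⊎ ∃ λ l → sum f ≈ f l
  sum-atMostOne f P? f≈0 unique with Fin.any? P?
  ... | yes (l , Pl) = inj₂ (l , sum-single l λ l′ l′≢l → f≈0 l′ λ Pl′ → l′≢l (unique l′ l Pl′ Pl))
  ... | no ¬∃P       = inj₁ (sum-zero λ l → f≈0 l λ Pl → ¬∃P (l , Pl))

  sum-+ : ∀ m {n} (f : Vector Carrier (m ℕ.+ n)) →
          sum f ≈ sum (λ i → f (i ↑ˡ n)) + sum (λ j → f (m ↑ʳ j))
  sum-+ zero    f = sym (+-identityˡ _)
  sum-+ (suc m) f = trans (+-congˡ (sum-+ m (f ∘ suc))) (sym (+-assoc _ _ _))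

  sum-combine : ∀ m n (f : Vector Carrier (m ℕ.* n)) →
                sum f ≈ sum (λ (i : Fin m) → sum (λ (j : Fin n) → f (combine i j)))
  sum-combine zero    n f = refl
  sum-combine (suc m) n f = trans (sum-+ n f) (+-congˡ (sum-combine m n (λ l → f (n ↑ʳ l))))

  sum-remQuot : ∀ m n (f : Fin m → Fin n → Carrier) →
                sum (λ l → let i , j = remQuot {m} n l in f i j) ≈ sum (λ i → sum (λ j → f i j))
  sum-remQuot m n f = trans (sum-combine m n _) (sum-cong-≋ λ i → sum-cong-≋ λ j →
    reflexive (≡.cong (λ (i , j) → f i j) (Fin.remQuot-combine {m} {n} i j)))

  Iₘ-combine : ∀ {m n} (i j : Fin m) (y z : Fin n) → Iₘ (combine i y) (combine j z) ≈ Iₘ i j * Iₘ y z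
  Iₘ-combine i j y z with i Fin.≟ j | y Fin.≟ z
  ... | yes ≡.refl | yes ≡.refl = trans (reflexive (Iₘ-diagonal (combine i y))) (sym (*-identityˡ _))
  ... | yes ≡.refl | no y≢z     = trans (reflexive (Iₘ-off (y≢z ∘ Fin.combine-injectiveʳ i y j z)))
      (sym (zeroʳ _))
  ... | no i≢j     | _          = trans (reflexive (Iₘ-off (i≢j ∘ Fin.combine-injectiveˡ i y j z)))
      (sym (zeroˡ _))

  Iₘ-remQuot : ∀ m n (k l : Fin (m ℕ.* n)) →
               let i , y = remQuot {m} n k ; j , z = remQuot {m} n l in Iₘ k l ≈ Iₘ i j * Iₘ y z
  Iₘ-remQuot m n k l = trans
    (reflexive (≡.sym (≡.cong₂ Iₘ (Fin.combine-remQuot {m} n k) (Fin.combine-remQuot {m} n l))))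
    (Iₘ-combine {m} {n} _ _ _ _)

  *ₘ-cong : ∀ {n} {X X′ Y Y′ : Matrix Carrier n} → X ≈ₘ X′ → Y ≈ₘ Y′ → X *ₘ Y ≈ₘ X′ *ₘ Y′
  *ₘ-cong X≈ Y≈ i j = sum-cong-≋ λ l → *-cong (X≈ i l) (Y≈ l j)

  *ₘ-assoc : ∀ {n} (X Y Z : Matrix Carrier n) → (X *ₘ Y) *ₘ Z ≈ₘ X *ₘ (Y *ₘ Z)
  *ₘ-assoc X Y Z i j = begin
    sum (λ l → sum (λ h → X i h * Y h l) * Z l j)
      ≈⟨ sum-cong-≋ (λ l → trans (*-distribʳ-sum (Z l j) (λ h → X i h * Y h l))
                                                             (sum-cong-≋ λ h → *-assoc (X i h) (Y h l)
                                                                 (Z l j))) ⟩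
    sum (λ l → sum (λ h → X i h * (Y h l * Z l j)))    ≈⟨ ∑-comm (λ l h → X i h * (Y h l * Z l j)) ⟩
    sum (λ h → sum (λ l → X i h * (Y h l * Z l j)))
      ≈⟨ sum-cong-≋ (λ h → *-distribˡ-sum (X i h) (λ l → Y h l * Z l j)) ⟨
    sum (λ h → X i h * sum (λ l → Y h l * Z l j))      ∎

  *ₘ-•ₘ : ∀ {n} x (X Y : Matrix Carrier n) → X *ₘ (x •ₘ Y) ≈ₘ x •ₘ (X *ₘ Y)
  *ₘ-•ₘ x X Y i j = trans (sum-cong-≋ λ l → x∙yz≈y∙xz (X i l) x (Y l j))
      (sym (*-distribˡ-sum x (λ l → X i l * Y l j)))
    where open CommutativeSemigroupProperties *-commutativeSemigroup using (x∙yz≈y∙xz)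

  *ₘ-identityˡ : ∀ {n} (X : Matrix Carrier n) → Iₘ *ₘ X ≈ₘ X
  *ₘ-identityˡ X i j = sum-Iₘ i (λ l → X l j)

  *ₘ-identityʳ : ∀ {n} (X : Matrix Carrier n) → X *ₘ Iₘ ≈ₘ X
  *ₘ-identityʳ X i j = trans
    (sum-cong-≋ λ l → trans (*-comm (X i l) (Iₘ l j)) (*-congʳ (reflexive (Iₘ-sym l j))))
    (sum-Iₘ j (X i))

  •ₘ-*ₘ : ∀ {n} x (X Y : Matrix Carrier n) → (x •ₘ X) *ₘ Y ≈ₘ x •ₘ (X *ₘ Y)
  •ₘ-*ₘ x X Y i j = trans (sum-cong-≋ λ l → *-assoc x (X i l) (Y l j))
      (sym (*-distribˡ-sum x (λ l → X i l * Y l j)))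

  transpose-*ₘ : ∀ {n} (X Y : Matrix Carrier n) → transpose (X *ₘ Y) ≈ₘ transpose Y *ₘ transpose X
  transpose-*ₘ X Y i j = sum-cong-≋ λ l → *-comm (X j l) (Y l i)

  -- The scalar matrix M Mᵀ can be taken out of the middle of X (M Mᵀ) Yᵀ. This serves for the
  -- designs X a K and also for the orthogonality of X a (X b)ᵀ.
  *ₘ-orthogonal : ∀ {n} (X Y M : Matrix Carrier n) {x} → M *ₘ transpose M ≈ₘ x •ₘ Iₘ →
                  (X *ₘ M) *ₘ transpose (Y *ₘ M) ≈ₘ x •ₘ (X *ₘ transpose Y)
  *ₘ-orthogonal X Y M {x} MMᵀ i j = begin
    ((X *ₘ M) *ₘ transpose (Y *ₘ M)) i j
      ≈⟨ *ₘ-cong {X = X *ₘ M} (λ _ _ → refl) (transpose-*ₘ Y M) i j ⟩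
    ((X *ₘ M) *ₘ (transpose M *ₘ transpose Y)) i j
      ≈⟨ *ₘ-assoc X M (transpose M *ₘ transpose Y) i j ⟩
    (X *ₘ (M *ₘ (transpose M *ₘ transpose Y))) i j
      ≈⟨ *ₘ-cong {X = X} (λ _ _ → refl) (*ₘ-assoc M (transpose M) (transpose Y)) i j ⟨
    (X *ₘ ((M *ₘ transpose M) *ₘ transpose Y)) i j
      ≈⟨ *ₘ-cong {X = X} (λ _ _ → refl) (*ₘ-cong {Y = transpose Y} MMᵀ (λ _ _ → refl)) i j ⟩
    (X *ₘ ((x •ₘ Iₘ) *ₘ transpose Y)) i j
      ≈⟨ *ₘ-cong {X = X} (λ _ _ → refl) (•ₘ-*ₘ x Iₘ (transpose Y)) i j ⟩
    (X *ₘ (x •ₘ (Iₘ *ₘ transpose Y))) i j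
      ≈⟨ *ₘ-cong {X = X} (λ _ _ → refl) (λ k l → *-congˡ (*ₘ-identityˡ (transpose Y) k l)) i j ⟩
    (X *ₘ (x •ₘ transpose Y)) i j                          ≈⟨ *ₘ-•ₘ x X (transpose Y) i j ⟩
    (x •ₘ (X *ₘ transpose Y)) i j                          ∎

  infixl 7 _⊗_
  _⊗_ : ∀ {m n} → Matrix Carrier m → Matrix Carrier n → Matrix Carrier (m ℕ.* n)
  _⊗_ {m} {n} X Y k l = let i , y = remQuot {m} n k ; j , z = remQuot {m} n l in X i j * Y y z

  ⊗-*ₘ : ∀ {m n} (X X′ : Matrix Carrier m) (Y Y′ : Matrix Carrier n) →
         (X ⊗ Y) *ₘ (X′ ⊗ Y′) ≈ₘ (X *ₘ X′) ⊗ (Y *ₘ Y′)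
  ⊗-*ₘ {m} {n} X X′ Y Y′ k l = let i , y = remQuot {m} n k ; j , z = remQuot {m} n l in begin
    sum ((λ (h , w) → (X i h * Y y w) * (X′ h j * Y′ w z)) ∘ remQuot {m} n)
      ≈⟨ sum-remQuot m n (λ h w → (X i h * Y y w) * (X′ h j * Y′ w z)) ⟩
    sum (λ h → sum (λ w → (X i h * Y y w) * (X′ h j * Y′ w z)))
      ≈⟨ sum-cong-≋ (λ h → sum-cong-≋ λ w → interchange (X i h) (Y y w) (X′ h j) (Y′ w z)) ⟩
    sum (λ h → sum (λ w → (X i h * X′ h j) * (Y y w * Y′ w z)))
      ≈⟨ sum-cong-≋ (λ h → *-distribˡ-sum (X i h * X′ h j) (λ w → Y y w * Y′ w z)) ⟨
    sum (λ h → (X i h * X′ h j) * sum (λ w → Y y w * Y′ w z))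
      ≈⟨ *-distribʳ-sum (sum (λ w → Y y w * Y′ w z)) (λ h → X i h * X′ h j) ⟨
    sum (λ h → X i h * X′ h j) * sum (λ w → Y y w * Y′ w z)        ∎
    where open CommutativeSemigroupProperties *-commutativeSemigroup using (interchange)

  ⊗-orthogonal : ∀ {m n} (X : Matrix Carrier m) (Y : Matrix Carrier n) {x y} →
                 X *ₘ transpose X ≈ₘ x •ₘ Iₘ → Y *ₘ transpose Y ≈ₘ y •ₘ Iₘ →
                 (X ⊗ Y) *ₘ transpose (X ⊗ Y) ≈ₘ (x * y) •ₘ Iₘ
  ⊗-orthogonal {m} {n} X Y {x} {y} XXᵀ YYᵀ k l = begin
    ((X ⊗ Y) *ₘ transpose (X ⊗ Y)) k l
      ≈⟨ ⊗-*ₘ X (transpose X) Y (transpose Y) k l ⟩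
    ((X *ₘ transpose X) ⊗ (Y *ₘ transpose Y)) k l          ≈⟨ *-cong (XXᵀ _ _) (YYᵀ _ _) ⟩
    (x * _) * (y * _)                                      ≈⟨ interchange _ _ _ _ ⟩
    (x * y) * (_ * _)                                      ≈⟨ *-congˡ (Iₘ-remQuot m n k l) ⟨
    (x * y) * Iₘ k l                                       ∎
    where open CommutativeSemigroupProperties *-commutativeSemigroup using (interchange)

  Iₘ-orthogonal : ∀ {n} → Iₘ {n} *ₘ transpose Iₘ ≈ₘ 1# •ₘ Iₘ
  Iₘ-orthogonal i j = trans (sum-Iₘ i (λ l → Iₘ j l)) (trans (reflexive (Iₘ-sym j i)) (sym (*-identityˡ _)))

-- Weighing matrices from lines

-- line a j c is the second coordinate of the point with first
-- coordinate j on the line with slope a and intercept c.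
record Lines (m q : ℕ) : Set where
  field
    line           : Fin m → Fin m → Fin q → Fin q
    line-injective : ∀ a j {c c′} → line a j c ≡ line a j c′ → c ≡ c′
    line-meet      : ∀ {a b} → a ≢ b → ∀ c c′ {j j′} →
                     line a j c ≡ line b j c′ → line a j′ c ≡ line b j′ c′ → j ≡ j′
    notHorizontal  : m ≢ q → ∀ a c {j j′} → line a j c ≡ line a j′ c → j ≡ j′

-- If m < q, then the slopes can be chosen to be nonzero.
linesOverDomain : ∀ {m q} → m ℕ.≤ q → FiniteDomain q → Lines m q
linesOverDomain {m} {q} m≤q F = record
  { line = line ; line-injective = line-injective ; line-meet = line-meet
  ; notHorizontal = λ m≢q a c → horizontal (slope-nonzero m≢q a) c }
  where
  open FiniteDomain F
  open RingProperties (CommutativeRing.ring (FiniteDomain.ring F))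
    using (x∙y⁻¹≈ε⇒x≈y; +-cancelˡ; +-cancelʳ; -‿distribʳ-*; -‿distribˡ-*)
  open SetoidReasoning setoid

  to-injective : ∀ {i j} → to i ≈ to j → i ≡ j
  to-injective eq = ≡.trans (≡.sym (from∘to _)) (≡.trans (from-cong eq) (from∘to _))

  from-injective : ∀ {x y} → from x ≡ from y → x ≈ y
  from-injective eq = trans (sym (to∘from _)) (trans (reflexive (≡.cong to eq)) (to∘from _))

  column : Fin m → Carrier
  column j = to (Fin.inject≤ j m≤q)

  column-injective : ∀ {i j} → column i ≈ column j → i ≡ j
  column-injective eq = Fin.inject≤-injective m≤q m≤q _ _ (to-injective eq)

  slopes : ∃ λ (slope : Fin m → Carrier) → (∀ {a b} → slope a ≈ slope b → a ≡ b) ×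
             (m ≢ q → ∀ a → ¬ (slope a ≈ 0#))
  slopes with m ℕ.≟ q
  ... | yes m≡q = column , column-injective , λ m≢q → contradiction m≡q m≢q
  ... | no m≢q  = avoid q m≤q m≢q to to-injective (from 0#) (to∘from 0#)
    where
    -- The size is generalised so that it can be split as a successor; `o` is the index of the zero
    -- of F, and `Fin.punchIn o` skips it.
    avoid : ∀ q → m ℕ.≤ q → m ≢ q → (to : Fin q → Carrier) → (∀ {i j} → to i ≈ to j → i ≡ j) → ∀ o → to o ≈ 0# →
            ∃ λ (slope : Fin m → Carrier) → (∀ {a b} → slope a ≈ slope b → a ≡ b) ×
                (m ≢ q → ∀ a → ¬ (slope a ≈ 0#))
    avoid (suc q) m≤1+q m≢1+q to to-inj o to-o≈0 =
      (λ a → to (Fin.punchIn o (Fin.inject≤ a m≤q′))) ,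
      (λ eq → Fin.inject≤-injective m≤q′ m≤q′ _ _ (Fin.punchIn-injective o _ _ (to-inj eq))) ,
      λ _ a eq → Fin.punchInᵢ≢i o _ (to-inj (trans eq (sym to-o≈0)))
      where
      m≤q′ : m ℕ.≤ q
      m≤q′ = ℕ.≤-pred (ℕ.≤∧≢⇒< m≤1+q m≢1+q)

  slope : Fin m → Carrier
  slope = proj₁ slopes

  slope-injective : ∀ {a b} → slope a ≈ slope b → a ≡ b
  slope-injective = proj₁ (proj₂ slopes)

  slope-nonzero : m ≢ q → ∀ a → ¬ (slope a ≈ 0#)
  slope-nonzero = proj₂ (proj₂ slopes)

  line : Fin m → Fin m → Fin q → Fin q
  line a j c = from (slope a * column j + to c)

  line-injective : ∀ a j {c c′} → line a j c ≡ line a j c′ → c ≡ c′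
  line-injective a j eq = to-injective (+-cancelˡ (slope a * column j) _ _ (from-injective eq))

  *-cancelˡ : ∀ {x y z} → ¬ (x ≈ 0#) → x * y ≈ x * z → y ≈ z
  *-cancelˡ {x} {y} {z} x≉0 xy≈xz with domain {x} {y - z} (begin
      x * (y - z)         ≈⟨ distribˡ _ _ _ ⟩
      x * y + x * - z     ≈⟨ +-cong xy≈xz (sym (-‿distribʳ-* x z)) ⟩
      x * z - x * z       ≈⟨ -‿inverseʳ _ ⟩
      0#                  ∎)
  ... | inj₁ x≈0   = contradiction x≈0 x≉0
  ... | inj₂ y-z≈0 = x∙y⁻¹≈ε⇒x≈y _ _ y-z≈0

  horizontal : ∀ {a} → ¬ (slope a ≈ 0#) → ∀ c {j j′} → line a j c ≡ line a j′ c → j ≡ j′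
  horizontal {a} slope≉0 c eq = column-injective (*-cancelˡ slope≉0 (+-cancelʳ (to c) _ _ (from-injective eq)))

  -- A common point with abscissa x satisfies (s - t) x = c′ - c for the slopes s and t, and s - t
  -- can be cancelled.
  line-meet : ∀ {a b} → a ≢ b → ∀ c c′ {j j′} →
              line a j c ≡ line b j c′ → line a j′ c ≡ line b j′ c′ → j ≡ j′
  line-meet {a} {b} a≢b c c′ {j} {j′} eq eq′ = column-injective
    (*-cancelˡ (λ s-t≈0 → a≢b (slope-injective (x∙y⁻¹≈ε⇒x≈y _ _ s-t≈0)))
        (trans (difference (from-injective eq)) (sym (difference (from-injective eq′)))))
    where
    s = slope a
    t = slope b
    difference : ∀ {x} → s * x + to c ≈ t * x + to c′ → (s - t) * x ≈ to c′ - to c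
    difference {x} sx+c≈tx+c′ = begin
      (s - t) * x                                   ≈⟨ distribʳ x s (- t) ⟩
      s * x + - t * x                               ≈⟨ +-cong (+-identityʳ _) (-‿distribˡ-* t x) ⟨
      (s * x + 0#) - t * x                          ≈⟨ +-congʳ (+-congˡ (-‿inverseʳ (to c))) ⟨
      (s * x + (to c - to c)) - t * x               ≈⟨ +-congʳ (+-assoc _ _ _) ⟨
      ((s * x + to c) - to c) - t * x               ≈⟨ +-congʳ (+-congʳ sx+c≈tx+c′) ⟩
      ((t * x + to c′) - to c) - t * x              ≈⟨ +-congʳ (+-assoc _ _ _) ⟩
      (t * x + (to c′ - to c)) - t * x              ≈⟨ +-congʳ (+-comm _ _) ⟩
      ((to c′ - to c) + t * x) - t * x              ≈⟨ +-assoc _ _ _ ⟩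
      (to c′ - to c) + (t * x - t * x)              ≈⟨ +-congˡ (-‿inverseʳ _) ⟩
      (to c′ - to c) + 0#                           ≈⟨ +-identityʳ _ ⟩
      to c′ - to c                                  ∎

-- Integer matrices and their Gram products

module IntegerMatrices where

  open ℤM hiding (Iₘ)
  open MatrixProperties ℤ.+-*-commutativeRing
  open FiniteSums ℤ.+-*-commutativeRing

  Ternary : ℤ → Set
  Ternary z = z ≡ ℤ.0ℤ ⊎ z ≡ ℤ.1ℤ ⊎ z ≡ ℤ.-1ℤ

  Ternary-* : ∀ {y z} → Ternary y → Ternary z → Ternary (y ℤ.* z)
  Ternary-* (inj₁ ≡.refl)                 _                             = inj₁ ≡.refl
  Ternary-* {y} (inj₂ _)                  (inj₁ ≡.refl)                 = inj₁ (ℤ.*-zeroʳ y)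
  Ternary-* (inj₂ (inj₁ ≡.refl))          (inj₂ (inj₁ ≡.refl))          = inj₂ (inj₁ ≡.refl)
  Ternary-* (inj₂ (inj₁ ≡.refl))          (inj₂ (inj₂ ≡.refl))          = inj₂ (inj₂ ≡.refl)
  Ternary-* (inj₂ (inj₂ ≡.refl))          (inj₂ (inj₁ ≡.refl))          = inj₂ (inj₂ ≡.refl)
  Ternary-* (inj₂ (inj₂ ≡.refl))          (inj₂ (inj₂ ≡.refl))          = inj₂ (inj₁ ≡.refl)

  Iₘ-ternary : ∀ {n} (i j : Fin n) → Ternary (Iₘ i j)
  Iₘ-ternary i j with i Fin.≟ j
  ... | yes _ = inj₂ (inj₁ ≡.refl)
  ... | no _  = inj₁ ≡.refl

  square-nonNegative : ∀ z → ℤ.0ℤ ℤ.≤ z ℤ.* z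
  square-nonNegative ℤ.+0       = ℤ.+≤+ z≤n
  square-nonNegative ℤ.+[1+ n ] = ℤ.+≤+ z≤n
  square-nonNegative ℤ.-[1+ n ] = ℤ.+≤+ z≤n

  square-zero : ∀ z → z ℤ.* z ≡ ℤ.0ℤ → z ≡ ℤ.0ℤ
  square-zero z zz≡0 = [ (λ eq → eq) , (λ eq → eq) ]′ (ℤ.i*j≡0⇒i≡0∨j≡0 z zz≡0)

  sum-nonNegative : ∀ {n} (f : Vector ℤ n) → (∀ i → ℤ.0ℤ ℤ.≤ f i) → ℤ.0ℤ ℤ.≤ sum f
  sum-nonNegative {zero}  f 0≤f = ℤ.≤-refl
  sum-nonNegative {suc n} f 0≤f = ℤ.+-mono-≤ (0≤f zero) (sum-nonNegative (f ∘ suc) (0≤f ∘ suc))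

  sum-nonNegative-zero : ∀ {n} (f : Vector ℤ n) → (∀ i → ℤ.0ℤ ℤ.≤ f i) → sum f ≡ ℤ.0ℤ → ∀ i → f i ≡ ℤ.0ℤ
  sum-nonNegative-zero {suc n} f 0≤f sum≡0 = λ
    { zero    → head≡0
    ; (suc i) → sum-nonNegative-zero (f ∘ suc) (0≤f ∘ suc) tail≡0 i
    }
    where
    tail = sum (f ∘ suc)
    head≡0 : f zero ≡ ℤ.0ℤ
    head≡0 = ℤ.≤-antisym (≡.subst₂ ℤ._≤_ (ℤ.+-identityʳ (f zero)) sum≡0
      (ℤ.+-monoʳ-≤ (f zero) (sum-nonNegative (f ∘ suc) (0≤f ∘ suc)))) (0≤f zero)
    tail≡0 : tail ≡ ℤ.0ℤ
    tail≡0 = ≡.trans (≡.sym (ℤ.+-identityˡ tail)) (≡.trans (≡.cong (λ z → z ℤ.+ tail) (≡.sym head≡0)) sum≡0)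

  -- With M = XᵀX one has MMᵀ = kM and tr M = tr XXᵀ, so the squares of the
  -- entries of kI - M add up to k tr (kI - M) = 0.
  transpose-orthogonal : ∀ {n} (X : Matrix ℤ n) k → X *ₘ transpose X ≈ₘ k •ₘ Iₘ → transpose X *ₘ X ≈ₘ k •ₘ Iₘ
  transpose-orthogonal {n} X k XXᵀ i j = ℤ.i-j≡0⇒i≡j (M i j) (k ℤ.* Iₘ i j) (≡.trans
    (solve 2 (λ m kd → m :- kd := :- (kd :- m)) ≡.refl (M i j) (k ℤ.* Iₘ i j)) (≡.cong ℤ.-_ (N≡0 i j)))
    where
    open ℤ.+-*-Solver
    open ≡.≡-Reasoning
    M N : Matrix ℤ n
    M = transpose X *ₘ X
    N i j = k ℤ.* Iₘ i j ℤ.- M i j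

    M-square : ∀ i → sum (λ j → M i j ℤ.* M i j) ≡ k ℤ.* M i i
    M-square i = ≡.trans
      (sum-cong-≋ {x = λ j → M i j ℤ.* M i j} λ j → ≡.cong (M i j ℤ.*_)
          (sum-cong-≋ λ l → ℤ.*-comm (X l i) (X l j)))
      (*ₘ-orthogonal′ i i)
      where
      *ₘ-orthogonal′ : M *ₘ M ≈ₘ k •ₘ M
      *ₘ-orthogonal′ i j = begin
        (M *ₘ M) i j
          ≡⟨ *ₘ-assoc (transpose X) X (transpose X *ₘ X) i j ⟩
        (transpose X *ₘ (X *ₘ (transpose X *ₘ X))) i j
          ≡⟨ *ₘ-cong {X = transpose X} (λ _ _ → ≡.refl) (*ₘ-assoc X (transpose X) X) i j ⟨
        (transpose X *ₘ ((X *ₘ transpose X) *ₘ X)) i j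
          ≡⟨ *ₘ-cong {X = transpose X} (λ _ _ → ≡.refl) (*ₘ-cong {Y = X} XXᵀ (λ _ _ → ≡.refl)) i j ⟩
        (transpose X *ₘ ((k •ₘ Iₘ) *ₘ X)) i j
          ≡⟨ *ₘ-cong {X = transpose X} (λ _ _ → ≡.refl)
              (λ h l → ≡.trans (•ₘ-*ₘ k Iₘ X h l) (≡.cong (k ℤ.*_) (*ₘ-identityˡ X h l))) i j ⟩
        (transpose X *ₘ (k •ₘ X)) i j                          ≡⟨ *ₘ-•ₘ k (transpose X) X i j ⟩
        k ℤ.* M i j                                            ∎

    N-square : ∀ i → sum (λ j → N i j ℤ.* N i j) ≡ k ℤ.* (k ℤ.- M i i)
    N-square i = begin
      sum (λ j → N i j ℤ.* N i j)
        ≡⟨ sum-cong-≋ (λ j → solve 3 (λ k d m → (k :* d :- m) :* (k :* d :- m) := d :*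
            (k :* (k :* d :- (m :+ m))) :+ m :* m) ≡.refl k (Iₘ i j) (M i j)) ⟩
      sum (λ j → Iₘ i j ℤ.* (k ℤ.* (k ℤ.* Iₘ i j ℤ.- (M i j ℤ.+ M i j))) ℤ.+ M i j ℤ.* M i j)
        ≡⟨ ∑-distrib-+ (λ j → Iₘ i j ℤ.* (k ℤ.* (k ℤ.* Iₘ i j ℤ.- (M i j ℤ.+ M i j)))) (λ j → M i j ℤ.* M i j) ⟩
      sum (λ j → Iₘ i j ℤ.* (k ℤ.* (k ℤ.* Iₘ i j ℤ.- (M i j ℤ.+ M i j)))) ℤ.+ sum (λ j → M i j ℤ.* M i j)
        ≡⟨ ≡.cong₂ ℤ._+_ (sum-Iₘ i (λ j → k ℤ.* (k ℤ.* Iₘ i j ℤ.- (M i j ℤ.+ M i j)))) (M-square i) ⟩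
      k ℤ.* (k ℤ.* Iₘ i i ℤ.- (M i i ℤ.+ M i i)) ℤ.+ k ℤ.* M i i
        ≡⟨ ≡.cong (λ d → k ℤ.* (k ℤ.* d ℤ.- (M i i ℤ.+ M i i)) ℤ.+ k ℤ.* M i i) (Iₘ-diagonal i) ⟩
      k ℤ.* (k ℤ.* ℤ.1ℤ ℤ.- (M i i ℤ.+ M i i)) ℤ.+ k ℤ.* M i i
        ≡⟨ solve 2 (λ k m → k :* (k :* con ℤ.1ℤ :- (m :+ m)) :+ k :* m := k :* (k :- m)) ≡.refl k (M i i) ⟩
      k ℤ.* (k ℤ.- M i i) ∎

    trace : sum (λ i → k ℤ.- M i i) ≡ ℤ.0ℤ
    trace = begin
      sum (λ i → k ℤ.- M i i)                        ≡⟨ ∑-distrib-+ (λ _ → k) (λ i → ℤ.- M i i) ⟩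
      sum {n} (λ _ → k) ℤ.+ sum (λ i → ℤ.- M i i)
        ≡⟨ ≡.cong₂ ℤ._+_ (sum-cong-≋ {n} λ l → ≡.sym (diagonal l)) (sum-neg (λ i → M i i)) ⟩
      sum (λ l → sum (λ i → X l i ℤ.* X l i)) ℤ.- sum (λ i → M i i)
        ≡⟨ ≡.cong (λ t → t ℤ.- sum (λ i → M i i)) (∑-comm (λ l i → X l i ℤ.* X l i)) ⟩
      sum (λ i → M i i) ℤ.- sum (λ i → M i i)        ≡⟨ ℤ.+-inverseʳ (sum (λ i → M i i)) ⟩
      ℤ.0ℤ                                           ∎
      where
      diagonal : ∀ l → sum (λ i → X l i ℤ.* X l i) ≡ k
      diagonal l = ≡.trans (XXᵀ l l) (≡.trans (≡.cong (k ℤ.*_) (Iₘ-diagonal l)) (ℤ.*-identityʳ k))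
      sum-neg : ∀ {n} (f : Vector ℤ n) → sum (λ i → ℤ.- f i) ≡ ℤ.- sum f
      sum-neg {zero}  f = ≡.refl
      sum-neg {suc n} f = ≡.trans (≡.cong (λ t → ℤ.- f zero ℤ.+ t) (sum-neg (f ∘ suc)))
          (≡.sym (ℤ.neg-distrib-+ (f zero) (sum (f ∘ suc))))

    N≡0 : ∀ i j → N i j ≡ ℤ.0ℤ
    N≡0 i j = square-zero (N i j) (sum-nonNegative-zero (λ j → N i j ℤ.* N i j)
        (λ j → square-nonNegative (N i j))
      (sum-nonNegative-zero (λ i → sum (λ j → N i j ℤ.* N i j))
        (λ i → sum-nonNegative (λ j → N i j ℤ.* N i j) (λ j → square-nonNegative (N i j))) total i) j)
      where
      total : sum (λ i → sum (λ j → N i j ℤ.* N i j)) ≡ ℤ.0ℤ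
      total = begin
        sum (λ i → sum (λ j → N i j ℤ.* N i j))   ≡⟨ sum-cong-≋ N-square ⟩
        sum (λ i → k ℤ.* (k ℤ.- M i i))           ≡⟨ *-distribˡ-sum k (λ i → k ℤ.- M i i) ⟨
        k ℤ.* sum (λ i → k ℤ.- M i i)             ≡⟨ ≡.cong (k ℤ.*_) trace ⟩
        k ℤ.* ℤ.0ℤ                                ≡⟨ ℤ.*-zeroʳ k ⟩
        ℤ.0ℤ                                      ∎

  -- A zero row would make the diagonal entry of W Wᵀ equal to 0 instead of k.
  row-nonzero : ∀ {n k} {W : Matrix ℤ n} → 1 ℕ.≤ k → IsWeighingMatrix k W → ∀ i → ∃ λ j → W i j ≢ ℤ.0ℤ
  row-nonzero {n} {k} {W} 1≤k isW i with Fin.any? (λ j → ¬? (W i j ℤ.≟ ℤ.0ℤ))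
  ... | yes found = found
  ... | no ¬found = contradiction k≡0 (ℕ.<⇒≢ 1≤k ∘ ≡.sym)
    where
    open ≡.≡-Reasoning
    W≡0 : ∀ j → W i j ≡ ℤ.0ℤ
    W≡0 j = decidable-stable (W i j ℤ.≟ ℤ.0ℤ) λ W≢0 → ¬found (j , W≢0)
    k≡0 : k ≡ 0
    k≡0 = ℤ.+-injective (begin
      ℤ.+ k                                ≡⟨ ℤ.*-identityʳ (ℤ.+ k) ⟨
      ℤ.+ k ℤ.* ℤ.1ℤ                       ≡⟨ ≡.cong (ℤ.+ k ℤ.*_) (Iₘ-diagonal i) ⟨
      ℤ.+ k ℤ.* Iₘ i i                     ≡⟨ IsWeighingMatrix.orthogonal isW i i ⟨
      sum (λ j → W i j ℤ.* W i j)          ≡⟨ sum-zero (λ j → ≡.cong (ℤ._* W i j) (W≡0 j)) ⟩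
      ℤ.0ℤ                                 ∎)

  -- Multiply Y Xᵀ = k I by X from the right: since also Xᵀ X = k I, this gives k Y = k X. It
  -- recovers a line matrix from Gram products, which are what the designs determine directly.
  gram-injective : ∀ {n k} {X Y : Matrix ℤ n} → 1 ℕ.≤ k → X ℤM.*ₘ transpose X ℤM.≈ₘ ℤ.+ k ℤM.•ₘ ℤM.Iₘ →
                   Y ℤM.*ₘ transpose X ℤM.≈ₘ ℤ.+ k ℤM.•ₘ ℤM.Iₘ → X ℤM.≈ₘ Y
  gram-injective {k = k} {X} {Y} 1≤k XXᵀ YXᵀ i j = ℤ.*-cancelˡ-≡ (ℤ.+ k) (X i j)
      (Y i j) {{ℕ.>-nonZero 1≤k}} (begin
    ℤ.+ k ℤ.* X i j                           ≡⟨ ≡.cong (ℤ.+ k ℤ.*_) (*ₘ-identityˡ X i j) ⟨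
    ℤ.+ k ℤ.* (Iₘ *ₘ X) i j                   ≡⟨ •ₘ-*ₘ (ℤ.+ k) Iₘ X i j ⟨
    ((ℤ.+ k •ₘ Iₘ) *ₘ X) i j
      ≡⟨ *ₘ-cong {Y = X} (λ h l → ≡.sym (YXᵀ h l)) (λ _ _ → ≡.refl) i j ⟩
    ((Y *ₘ transpose X) *ₘ X) i j             ≡⟨ *ₘ-assoc Y (transpose X) X i j ⟩
    (Y *ₘ (transpose X *ₘ X)) i j
      ≡⟨ *ₘ-cong {X = Y} (λ _ _ → ≡.refl) (transpose-orthogonal X (ℤ.+ k) XXᵀ) i j ⟩
    (Y *ₘ (ℤ.+ k •ₘ Iₘ)) i j                  ≡⟨ *ₘ-•ₘ (ℤ.+ k) Y Iₘ i j ⟩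
    ℤ.+ k ℤ.* (Y *ₘ Iₘ) i j                   ≡⟨ ≡.cong (ℤ.+ k ℤ.*_) (*ₘ-identityʳ Y i j) ⟩
    ℤ.+ k ℤ.* Y i j                           ∎)
    where
    open ≡.≡-Reasoning

  -- The rows are indexed by pairs (i , c), where c is the intercept of a
  -- line, and the columns by the points (j , y).
  module LineMatrices {m q : ℕ} (L : Lines m q) {k : ℕ} {W : Matrix ℤ m} (isW : IsWeighingMatrix k W) where
    open Lines L
    open IsWeighingMatrix isW

    lineMatrix : Fin m → Matrix ℤ (m ℕ.* q)
    lineMatrix a r s = let i , c = remQuot {m} q r ; j , y = remQuot {m} q s in W i j ℤ.* Iₘ (line a j c) y

    private
      gramEntry : Fin m → Fin m → Fin m × Fin q → Fin m × Fin q → Fin m → ℤ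
      gramEntry a b (i , c) (i′ , c′) j = (W i j ℤ.* W i′ j) ℤ.* Iₘ (line a j c) (line b j c′)

    -- For a fixed abscissa j only the height `line a j c` contributes. What remains is a sum over j
    -- whose terms ask whether the two lines meet there.
    lineMatrix-gram : ∀ a b r r′ → (lineMatrix a *ₘ transpose (lineMatrix b)) r r′ ≡
      sum (gramEntry a b (remQuot {m} q r) (remQuot {m} q r′))
    lineMatrix-gram a b r r′ = let i , c = remQuot {m} q r ; i′ , c′ = remQuot {m} q r′ in begin
      (lineMatrix a *ₘ transpose (lineMatrix b)) r r′
        ≡⟨ sum-remQuot m q (λ j y → (W i j ℤ.* Iₘ (line a j c) y) ℤ.* (W i′ j ℤ.* Iₘ (line b j c′) y)) ⟩
      sum (λ j → sum (λ y → (W i j ℤ.* Iₘ (line a j c) y) ℤ.* (W i′ j ℤ.* Iₘ (line b j c′) y)))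
        ≡⟨ sum-cong-≋ (λ j → sum-cong-≋ λ y → solve 4
            (λ w d w′ d′ → (w :* d) :* (w′ :* d′) := d :* ((w :* w′) :* d′)) ≡.refl
             (W i j) (Iₘ (line a j c) y) (W i′ j) (Iₘ (line b j c′) y)) ⟩
      sum (λ j → sum (λ y → Iₘ (line a j c) y ℤ.* ((W i j ℤ.* W i′ j) ℤ.* Iₘ (line b j c′) y)))
        ≡⟨ sum-cong-≋ (λ j → ≡.trans (sum-Iₘ (line a j c) (λ y → (W i j ℤ.* W i′ j) ℤ.* Iₘ (line b j c′) y))
             (≡.cong ((W i j ℤ.* W i′ j) ℤ.*_) (Iₘ-sym (line b j c′) (line a j c)))) ⟩
      sum (gramEntry a b (i , c) (i′ , c′)) ∎
      where
      open ≡.≡-Reasoning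
      open ℤ.+-*-Solver

    lineMatrix-ternary : ∀ a r s → Ternary (lineMatrix a r s)
    lineMatrix-ternary a r s = let i , c = remQuot {m} q r ; j , y = remQuot {m} q s in
      Ternary-* (entries i j) (Iₘ-ternary (line a j c) y)

    -- Lines of the same slope meet everywhere or nowhere, so the incidence factor is `Iₘ c c′` for
    -- every j and the Gram product is W Wᵀ ⊗ I.
    lineMatrix-weighing : ∀ a → IsWeighingMatrix k (lineMatrix a)
    lineMatrix-weighing a = record { entries = lineMatrix-ternary a ; orthogonal = λ r r′ →
      let i , c = remQuot {m} q r ; i′ , c′ = remQuot {m} q r′ in begin
        (lineMatrix a *ₘ transpose (lineMatrix a)) r r′      ≡⟨ lineMatrix-gram a a r r′ ⟩
        sum (gramEntry a a (i , c) (i′ , c′))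
          ≡⟨ sum-cong-≋ (λ j → ≡.cong ((W i j ℤ.* W i′ j) ℤ.*_) (line-Iₘ j c c′)) ⟩
        sum (λ j → (W i j ℤ.* W i′ j) ℤ.* Iₘ c c′)
          ≡⟨ *-distribʳ-sum (Iₘ c c′) (λ j → W i j ℤ.* W i′ j) ⟨
        sum (λ j → W i j ℤ.* W i′ j) ℤ.* Iₘ c c′
          ≡⟨ ≡.cong (ℤ._* Iₘ c c′) (orthogonal i i′) ⟩
        (ℤ.+ k ℤ.* Iₘ i i′) ℤ.* Iₘ c c′
          ≡⟨ ℤ.*-assoc (ℤ.+ k) (Iₘ i i′) (Iₘ c c′) ⟩
        ℤ.+ k ℤ.* (Iₘ i i′ ℤ.* Iₘ c c′)
          ≡⟨ ≡.cong (ℤ.+ k ℤ.*_) (Iₘ-remQuot m q r r′) ⟨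
        ℤ.+ k ℤ.* Iₘ r r′                                    ∎ }
      where
      open ≡.≡-Reasoning
      line-Iₘ : ∀ j c c′ → Iₘ (line a j c) (line a j c′) ≡ Iₘ c c′
      line-Iₘ j c c′ with c Fin.≟ c′
      ... | yes ≡.refl = Iₘ-diagonal (line a j c)
      ... | no c≢c′    = Iₘ-off (c≢c′ ∘ line-injective a j)

    -- Lines with different slopes meet in at most one point.
    lineMatrix-cross-weighing : ∀ {a b} → a ≢ b →
      IsWeighingMatrix (k ℕ.^ 2) (lineMatrix a *ₘ transpose (lineMatrix b))
    lineMatrix-cross-weighing {a} {b} a≢b = record
      { entries = λ r r′ → ≡.subst Ternary (≡.sym (lineMatrix-gram a b r r′))
          (ternary (remQuot {m} q r) (remQuot {m} q r′))
      ; orthogonal = λ r r′ → begin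
          ((X *ₘ transpose Y) *ₘ transpose (X *ₘ transpose Y)) r r′
            -- The product is X (Yᵀ Y) Xᵀ, whose middle factor is scalar because the columns of Y
            -- are orthogonal too.
            ≡⟨ *ₘ-orthogonal X X (transpose Y) {ℤ.+ k} YᵀY r r′ ⟩
          ℤ.+ k ℤ.* (X *ₘ transpose X) r r′
            ≡⟨ ≡.cong (ℤ.+ k ℤ.*_) (IsWeighingMatrix.orthogonal (lineMatrix-weighing a) r r′) ⟩
          ℤ.+ k ℤ.* (ℤ.+ k ℤ.* Iₘ r r′)
            ≡⟨ ℤ.*-assoc (ℤ.+ k) (ℤ.+ k) (Iₘ r r′) ⟨
          (ℤ.+ k ℤ.* ℤ.+ k) ℤ.* Iₘ r r′
            ≡⟨ ≡.cong (ℤ._* Iₘ r r′) (ℤ.pos-* k k) ⟨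
          ℤ.+ (k ℕ.* k) ℤ.* Iₘ r r′
            ≡⟨ ≡.cong (λ l → ℤ.+ (k ℕ.* l) ℤ.* Iₘ r r′) (ℕ.*-identityʳ k) ⟨
          ℤ.+ (k ℕ.^ 2) ℤ.* Iₘ r r′                                  ∎
      }
      where
      open ≡.≡-Reasoning
      X = lineMatrix a
      Y = lineMatrix b
      YᵀY : transpose Y *ₘ transpose (transpose Y) ≈ₘ ℤ.+ k •ₘ Iₘ
      YᵀY = transpose-orthogonal Y (ℤ.+ k) (IsWeighingMatrix.orthogonal (lineMatrix-weighing b))
      ternary : ∀ p p′ → Ternary (sum (gramEntry a b p p′))
      ternary p@(i , c) p′@(i′ , c′) with sum-atMostOne (gramEntry a b p p′)
        (λ j → line a j c Fin.≟ line b j c′)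
        (λ j lines-differ → ≡.trans (≡.cong ((W i j ℤ.* W i′ j) ℤ.*_) (Iₘ-off lines-differ))
            (ℤ.*-zeroʳ (W i j ℤ.* W i′ j)))
        (λ j j′ → line-meet a≢b c c′)
      ... | inj₁ sum≡0       = inj₁ sum≡0
      ... | inj₂ (j , sum≡f) = ≡.subst Ternary (≡.sym sum≡f)
        (Ternary-* (Ternary-* (entries i j) (entries i′ j)) (Iₘ-ternary (line a j c) (line b j c′)))

    -- If two of the matrices agree, then the nonzero entries of W in any
    -- two rows lie in one and the same column.
    lineMatrix-distinct : 1 ℕ.≤ k → Fin q → ∀ {a b} → a ≢ b → ¬ (lineMatrix a ≈ₘ lineMatrix b)
    -- Slopes and rows of W are both indexed by `Fin m`, so `a` and `b` double as two different
    -- rows.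
    lineMatrix-distinct 1≤k c {a} {b} a≢b X≈Y with row-nonzero 1≤k isW a | row-nonzero 1≤k isW b
    ... | j , Waj≢0 | j′ , Wbj′≢0 = [ Waj≢0 , Wbj≢0 ]′ (ℤ.i*j≡0⇒i≡0∨j≡0 (W a j) (begin
        W a j ℤ.* W b j
          ≡⟨ sum-single j (λ l l≢j → ≡.cong (ℤ._* W b l) (elsewhere l l≢j)) ⟨
        sum (λ l → W a l ℤ.* W b l)         ≡⟨ orthogonal a b ⟩
        ℤ.+ k ℤ.* Iₘ a b                    ≡⟨ ≡.cong (ℤ.+ k ℤ.*_) (Iₘ-off a≢b) ⟩
        ℤ.+ k ℤ.* ℤ.0ℤ                      ≡⟨ ℤ.*-zeroʳ (ℤ.+ k) ⟩
        ℤ.0ℤ                                ∎))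
      where
      open ≡.≡-Reasoning
      lineMatrix-combine : ∀ a i j y → lineMatrix a (combine i c) (combine j y) ≡ W i j ℤ.* Iₘ (line a j c) y
      lineMatrix-combine a i j y = ≡.cong₂ (λ (i , c) (j , y) → W i j ℤ.* Iₘ (line a j c) y)
        (Fin.remQuot-combine {m} {q} i c) (Fin.remQuot-combine {m} {q} j y)
      agree : ∀ {i j} → W i j ≢ ℤ.0ℤ → line a j c ≡ line b j c
      agree {i} {j} W≢0 = decidable-stable (line a j c Fin.≟ line b j c) λ lines-differ → W≢0 (begin
        W i j                                               ≡⟨ ℤ.*-identityʳ (W i j) ⟨
        W i j ℤ.* ℤ.1ℤ
          ≡⟨ ≡.cong (W i j ℤ.*_) (Iₘ-diagonal (line a j c)) ⟨
        W i j ℤ.* Iₘ (line a j c) (line a j c)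
          ≡⟨ lineMatrix-combine a i j (line a j c) ⟨
        lineMatrix a (combine i c) (combine j (line a j c))
          ≡⟨ X≈Y (combine i c) (combine j (line a j c)) ⟩
        lineMatrix b (combine i c) (combine j (line a j c))
          ≡⟨ lineMatrix-combine b i j (line a j c) ⟩
        W i j ℤ.* Iₘ (line b j c) (line a j c)
          ≡⟨ ≡.cong (W i j ℤ.*_) (Iₘ-off (lines-differ ∘ ≡.sym)) ⟩
        W i j ℤ.* ℤ.0ℤ                                      ≡⟨ ℤ.*-zeroʳ (W i j) ⟩
        ℤ.0ℤ                                                ∎)
      elsewhere : ∀ l → l ≢ j → W a l ≡ ℤ.0ℤ
      elsewhere l l≢j = decidable-stable (W a l ℤ.≟ ℤ.0ℤ) λ Wal≢0 → l≢j
          (line-meet a≢b c c (agree Wal≢0) (agree Waj≢0))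
      Wbj≢0 : W b j ≢ ℤ.0ℤ
      Wbj≢0 = ≡.subst (λ l → W b l ≢ ℤ.0ℤ) (line-meet a≢b c c (agree Wbj′≢0) (agree Waj≢0)) Wbj′≢0

open IntegerMatrices

-- Ring homomorphisms

IsHom : (R : CommutativeRing a ℓ₁) (S : CommutativeRing b ℓ₂) →
        (CommutativeRing.Carrier R → CommutativeRing.Carrier S) → Set (a ⊔ ℓ₁ ⊔ ℓ₂)
IsHom R S = RingMorphisms.IsRingHomomorphism (CommutativeRing.rawRing R) (CommutativeRing.rawRing S)

module _ (R : CommutativeRing a ℓ₁) (S : CommutativeRing b ℓ₂) where
  private
    module R = CommutativeRing R
    module S = CommutativeRing S
  open SetoidReasoning S.setoid
  open RingProperties S.ring using (+-inverseʳ-unique; +-identityˡ-unique)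

  isHom : {f : R.Carrier → S.Carrier} → (∀ {x y} → x R.≈ y → f x S.≈ f y) →
          (∀ x y → f (x R.+ y) S.≈ f x S.+ f y) → (∀ x y → f (x R.* y) S.≈ f x S.* f y) →
          f R.1# S.≈ S.1# → IsHom R S f
  isHom {f} f-cong f-+ f-* f-1 = record
    { isSemiringHomomorphism = record
      { isNearSemiringHomomorphism = record
        { +-isMonoidHomomorphism = record
          { isMagmaHomomorphism = record { isRelHomomorphism = record { cong = f-cong } ; homo = f-+ }
          ; ε-homo = f-0
          }
        ; *-homo = f-*
        }
      ; 1#-homo = f-1
      }
    ; -‿homo = λ x → +-inverseʳ-unique (f x) (f (R.- x))
        (S.trans (S.sym (f-+ x (R.- x))) (S.trans (f-cong (R.-‿inverseʳ x)) f-0))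
    }
    where
    f-0 : f R.0# S.≈ S.0#
    f-0 = +-identityˡ-unique (f R.0#) (f R.0#) (S.trans (S.sym (f-+ R.0# R.0#)) (f-cong (R.+-identityˡ R.0#)))

module Hom {R : CommutativeRing a ℓ₁} {S : CommutativeRing b ℓ₂} {f} (hom : IsHom R S f) where
  private
    module R where
      open CommutativeRing R public hiding (zero)
      open FiniteSums R public
      open Mat R public hiding (Iₘ)
      open SemiringMult semiring public using () renaming (_×_ to _·_)
    module S where
      open CommutativeRing S public hiding (zero)
      open FiniteSums S public
      open Mat S public hiding (Iₘ)
      open SemiringMult semiring public using () renaming (_×_ to _·_)
  open RingMorphisms.IsRingHomomorphism hom public using (⟦⟧-cong; +-homo; *-homo; 0#-homo; 1#-homo; -‿homo)

  sum-homo : ∀ {n} (g : Vector R.Carrier n) → f (R.sum g) S.≈ S.sum (λ i → f (g i))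
  sum-homo {zero}  g = 0#-homo
  sum-homo {suc n} g = S.trans (+-homo _ _) (S.+-congˡ (sum-homo (g ∘ suc)))

  ·-homo : ∀ n x → f (n R.· x) S.≈ n S.· f x
  ·-homo zero    x = 0#-homo
  ·-homo (suc n) x = S.trans (+-homo _ _) (S.+-congˡ (·-homo n x))

  fromℕ-homo : ∀ n → f (R.fromℕ n) S.≈ S.fromℕ n
  fromℕ-homo n = S.trans (·-homo n R.1#) (SemiringMult.×-congʳ S.semiring n 1#-homo)

  Iₘ-homo : ∀ {n} (i j : Fin n) → f (R.Iₘ i j) S.≈ S.Iₘ i j
  Iₘ-homo i j with i Fin.≟ j
  ... | yes _ = 1#-homo
  ... | no _  = 0#-homo

  *ₘ-homo : ∀ {n} (X Y : Matrix R.Carrier n) → (λ i j → f ((X R.*ₘ Y) i j)) S.≈ₘ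
      (λ i j → f (X i j)) S.*ₘ (λ i j → f (Y i j))
  *ₘ-homo X Y i j = S.trans (sum-homo (λ l → X i l R.* Y l j)) (S.sum-cong-≋ λ l → *-homo (X i l) (Y l j))

module FromInteger (R : CommutativeRing c ℓ) where
  open CommutativeRing R hiding (zero)
  open Mat R using (fromℕ)
  open RingProperties ring using (-0#≈0#; -‿+-comm; -‿distribˡ-*; -‿involutive)
  open CommutativeSemigroupProperties +-commutativeSemigroup using (interchange)
  open SemiringMult semiring using (×-homo-+)
  open SetoidReasoning setoid

  fromℤ : ℤ → Carrier
  fromℤ (ℤ.+ n)      = fromℕ n
  fromℤ ℤ.-[1+ n ]   = - fromℕ (suc n)

  fromℤ-⊖ : ∀ m n → fromℤ (m ℤ.⊖ n) ≈ fromℕ m - fromℕ n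
  fromℤ-⊖ zero    zero    = sym (-‿inverseʳ 0#)
  fromℤ-⊖ zero    (suc n) = sym (+-identityˡ _)
  fromℤ-⊖ (suc m) zero    = sym (trans (+-congˡ -0#≈0#) (+-identityʳ _))
  fromℤ-⊖ (suc m) (suc n) = begin
    fromℤ (suc m ℤ.⊖ suc n)                    ≡⟨ ≡.cong fromℤ (ℤ.[1+m]⊖[1+n]≡m⊖n m n) ⟩
    fromℤ (m ℤ.⊖ n)                            ≈⟨ fromℤ-⊖ m n ⟩
    fromℕ m - fromℕ n                          ≈⟨ +-identityˡ _ ⟨
    0# + (fromℕ m - fromℕ n)                   ≈⟨ +-congʳ (-‿inverseʳ 1#) ⟨
    (1# - 1#) + (fromℕ m - fromℕ n)            ≈⟨ interchange _ _ _ _ ⟩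
    (1# + fromℕ m) + (- 1# - fromℕ n)          ≈⟨ +-congˡ (-‿+-comm 1# (fromℕ n)) ⟩
    fromℕ (suc m) - fromℕ (suc n)              ∎

  fromℤ-neg : ∀ z → fromℤ (ℤ.- z) ≈ - fromℤ z
  fromℤ-neg ℤ.+0       = sym -0#≈0#
  fromℤ-neg ℤ.+[1+ n ] = refl
  fromℤ-neg ℤ.-[1+ n ] = sym (-‿involutive _)

  fromℤ-+ : ∀ y z → fromℤ (y ℤ.+ z) ≈ fromℤ y + fromℤ z
  fromℤ-+ (ℤ.+ m)    (ℤ.+ n)    = ×-homo-+ 1# m n
  fromℤ-+ (ℤ.+ m)    ℤ.-[1+ n ] = fromℤ-⊖ m (suc n)
  fromℤ-+ ℤ.-[1+ m ] (ℤ.+ n)    = trans (fromℤ-⊖ n (suc m)) (+-comm _ _)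
  fromℤ-+ ℤ.-[1+ m ] ℤ.-[1+ n ] = begin
    - fromℕ (suc (suc (m ℕ.+ n)))      ≡⟨ ≡.cong (λ k → - fromℕ (suc k)) (ℕ.+-suc m n) ⟨
    - fromℕ (suc m ℕ.+ suc n)          ≈⟨ -‿cong (×-homo-+ 1# (suc m) (suc n)) ⟩
    - (fromℕ (suc m) + fromℕ (suc n))  ≈⟨ -‿+-comm _ _ ⟨
    - fromℕ (suc m) - fromℕ (suc n)    ∎

  fromℤ-*⁺ : ∀ m z → fromℤ (ℤ.+ m ℤ.* z) ≈ fromℕ m * fromℤ z
  fromℤ-*⁺ zero    z = sym (zeroˡ _)
  fromℤ-*⁺ (suc m) z = begin
    fromℤ (ℤ.+ suc m ℤ.* z)                  ≡⟨ ≡.cong fromℤ (ℤ.suc-* (ℤ.+ m) z) ⟩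
    fromℤ (z ℤ.+ ℤ.+ m ℤ.* z)                ≈⟨ fromℤ-+ z (ℤ.+ m ℤ.* z) ⟩
    fromℤ z + fromℤ (ℤ.+ m ℤ.* z)            ≈⟨ +-cong (sym (*-identityˡ _)) (fromℤ-*⁺ m z) ⟩
    1# * fromℤ z + fromℕ m * fromℤ z         ≈⟨ distribʳ _ _ _ ⟨
    fromℕ (suc m) * fromℤ z                  ∎

  fromℤ-* : ∀ y z → fromℤ (y ℤ.* z) ≈ fromℤ y * fromℤ z
  fromℤ-* (ℤ.+ m)    z = fromℤ-*⁺ m z
  fromℤ-* ℤ.-[1+ m ] z = begin
    fromℤ (ℤ.-[1+ m ] ℤ.* z)                 ≡⟨ ≡.cong fromℤ (ℤ.neg-distribˡ-* (ℤ.+ suc m) z) ⟨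
    fromℤ (ℤ.- (ℤ.+ suc m ℤ.* z))            ≈⟨ fromℤ-neg (ℤ.+ suc m ℤ.* z) ⟩
    - fromℤ (ℤ.+ suc m ℤ.* z)                ≈⟨ -‿cong (fromℤ-*⁺ (suc m) z) ⟩
    - (fromℕ (suc m) * fromℤ z)              ≈⟨ -‿distribˡ-* _ _ ⟩
    - fromℕ (suc m) * fromℤ z                ∎

  fromℤ-hom : IsHom ℤ.+-*-commutativeRing R fromℤ
  fromℤ-hom = isHom ℤ.+-*-commutativeRing R (λ eq → reflexive (≡.cong fromℤ eq)) fromℤ-+ fromℤ-*
      (+-identityʳ 1#)

module _ {R : CommutativeRing a ℓ₁} {S : CommutativeRing b ℓ₂} {f} (hom : IsHom R S f) where
  open CommutativeRing S
  open Hom {R = R} {S} hom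

  fromℤ-homo : ∀ z → f (FromInteger.fromℤ R z) ≈ FromInteger.fromℤ S z
  fromℤ-homo (ℤ.+ n)    = fromℕ-homo n
  fromℤ-homo ℤ.-[1+ n ] = trans (-‿homo _) (-‿cong (fromℕ-homo (suc n)))

module Substitution {R : CommutativeRing a ℓ₁} {S : CommutativeRing b ℓ₂} {f} (hom : IsHom R S f)
  {u : ℕ} (v : Fin u → CommutativeRing.Carrier S) where
  private
    module R = CommutativeRing R
    module S = CommutativeRing S
  open Hom {R = R} {S} hom

  substitute : Poly R.Carrier u → S.Carrier
  substitute (con x)  = f x
  substitute (var i)  = v i
  substitute (p +ᴾ q) = substitute p S.+ substitute q
  substitute (p *ᴾ q) = substitute p S.* substitute q
  substitute (-ᴾ p)   = S.- substitute p

  -- The universal property of the free algebra: each generating equation of `≈ᴾ` becomes a law of S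
  -- or a property of f. Both evaluation and change of coefficients rest on it.
  substitute-cong : ∀ {p q} → CommutativeRing._≈_ (polynomialRing R u) p q → substitute p S.≈ substitute q
  substitute-cong ≈ᴾ-refl            = S.refl
  substitute-cong (≈ᴾ-sym eq)        = S.sym (substitute-cong eq)
  substitute-cong (≈ᴾ-trans eq eq′)  = S.trans (substitute-cong eq) (substitute-cong eq′)
  substitute-cong (+ᴾ-cong eq eq′)   = S.+-cong (substitute-cong eq) (substitute-cong eq′)
  substitute-cong (*ᴾ-cong eq eq′)   = S.*-cong (substitute-cong eq) (substitute-cong eq′)
  substitute-cong (-ᴾ-cong eq)       = S.-‿cong (substitute-cong eq)
  substitute-cong (+ᴾ-assoc p q r)   = S.+-assoc _ _ _
  substitute-cong (+ᴾ-comm p q)      = S.+-comm _ _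
  substitute-cong (+ᴾ-identityˡ p)   = S.trans (S.+-congʳ 0#-homo) (S.+-identityˡ _)
  substitute-cong (-ᴾ-inverseˡ p)    = S.trans (S.-‿inverseˡ _) (S.sym 0#-homo)
  substitute-cong (*ᴾ-assoc p q r)   = S.*-assoc _ _ _
  substitute-cong (*ᴾ-comm p q)      = S.*-comm _ _
  substitute-cong (*ᴾ-identityˡ p)   = S.trans (S.*-congʳ 1#-homo) (S.*-identityˡ _)
  substitute-cong (distribᴾˡ p q r)  = S.distribˡ _ _ _
  substitute-cong (con-cong eq)      = ⟦⟧-cong eq
  substitute-cong (con-+ x y)        = +-homo x y
  substitute-cong (con-* x y)        = *-homo x y

  substitute-hom : IsHom (polynomialRing R u) S substitute
  substitute-hom = isHom (polynomialRing R u) S substitute-cong (λ _ _ → S.refl) (λ _ _ → S.refl) 1#-homo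

module _ (R : CommutativeRing a ℓ₁) (u : ℕ) where

  con-hom : IsHom R (polynomialRing R u) con
  con-hom = isHom R (polynomialRing R u) con-cong con-+ con-* ≈ᴾ-refl

  id-hom : IsHom R R (λ x → x)
  id-hom = isHom R R (λ eq → eq) (λ _ _ → R.refl) (λ _ _ → R.refl) R.refl
    where module R = CommutativeRing R

module _ {R : CommutativeRing a ℓ₁} {S : CommutativeRing b ℓ₂} {f} (hom : IsHom R S f) (u : ℕ) where
  private
    R[u] = polynomialRing R u
    S[u] = polynomialRing S u
    module R[u] = CommutativeRing R[u]
    module S[u] = CommutativeRing S[u]
    module Con = Hom {R = S} {S[u]} (con-hom S u)
    module F = Hom {R = R} {S} hom

    con∘f-hom : IsHom R S[u] (λ x → con (f x))
    con∘f-hom = isHom R S[u] (λ eq → con-cong (F.⟦⟧-cong eq))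
      (λ x y → S[u].trans (con-cong (F.+-homo x y)) (con-+ _ _))
      (λ x y → S[u].trans (con-cong (F.*-homo x y)) (con-* _ _))
      (con-cong F.1#-homo)

    module Sub = Substitution {R = R} {S[u]} con∘f-hom {u} var

    -- Changing coefficients is the substitution of each variable for itself, so `mapPoly f`
    -- respects `≈ᴾ` by `substitute-cong`.
    mapPoly≡substitute : ∀ p → mapPoly f p ≡ Sub.substitute p
    mapPoly≡substitute (con x)  = ≡.refl
    mapPoly≡substitute (var i)  = ≡.refl
    mapPoly≡substitute (p +ᴾ q) = ≡.cong₂ _+ᴾ_ (mapPoly≡substitute p) (mapPoly≡substitute q)
    mapPoly≡substitute (p *ᴾ q) = ≡.cong₂ _*ᴾ_ (mapPoly≡substitute p) (mapPoly≡substitute q)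
    mapPoly≡substitute (-ᴾ p)   = ≡.cong -ᴾ_ (mapPoly≡substitute p)

  mapPoly-hom : IsHom R[u] S[u] (mapPoly f)
  mapPoly-hom = isHom R[u] S[u]
    (λ {p} {q} p≈q → ≡.subst₂ S[u]._≈_ (≡.sym (mapPoly≡substitute p)) (≡.sym (mapPoly≡substitute q))
        (Sub.substitute-cong p≈q))
    (λ _ _ → S[u].refl) (λ _ _ → S[u].refl) (con-cong F.1#-homo)

  quadraticForm-homo : ∀ (s : Vector ℕ u) → mapPoly f (quadraticForm R s) S[u].≈ quadraticForm S s
  quadraticForm-homo s = S[u].trans (M.sum-homo (λ i → s i ·ᴿ (var i *ᴾ var i)))
    (FiniteSums.sum-cong-≋ S[u] (λ i → M.·-homo (s i) (var i *ᴾ var i)))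
    where
    module M = Hom {R = R[u]} {S[u]} mapPoly-hom
    open SemiringMult R[u].semiring using () renaming (_×_ to _·ᴿ_)

module _ (R : CommutativeRing a ℓ₁) {u : ℕ} where
  open CommutativeRing (polynomialRing R u) hiding (zero)
  open FiniteSums (polynomialRing R u)
  open Mat (polynomialRing R u) using (fromℕ)
  open SemiringMult semiring using (×-assocˡ; ×-congʳ; ×-assoc-*) renaming (_×_ to _·_)
  open SetoidReasoning setoid

  quadraticForm-scale : ∀ k (s : Vector ℕ u) → quadraticForm R (λ i → k ℕ.* s i) ≈ fromℕ k * quadraticForm R s
  quadraticForm-scale k s = begin
    sum (λ i → (k ℕ.* s i) · (var i * var i))       ≈⟨ sum-cong-≋ (λ i → begin
      (k ℕ.* s i) · (var i * var i)                   ≈⟨ ×-assocˡ (var i * var i) k (s i) ⟨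
      k · (s i · (var i * var i))                     ≈⟨ ×-congʳ k (*-identityˡ _) ⟨
      k · (1# * (s i · (var i * var i)))              ≈⟨ ×-assoc-* k 1# _ ⟨
      fromℕ k * (s i · (var i * var i))               ∎) ⟩
    sum (λ i → fromℕ k * (s i · (var i * var i)))
      ≈⟨ *-distribˡ-sum (fromℕ k) (λ i → s i · (var i * var i)) ⟨
    fromℕ k * quadraticForm R s                     ∎

-- Real and complex matrices

module Real = CommutativeRing ℝ-commutativeRing
module Complex = CommutativeRing ℂ-commutativeRing
open FromInteger ℝ-commutativeRing using () renaming (fromℤ to fromℤᴿ; fromℤ-hom to fromℤᴿ-hom)
module Fromℤᴿ = Hom {R = ℤ.+-*-commutativeRing} {ℝ-commutativeRing} fromℤᴿ-hom

opaque
  unfolding constᴿ _+ᴿ_ _*ᴿ_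

  constᴿ-hom : IsHom ℚ.+-*-commutativeRing ℝ-commutativeRing constᴿ
  constᴿ-hom = isHom ℚ.+-*-commutativeRing ℝ-commutativeRing
    (λ {p} {q} p≡q → Real.reflexive (≡.cong constᴿ p≡q))
    (λ p q → pointwise {constᴿ (p ℚ.+ q)} {constᴿ p +ᴿ constᴿ q} λ _ → ≡.refl)
    (λ p q → pointwise {constᴿ (p ℚ.* q)} {constᴿ p *ᴿ constᴿ q} λ _ → ≡.refl)
    Real.refl

  constᴿ-nonNegative : ∀ {p} → 0ℚ ℚ.≤ p → NonNegativeᴿ (constᴿ p)
  constᴿ-nonNegative 0≤p = mkNonNegativeᴿ λ ε 0<ε → 0 , λ _ _ → ℚ.<-≤-trans (ℚ.neg-antimono-< 0<ε) 0≤p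

  -- Closeness fails for ε = 1, since the constant difference is 1 itself.
  1≉0ᴿ : ¬ (constᴿ 1ℚ ≈ᴿ constᴿ 0ℚ)
  1≉0ᴿ 1≈0 = let N , h = close 1≈0 1ℚ (ℚ.positive⁻¹ 1ℚ) in ℚ.<-irrefl ≡.refl (h N ℕ.≤-refl)

fromℕ-positive : ∀ {n} → 1 ℕ.≤ n → 0ℚ ℚ.< Mat.fromℕ ℚ.+-*-commutativeRing n
fromℕ-positive {suc zero}    _ = ℚ.positive⁻¹ 1ℚ
fromℕ-positive {suc (suc n)} _ = ℚ.+-mono-< (ℚ.positive⁻¹ 1ℚ) (fromℕ-positive {suc n} (s≤s z≤n))

-- The root of n ^ 2 is the rational n, so its inverse is the constant sequence 1 / n. It is applied
-- to α = k ^ 2 and to a = (Σ sᵢ) ^ 2.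
inverseSqrt : ∀ {n} → 1 ℕ.≤ n → ∃ λ t → IsInverseSqrt t (ℝM.fromℕ (n ℕ.^ 2)) × t *ᴿ ℝM.fromℕ n ≈ᴿ constᴿ 1ℚ
inverseSqrt {n} 1≤n = constᴿ (ℚ.1/ p) , (constᴿ p ,
    (constᴿ-nonNegative (ℚ.<⇒≤ 0<p) , square) , inverseᵖ) , Real.trans
    (Real.*-congˡ (Real.sym (Const.fromℕ-homo n))) inverseᵖ
  where
  module Const = Hom {R = ℚ.+-*-commutativeRing} {ℝ-commutativeRing} constᴿ-hom
  open SetoidReasoning ℝ-setoid
  p : ℚ
  p = Mat.fromℕ ℚ.+-*-commutativeRing n
  0<p : 0ℚ ℚ.< p
  0<p = fromℕ-positive 1≤n
  instance
    p≢0 : ℚ.NonZero p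
    p≢0 = ℚ.pos⇒nonZero p {{ℚ.positive 0<p}}
  square : constᴿ p *ᴿ constᴿ p ≈ᴿ ℝM.fromℕ (n ℕ.^ 2)
  square = begin
    constᴿ p *ᴿ constᴿ p         ≈⟨ Real.*-cong (Const.fromℕ-homo n) (Const.fromℕ-homo n) ⟩
    ℝM.fromℕ n *ᴿ ℝM.fromℕ n     ≈⟨ SemiringMult.×1-homo-* Real.semiring n n ⟨
    ℝM.fromℕ (n ℕ.* n)           ≡⟨ ≡.cong (λ m → ℝM.fromℕ (n ℕ.* m)) (ℕ.*-identityʳ n) ⟨
    ℝM.fromℕ (n ℕ.^ 2)           ∎
  inverseᵖ : constᴿ (ℚ.1/ p) *ᴿ constᴿ p ≈ᴿ constᴿ 1ℚ
  inverseᵖ = begin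
    constᴿ (ℚ.1/ p) *ᴿ constᴿ p      ≈⟨ Const.*-homo (ℚ.1/ p) p ⟨
    constᴿ (ℚ.1/ p ℚ.* p)            ≡⟨ ≡.cong constᴿ (ℚ.*-inverseˡ p) ⟩
    constᴿ 1ℚ                        ∎

fromℕᴿ-nonzero : ∀ {n} → 1 ℕ.≤ n → ¬ (ℝM.fromℕ n ≈ᴿ constᴿ 0ℚ)
fromℕᴿ-nonzero 1≤n n≈0 = let t , _ , tn≈1 = inverseSqrt 1≤n in
  1≉0ᴿ (Real.trans (Real.sym tn≈1) (Real.trans (Real.*-congˡ n≈0) (Real.zeroʳ t)))

fromℤᴿ-zero : ∀ z → fromℤᴿ z ≈ᴿ constᴿ 0ℚ → z ≡ ℤ.0ℤ
fromℤᴿ-zero ℤ.+0       _   = ≡.refl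
fromℤᴿ-zero ℤ.+[1+ n ] eq = contradiction eq (fromℕᴿ-nonzero {suc n} (s≤s z≤n))
fromℤᴿ-zero ℤ.-[1+ n ] eq = contradiction
  (Real.trans (Real.sym (-‿involutive _)) (Real.trans (Real.-‿cong eq) -0#≈0#))
      (fromℕᴿ-nonzero {suc n} (s≤s z≤n))
  where open RingProperties Real.ring using (-‿involutive; -0#≈0#)

fromℤᴿ-injective : ∀ {y z} → fromℤᴿ y ≈ᴿ fromℤᴿ z → y ≡ z
fromℤᴿ-injective {y} {z} eq = ℤ.i-j≡0⇒i≡j y z (fromℤᴿ-zero (y ℤ.- z) (begin
  fromℤᴿ (y ℤ.- z)               ≈⟨ Fromℤᴿ.+-homo y (ℤ.- z) ⟩
  fromℤᴿ y +ᴿ fromℤᴿ (ℤ.- z)     ≈⟨ Real.+-cong eq (Fromℤᴿ.-‿homo z) ⟩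
  fromℤᴿ z +ᴿ -ᴿ fromℤᴿ z        ≈⟨ Real.-‿inverseʳ _ ⟩
  constᴿ 0ℚ                      ∎))
  where open SetoidReasoning ℝ-setoid

fromReal-hom : IsHom ℝ-commutativeRing ℂ-commutativeRing fromReal
fromReal-hom = isHom ℝ-commutativeRing ℂ-commutativeRing
  (λ x≈y → x≈y ,ᴳ Real.refl)
  (λ x y → Real.refl ,ᴳ Real.sym (Real.+-identityʳ _))
  (λ x y → Real.sym (Real.trans (Real.+-congˡ (Real.trans (Real.-‿cong (Real.zeroˡ _)) -0#≈0#))
      (Real.+-identityʳ _))
        ,ᴳ Real.sym (Real.trans (Real.+-cong (Real.zeroʳ x) (Real.zeroˡ y)) (Real.+-identityʳ _)))
  Complex.refl
  where open RingProperties Real.ring using (-0#≈0#)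

module FromReal = Hom {R = ℝ-commutativeRing} {ℂ-commutativeRing} fromReal-hom

conjugate-cong : ∀ {z w} → z Complex.≈ w → conjugate z Complex.≈ conjugate w
conjugate-cong (re≈ ,ᴳ im≈) = re≈ ,ᴳ Real.-‿cong im≈

conjugate-fromReal : ∀ x → conjugate (fromReal x) Complex.≈ fromReal x
conjugate-fromReal x = Real.refl ,ᴳ RingProperties.-0#≈0# Real.ring

unit-±1 : ∀ {x z} → z ≡ ℤ.1ℤ ⊎ z ≡ ℤ.-1ℤ → x ≈ᴿ fromℤᴿ z → OnUnitCircle (fromReal x)
unit-±1 {x} {z} z≡±1 x≈z = constᴿ-nonNegative (ℚ.<⇒≤ (ℚ.positive⁻¹ 1ℚ)) , (begin
  constᴿ 1ℚ *ᴿ constᴿ 1ℚ                     ≈⟨ Real.*-identityˡ _ ⟩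
  constᴿ 1ℚ                                  ≈⟨ Fromℤᴿ.1#-homo ⟨
  fromℤᴿ ℤ.1ℤ                                ≡⟨ ≡.cong fromℤᴿ (square z≡±1) ⟨
  fromℤᴿ (z ℤ.* z)                           ≈⟨ Fromℤᴿ.*-homo z z ⟩
  fromℤᴿ z *ᴿ fromℤᴿ z                       ≈⟨ Real.*-cong x≈z x≈z ⟨
  x *ᴿ x                                     ≈⟨ Real.+-identityʳ _ ⟨
  x *ᴿ x +ᴿ constᴿ 0ℚ                        ≈⟨ Real.+-congˡ (Real.zeroˡ _) ⟨
  x *ᴿ x +ᴿ constᴿ 0ℚ *ᴿ constᴿ 0ℚ           ∎)
  where
  open SetoidReasoning ℝ-setoid
  square : z ≡ ℤ.1ℤ ⊎ z ≡ ℤ.-1ℤ → z ℤ.* z ≡ ℤ.1ℤ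
  square (inj₁ ≡.refl) = ≡.refl
  square (inj₂ ≡.refl) = ≡.refl

ternary-zero-or-unit : ∀ {x z} → Ternary z → x ≈ᴿ fromℤᴿ z
    → fromReal x Complex.≈ Complex.0# ⊎ OnUnitCircle (fromReal x)
ternary-zero-or-unit (inj₁ ≡.refl) x≈0 = inj₁ (FromReal.⟦⟧-cong x≈0)
ternary-zero-or-unit (inj₂ z≡±1)   x≈z = inj₂ (unit-±1 z≡±1 x≈z)

fromRealₘ : ∀ {n} → Matrix ℝ n → Matrix ℂ n
fromRealₘ X i j = fromReal (X i j)

IsTernaryᴿ : ∀ {n} → Matrix ℝ n → Set
IsTernaryᴿ X = ∀ i j → ∃ λ z → Ternary z × X i j ≈ᴿ fromℤᴿ z

fromRealₘ-ᴴ : ∀ {n} (X Y : Matrix ℝ n) → fromRealₘ X ℂM.*ₘ (fromRealₘ Y ᴴ) ℂM.≈ₘ fromRealₘ (X ℝM.*ₘ transpose Y)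
fromRealₘ-ᴴ X Y i j = Complex.trans
  (*ₘ-cong {X = fromRealₘ X} (λ _ _ → Complex.refl) (λ k l → conjugate-fromReal (Y l k)) i j)
  (Complex.sym (FromReal.*ₘ-homo X (transpose Y) i j))
  where open MatrixProperties ℂ-commutativeRing

fromRealₘ-weighing : ∀ {n k} (X : Matrix ℝ n) → IsTernaryᴿ X →
                     X ℝM.*ₘ transpose X ℝM.≈ₘ ℝM.fromℕ k ℝM.•ₘ ℝM.Iₘ → IsUnitWeighingMatrix k (fromRealₘ X)
fromRealₘ-weighing {k = k} X ternary XXᵀ = record
  { entries = λ i j → let z , z-ternary , X≈z = ternary i j in ternary-zero-or-unit z-ternary X≈z
  ; orthogonal = λ i j → Complex.trans (fromRealₘ-ᴴ X X i j) (Complex.trans (FromReal.⟦⟧-cong (XXᵀ i j))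
      (Complex.trans (FromReal.*-homo _ _) (Complex.*-cong (FromReal.fromℕ-homo k) (FromReal.Iₘ-homo i j))))
  }

IsUnitWeighingMatrix-cong : ∀ {n k} {W W′ : Matrix ℂ n} → W ℂM.≈ₘ W′ → IsUnitWeighingMatrix k W
    → IsUnitWeighingMatrix k W′
IsUnitWeighingMatrix-cong {W = W} {W′} W≈W′ isW = record
  { entries = λ i j → [ (λ W≈0 → inj₁ (Complex.trans (Complex.sym (W≈W′ i j)) W≈0)) ,
      (λ unit → inj₂ (onUnitCircle-cong (W≈W′ i j) unit)) ]′ (entries i j)
  ; orthogonal = λ i j → Complex.trans (*ₘ-cong (λ k l → Complex.sym (W≈W′ k l))
      (λ k l → conjugate-cong (Complex.sym (W≈W′ l k))) i j) (orthogonal i j)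
  }
  where
  open IsUnitWeighingMatrix isW
  open MatrixProperties ℂ-commutativeRing using (*ₘ-cong)
  onUnitCircle-cong : ∀ {z w} → z Complex.≈ w → OnUnitCircle z → OnUnitCircle w
  onUnitCircle-cong (re≈ ,ᴳ im≈) (nonNegative , modulus) =
    nonNegative , Real.trans modulus (Real.+-cong (Real.*-cong re≈ re≈) (Real.*-cong im≈ im≈))

-- Orthogonal designs from lines

module Monomials (u : ℕ) where
  open CommutativeRing ℝ[ u ] hiding (zero)
  open FiniteSums ℝ[ u ] using (Iₘ)
  open FromInteger ℝ[ u ] using (fromℤ; fromℤ-hom)
  open Hom {R = ℤ.+-*-commutativeRing} {ℝ[ u ]} fromℤ-hom
  open RingProperties ring using (-1*x≈-x; -‿involutive; -0#≈0#)

  Monomial : Poly ℝ u → Set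
  Monomial p = p ≈ 0# ⊎ (∃ λ l → p ≈ var l ⊎ p ≈ -ᴾ var l)

  Monomial-cong : ∀ {p p′} → p ≈ p′ → Monomial p → Monomial p′
  Monomial-cong eq (inj₁ p≈)            = inj₁ (trans (sym eq) p≈)
  Monomial-cong eq (inj₂ (l , inj₁ p≈)) = inj₂ (l , inj₁ (trans (sym eq) p≈))
  Monomial-cong eq (inj₂ (l , inj₂ p≈)) = inj₂ (l , inj₂ (trans (sym eq) p≈))

  Monomial-neg : ∀ {p} → Monomial p → Monomial (- p)
  Monomial-neg (inj₁ p≈)            = inj₁ (trans (-‿cong p≈) -0#≈0#)
  Monomial-neg (inj₂ (l , inj₁ p≈)) = inj₂ (l , inj₂ (-‿cong p≈))
  Monomial-neg (inj₂ (l , inj₂ p≈)) = inj₂ (l , inj₁ (trans (-‿cong p≈) (-‿involutive _)))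

  Monomial-*ˡ : ∀ {z p} → Ternary z → Monomial p → Monomial (fromℤ z * p)
  Monomial-*ˡ (inj₁ ≡.refl)         mono = inj₁ (zeroˡ _)
  Monomial-*ˡ {p = p} (inj₂ (inj₁ ≡.refl)) mono =
    Monomial-cong (trans (sym (*-identityˡ p)) (*-congʳ (sym 1#-homo))) mono
  Monomial-*ˡ {p = p} (inj₂ (inj₂ ≡.refl)) mono =
    Monomial-cong (trans (sym (-1*x≈-x p)) (*-congʳ (sym (trans (-‿homo ℤ.1ℤ) (-‿cong 1#-homo)))))
        (Monomial-neg mono)

  Monomial-Iₘˡ : ∀ {n} (i j : Fin n) {p} → Monomial p → Monomial (Iₘ i j * p)
  Monomial-Iₘˡ i j mono = Monomial-cong (*-congʳ (Iₘ-homo i j)) (Monomial-*ˡ (Iₘ-ternary i j) mono)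

  Monomial-Iₘʳ : ∀ {n} (i j : Fin n) {p} → Monomial p → Monomial (p * Iₘ i j)
  Monomial-Iₘʳ i j mono = Monomial-cong (*-comm _ _) (Monomial-Iₘˡ i j mono)

module LineDesigns {m q k u : ℕ} {s : Vector ℕ u} (L : Lines m q)
  {W : Matrix ℤ m} (isW : IsWeighingMatrix k W) {D : Matrix (Poly ℝ u) m} (isD : IsOrthogonalDesign s D) where

  open CommutativeRing ℝ[ u ] hiding (zero)
  open FiniteSums ℝ[ u ]
  open MatrixProperties ℝ[ u ]
  open ℝ[X]M u using (_*ₘ_)
  open FromInteger ℝ[ u ] using (fromℤ; fromℤ-hom)
  open Hom {R = ℤ.+-*-commutativeRing} {ℝ[ u ]} fromℤ-hom
  open Monomials u
  open LineMatrices L isW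
  open Lines L
  module D = IsOrthogonalDesign isD

  private
    Q : Poly ℝ u
    Q = quadraticForm ℝ-commutativeRing s

    lineMatrix-off : ∀ a r l → line a (proj₁ (remQuot {m} q l)) (proj₂ (remQuot {m} q r)) ≢ proj₂
        (remQuot {m} q l) →
                     ∀ p → fromℤ (lineMatrix a r l) * p ≈ 0#
    lineMatrix-off a r l off p = trans
      (*-congʳ (⟦⟧-cong (≡.trans (≡.cong (W _ _ ℤ.*_) (FiniteSums.Iₘ-off ℤ.+-*-commutativeRing off))
          (ℤ.*-zeroʳ (W _ _)))))
      (zeroˡ p)

    remQuot-injective : ∀ {l l′ : Fin (m ℕ.* q)} → proj₁ (remQuot {m} q l) ≡ proj₁ (remQuot {m} q l′) →
                        proj₂ (remQuot {m} q l) ≡ proj₂ (remQuot {m} q l′) → l ≡ l′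
    remQuot-injective {l} {l′} eq₁ eq₂ = ≡.trans (≡.sym (Fin.combine-remQuot {m} q l))
      (≡.trans (≡.cong₂ combine eq₁ eq₂) (Fin.combine-remQuot {m} q l′))

  -- The entries of the products are sums with at most one nonzero term: for
  -- m < q, a line with nonzero slope meets each horizontal line at most once;
  -- for m = q, every line meets each vertical line at most once.
  Compatible : Matrix (Poly ℝ u) (m ℕ.* q) → Set
  Compatible K = IsOrthogonalDesign s K × (∀ a r t → Monomial (((λ i j → fromℤ (lineMatrix a i j)) *ₘ K) r t))

  compatible-< : m ≢ q → Compatible (D ⊗ Iₘ {q})
  compatible-< m≢q = record
    { entries = λ l t → Monomial-Iₘʳ (proj₂ (remQuot {m} q l)) (proj₂ (remQuot {m} q t)) (D.entries _ _)
    ; orthogonal = λ l t → trans (⊗-orthogonal {m} {q} D Iₘ D.orthogonal Iₘ-orthogonal l t)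
        (*-congʳ (*-identityʳ Q))
    } , monomial
    where
    monomial : ∀ a r t → Monomial (((λ i j → fromℤ (lineMatrix a i j)) *ₘ (D ⊗ Iₘ {q})) r t)
    monomial a r t with sum-atMostOne
      (λ l → fromℤ (lineMatrix a r l) * (D ⊗ Iₘ {q}) l t)
      (λ l → (proj₂ (remQuot {m} q l) Fin.≟ proj₂ (remQuot {m} q t)) ×-dec
             (line a (proj₁ (remQuot {m} q l)) (proj₂ (remQuot {m} q r)) Fin.≟ proj₂ (remQuot {m} q l)))
      vanish
      (λ l l′ (eq₁ , eq₂) (eq₁′ , eq₂′) →
        let y≡y′ = ≡.trans eq₁ (≡.sym eq₁′) in
        remQuot-injective (notHorizontal m≢q a _ (≡.trans eq₂ (≡.trans y≡y′ (≡.sym eq₂′)))) y≡y′)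
      where
      vanish : ∀ l → ¬ (proj₂ (remQuot {m} q l) ≡ proj₂ (remQuot {m} q t) ×
                        line a (proj₁ (remQuot {m} q l)) (proj₂ (remQuot {m} q r)) ≡ proj₂ (remQuot {m} q l)) →
               fromℤ (lineMatrix a r l) * (D ⊗ Iₘ {q}) l t ≈ 0#
      vanish l ¬P with proj₂ (remQuot {m} q l) Fin.≟ proj₂ (remQuot {m} q t)
      ... | yes y≡z = lineMatrix-off a r l (λ on → ¬P (y≡z , on)) _
      ... | no y≢z  = trans (*-congˡ (zeroʳ _)) (zeroʳ _)
    ... | inj₁ sum≈0       = inj₁ sum≈0
    ... | inj₂ (l , sum≈f) = Monomial-cong (sym sum≈f) (Monomial-*ˡ (lineMatrix-ternary a r l)
      (Monomial-Iₘʳ (proj₂ (remQuot {m} q l)) (proj₂ (remQuot {m} q t)) (D.entries _ _)))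

  -- The second Kronecker factor has order q, so D is transported along m ≡ q.
  compatible-≡ : (m≡q : m ≡ q) → Compatible (Iₘ {m} ⊗ ≡.subst (Matrix (Poly ℝ u)) m≡q D)
  compatible-≡ ≡.refl = record
    { entries = λ l t → Monomial-Iₘˡ (proj₁ (remQuot {m} q l)) (proj₁ (remQuot {m} q t)) (D.entries _ _)
    ; orthogonal = λ l t → trans (⊗-orthogonal {m} {q} Iₘ D Iₘ-orthogonal D.orthogonal l t)
        (*-congʳ (*-identityˡ Q))
    } , monomial
    where
    monomial : ∀ a r t → Monomial (((λ i j → fromℤ (lineMatrix a i j)) *ₘ (Iₘ {m} ⊗ D)) r t)
    monomial a r t with sum-atMostOne
      (λ l → fromℤ (lineMatrix a r l) * (Iₘ {m} ⊗ D) l t)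
      (λ l → (proj₁ (remQuot {m} q l) Fin.≟ proj₁ (remQuot {m} q t)) ×-dec
             (line a (proj₁ (remQuot {m} q l)) (proj₂ (remQuot {m} q r)) Fin.≟ proj₂ (remQuot {m} q l)))
      vanish
      (λ l l′ (eq₁ , eq₂) (eq₁′ , eq₂′) →
        let j≡j′ = ≡.trans eq₁ (≡.sym eq₁′) in
        remQuot-injective j≡j′ (≡.trans (≡.sym eq₂) (≡.trans (≡.cong (λ j → line a j _) j≡j′) eq₂′)))
      where
      vanish : ∀ l → ¬ (proj₁ (remQuot {m} q l) ≡ proj₁ (remQuot {m} q t) ×
                        line a (proj₁ (remQuot {m} q l)) (proj₂ (remQuot {m} q r)) ≡ proj₂ (remQuot {m} q l)) →
               fromℤ (lineMatrix a r l) * (Iₘ {m} ⊗ D) l t ≈ 0#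
      vanish l ¬P with proj₁ (remQuot {m} q l) Fin.≟ proj₁ (remQuot {m} q t)
      ... | yes j≡i = lineMatrix-off a r l (λ on → ¬P (j≡i , on)) _
      ... | no j≢i  = trans (*-congˡ (zeroˡ _)) (zeroʳ _)
    ... | inj₁ sum≈0       = inj₁ sum≈0
    ... | inj₂ (l , sum≈f) = Monomial-cong (sym sum≈f) (Monomial-*ˡ (lineMatrix-ternary a r l)
      (Monomial-Iₘˡ (proj₁ (remQuot {m} q l)) (proj₁ (remQuot {m} q t)) (D.entries _ _)))

  compatibleDesign : ∃ Compatible
  compatibleDesign with m ℕ.≟ q
  ... | yes m≡q = _ , compatible-≡ m≡q
  ... | no m≢q  = _ , compatible-< m≢q

  lineDesign : Fin m → Matrix (Poly ℝ u) (m ℕ.* q)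
  lineDesign a = (λ i j → fromℤ (lineMatrix a i j)) *ₘ proj₁ compatibleDesign

  lineDesign-monomial : ∀ a r t → Monomial (lineDesign a r t)
  lineDesign-monomial = proj₂ (proj₂ compatibleDesign)

  lineDesign-gram : ∀ a b r t → (lineDesign a *ₘ transpose (lineDesign b)) r t ≈
                    Q * fromℤ ((lineMatrix a ℤM.*ₘ transpose (lineMatrix b)) r t)
  lineDesign-gram a b r t = trans
    (*ₘ-orthogonal (λ i j → fromℤ (lineMatrix a i j)) (λ i j → fromℤ (lineMatrix b i j))
        (proj₁ compatibleDesign)
      (IsOrthogonalDesign.orthogonal (proj₁ (proj₂ compatibleDesign))) r t)
    (*-congˡ (sym (*ₘ-homo (lineMatrix a) (transpose (lineMatrix b)) r t)))

-- Evaluation at the indicator of a subset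

module ℕ-Sum = SemiringSum ℕ.+-*-semiring

≤-sum : ∀ {n} (f : Vector ℕ n) i → f i ℕ.≤ ℕ-Sum.sum f
≤-sum f zero    = ℕ.m≤m+n (f zero) _
≤-sum f (suc i) = ℕ.≤-trans (≤-sum (f ∘ suc) i) (ℕ.m≤n+m _ (f zero))

subsetSum-positive : ∀ {u} (S : Subset u) {s : Vector ℕ u} → (∀ i → 1 ℕ.≤ s i) → Nonempty S
    → 1 ℕ.≤ subsetSum S s
subsetSum-positive S {s} 1≤s (i , i∈S) = ℕ.≤-trans (1≤s i)
  (≡.subst (ℕ._≤ subsetSum S s) (≡.cong (if_then s i else 0) ([]=⇒lookup i∈S))
    (≤-sum (λ i → if Vec.lookup S i then s i else 0) i))

fromℕ-sum : (R : CommutativeRing c ℓ) (let module R = CommutativeRing R) → ∀ {n} (f : Vector ℕ n) →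
            Mat.fromℕ R (ℕ-Sum.sum f) R.≈ FiniteSums.sum R (λ i → Mat.fromℕ R (f i))
fromℕ-sum R {zero}  f = CommutativeRing.refl R
fromℕ-sum R {suc n} f = trans (SemiringMult.×-homo-+ semiring 1# (f zero) _) (+-congˡ (fromℕ-sum R (f ∘ suc)))
  where open CommutativeRing R hiding (zero)

module Evaluate {u : ℕ} (S : Subset u) where
  indicator : Fin u → ℝ
  indicator i = if Vec.lookup S i then constᴿ 1ℚ else constᴿ 0ℚ

  open Substitution {R = ℝ-commutativeRing} {ℝ-commutativeRing} (id-hom ℝ-commutativeRing u) indicator public
    renaming (substitute to evaluate; substitute-hom to evaluate-hom)
  module Ev = Hom {R = ℝ[ u ]} {ℝ-commutativeRing} evaluate-hom
  open Substitution {R = ℂ-commutativeRing} {ℂ-commutativeRing} (id-hom ℂ-commutativeRing u) (λ i → fromReal (indicator i)) public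
    using () renaming (substitute to evaluateᶜ; substitute-cong to evaluateᶜ-cong)
  open SemiringMult Real.semiring using (×-congʳ; ×-comm-*) renaming (_×_ to _·_)
  open SetoidReasoning ℝ-setoid

  evaluate-quadraticForm : ∀ s → evaluate (quadraticForm ℝ-commutativeRing s) ≈ᴿ ℝM.fromℕ (subsetSum S s)
  evaluate-quadraticForm s = begin
    evaluate (quadraticForm ℝ-commutativeRing s)
      ≈⟨ Ev.sum-homo (λ i → s i ·ᴾ (var i *ᴾ var i)) ⟩
    sum (λ i → evaluate (s i ·ᴾ (var i *ᴾ var i)))
      ≈⟨ sum-cong-≋ (λ i → Real.trans (Ev.·-homo (s i) (var i *ᴾ var i)) (term i)) ⟩
    sum (λ i → ℝM.fromℕ (if Vec.lookup S i then s i else 0))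
      ≈⟨ fromℕ-sum ℝ-commutativeRing (λ i → if Vec.lookup S i then s i else 0) ⟨
    ℝM.fromℕ (subsetSum S s)                                ∎
    where
    open FiniteSums ℝ-commutativeRing
    open SemiringMult (CommutativeRing.semiring ℝ[ u ]) using () renaming (_×_ to _·ᴾ_)
    term : ∀ i → s i · (indicator i *ᴿ indicator i) ≈ᴿ ℝM.fromℕ (if Vec.lookup S i then s i else 0)
    term i with Vec.lookup S i
    ... | inside  = ×-congʳ (s i) (Real.*-identityˡ _)
    ... | outside = Real.trans (Real.sym (×-comm-* (s i) (constᴿ 0ℚ) (constᴿ 0ℚ))) (Real.zeroˡ _)

  evaluate-monomial : ∀ {p} → Monomials.Monomial u p → ∃ λ z → Ternary z × evaluate p ≈ᴿ fromℤᴿ z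
  evaluate-monomial (inj₁ p≈0) = ℤ.0ℤ , inj₁ ≡.refl , Real.trans (Ev.⟦⟧-cong p≈0) Ev.0#-homo
  evaluate-monomial (inj₂ (l , p≈)) = signed p≈ (value l)
    where
    value : ∀ l → ∃ λ z → Ternary z × indicator l ≈ᴿ fromℤᴿ z
    value l with Vec.lookup S l
    ... | inside  = ℤ.1ℤ , inj₂ (inj₁ ≡.refl) , Real.sym Fromℤᴿ.1#-homo
    ... | outside = ℤ.0ℤ , inj₁ ≡.refl , Real.refl
    signed : ∀ {p l} → CommutativeRing._≈_ ℝ[ u ] p (var l) ⊎ CommutativeRing._≈_ ℝ[ u ] p (-ᴾ var l) →
             (∃ λ z → Ternary z × indicator l ≈ᴿ fromℤᴿ z) → ∃ λ z → Ternary z × evaluate p ≈ᴿ fromℤᴿ z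
    signed (inj₁ p≈) (z , z-ternary , v≈z) = z , z-ternary , Real.trans (Ev.⟦⟧-cong p≈) v≈z
    signed (inj₂ p≈) (z , z-ternary , v≈z) = ℤ.-1ℤ ℤ.* z , Ternary-* (inj₂ (inj₂ ≡.refl)) z-ternary ,
      Real.trans (Ev.⟦⟧-cong p≈) (Real.trans (Real.-‿cong v≈z) (Real.trans (Real.sym (Fromℤᴿ.-‿homo z))
        (Real.reflexive (≡.cong fromℤᴿ (≡.sym (ℤ.-1*i≡-i z))))))

  -- Used for distinctness: an equation between complexified designs is evaluated over ℂ, and this
  -- leads back to the real evaluation.
  evaluateᶜ-fromReal : ∀ p → evaluateᶜ (mapPoly fromReal p) Complex.≈ fromReal (evaluate p)
  evaluateᶜ-fromReal (con x)  = Complex.refl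
  evaluateᶜ-fromReal (var i)  = Complex.refl
  evaluateᶜ-fromReal (p +ᴾ q) = Complex.trans (Complex.+-cong (evaluateᶜ-fromReal p)
      (evaluateᶜ-fromReal q)) (Complex.sym (FromReal.+-homo _ _))
  evaluateᶜ-fromReal (p *ᴾ q) = Complex.trans (Complex.*-cong (evaluateᶜ-fromReal p)
      (evaluateᶜ-fromReal q)) (Complex.sym (FromReal.*-homo _ _))
  evaluateᶜ-fromReal (-ᴾ p)   = Complex.trans (Complex.-‿cong (evaluateᶜ-fromReal p))
      (Complex.sym (FromReal.-‿homo _))

-- Complexification of real polynomials

module Complexification (u : ℕ) where
  open CommutativeRing ℂ[ u ] hiding (zero)

  complexify : Poly ℝ u → Poly ℂ u
  complexify = mapPoly fromReal

  complexify-hom : IsHom ℝ[ u ] ℂ[ u ] complexify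
  complexify-hom = mapPoly-hom {R = ℝ-commutativeRing} {ℂ-commutativeRing} fromReal-hom u

  open Hom {R = ℝ[ u ]} {ℂ[ u ]} complexify-hom public
  open Monomials u

  conjugateᴾ-complexify : ∀ p → conjugateᴾ (complexify p) ≈ complexify p
  conjugateᴾ-complexify (con x)  = con-cong (conjugate-fromReal x)
  conjugateᴾ-complexify (var i)  = refl
  conjugateᴾ-complexify (p +ᴾ q) = +-cong (conjugateᴾ-complexify p) (conjugateᴾ-complexify q)
  conjugateᴾ-complexify (p *ᴾ q) = *-cong (conjugateᴾ-complexify p) (conjugateᴾ-complexify q)
  conjugateᴾ-complexify (-ᴾ p)   = -‿cong (conjugateᴾ-complexify p)

  complexify-ᴴ : ∀ {n} (X Y : Matrix (Poly ℝ u) n) i j →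
    ℂ[X]M._*ₘ_ u (λ i j → complexify (X i j)) ((λ i j → complexify (Y i j)) ᴴᴾ) i j ≈
    complexify (ℝ[X]M._*ₘ_ u X (transpose Y) i j)
  complexify-ᴴ X Y i j = trans
    (MatrixProperties.*ₘ-cong ℂ[ u ] {X = λ i j → complexify (X i j)} (λ _ _ → refl)
        (λ k l → conjugateᴾ-complexify (Y l k)) i j)
    (sym (*ₘ-homo X (transpose Y) i j))

  -- Both sides are images of z under composites of homomorphisms, which `fromℤ-homo` reduces to the
  -- canonical map from ℤ.
  complexify-fromℤ : ∀ z → complexify (FromInteger.fromℤ ℝ[ u ] z) ≈ con (fromReal (fromℤᴿ z))
  complexify-fromℤ z = trans (fromℤ-homo {R = ℝ[ u ]} {ℂ[ u ]} complexify-hom z) (sym (trans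
    (con-cong (fromℤ-homo {R = ℝ-commutativeRing} {ℂ-commutativeRing} fromReal-hom z))
    (fromℤ-homo {R = ℂ-commutativeRing} {ℂ[ u ]} (con-hom ℂ-commutativeRing u) z)))

  complexify-monomial : ∀ {p} → Monomial p → complexify p ≈ 0# ⊎
                        (∃ λ ε → ∃ λ l → OnUnitCircle ε × complexify p ≈ con ε *ᴾ var l)
  complexify-monomial (inj₁ p≈0) = inj₁ (trans (⟦⟧-cong p≈0) 0#-homo)
  complexify-monomial (inj₂ (l , inj₁ p≈)) = inj₂ (fromReal (fromℤᴿ ℤ.1ℤ) , l , unit-±1
      (inj₁ ≡.refl) Real.refl , trans (⟦⟧-cong p≈) (sym (trans
      (*-congʳ (con-cong (Complex.trans (FromReal.⟦⟧-cong Fromℤᴿ.1#-homo) FromReal.1#-homo)))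
          (*-identityˡ (var l)))))
  complexify-monomial (inj₂ (l , inj₂ p≈)) = inj₂ (fromReal (fromℤᴿ ℤ.-1ℤ) , l , unit-±1
      (inj₂ ≡.refl) Real.refl , trans (⟦⟧-cong p≈) (sym (trans
      (*-congʳ (trans (con-cong (fromℤ-homo {R = ℝ-commutativeRing} {ℂ-commutativeRing} fromReal-hom ℤ.-1ℤ))
        (trans (fromℤ-homo {R = ℂ-commutativeRing} {ℂ[ u ]} (con-hom ℂ-commutativeRing u) ℤ.-1ℤ)
          (-‿cong (+-identityʳ 1#)))))
      (-1*x≈-x (var l)))))
    where open RingProperties ring using (-1*x≈-x)

-- The two families

module Conclusion {m q k u : ℕ} {s : Vector ℕ u} (L : Lines m q) (o : Fin q) (1≤k : 1 ℕ.≤ k) (1≤s : ∀ i → 1 ℕ.≤ s i)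
  {W : Matrix ℤ m} (isW : IsWeighingMatrix k W) {D : Matrix (Poly ℝ u) m} (isD : IsOrthogonalDesign s D) where

  open LineMatrices L isW
  open LineDesigns L isW isD
  open Complexification u

  private
    n : ℕ
    n = m ℕ.* q

    Z : Fin m → Fin m → Matrix ℤ n
    Z a b = lineMatrix a ℤM.*ₘ transpose (lineMatrix b)

  module _ (S : Subset u) (S-nonempty : Nonempty S) where
    open Evaluate S
    open SetoidReasoning ℝ-setoid
    private
      σ : ℕ
      σ = subsetSum S s
      1≤σ : 1 ℕ.≤ σ
      1≤σ = subsetSum-positive S 1≤s S-nonempty

    lineWeighing : Fin m → Matrix ℝ n
    lineWeighing a i j = evaluate (lineDesign a i j)

    lineWeighing-gram : ∀ a b i j → (lineWeighing a ℝM.*ₘ transpose (lineWeighing b)) i j ≈ᴿ ℝM.fromℕ σ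
        *ᴿ fromℤᴿ (Z a b i j)
    lineWeighing-gram a b i j = begin
      (lineWeighing a ℝM.*ₘ transpose (lineWeighing b)) i j
        ≈⟨ Ev.*ₘ-homo (lineDesign a) (transpose (lineDesign b)) i j ⟨
      evaluate (ℝ[X]M._*ₘ_ u (lineDesign a) (transpose (lineDesign b)) i j)
        ≈⟨ Ev.⟦⟧-cong (lineDesign-gram a b i j) ⟩
      evaluate (quadraticForm ℝ-commutativeRing s) *ᴿ evaluate (FromInteger.fromℤ ℝ[ u ] (Z a b i j))
        ≈⟨ Real.*-cong (evaluate-quadraticForm s) (fromℤ-homo {R = ℝ[ u ]} {ℝ-commutativeRing}
            evaluate-hom (Z a b i j)) ⟩
      ℝM.fromℕ σ *ᴿ fromℤᴿ (Z a b i j)                                         ∎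

    private
      scalar : ∀ l {i j : Fin n} {z} → z ≡ ℤ.+ l ℤ.* ℤM.Iₘ i j → fromℤᴿ z ≈ᴿ ℝM.fromℕ l *ᴿ ℝM.Iₘ i j
      scalar l {i} {j} {z} z≡ = begin
        fromℤᴿ z                                ≡⟨ ≡.cong fromℤᴿ z≡ ⟩
        fromℤᴿ (ℤ.+ l ℤ.* ℤM.Iₘ i j)            ≈⟨ Fromℤᴿ.*-homo (ℤ.+ l) (ℤM.Iₘ i j) ⟩
        ℝM.fromℕ l *ᴿ fromℤᴿ (ℤM.Iₘ i j)        ≈⟨ Real.*-congˡ (Fromℤᴿ.Iₘ-homo i j) ⟩
        ℝM.fromℕ l *ᴿ ℝM.Iₘ i j                 ∎

    lineWeighing-weighing : ∀ a → IsUnitWeighingMatrix (k ℕ.* σ) (fromRealₘ (lineWeighing a))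
    lineWeighing-weighing a = fromRealₘ-weighing (lineWeighing a)
        (λ i j → evaluate-monomial (lineDesign-monomial a i j)) λ i j → begin
      (lineWeighing a ℝM.*ₘ transpose (lineWeighing a)) i j    ≈⟨ lineWeighing-gram a a i j ⟩
      ℝM.fromℕ σ *ᴿ fromℤᴿ (Z a a i j)
        ≈⟨ Real.*-congˡ (scalar k {i} {j} (IsWeighingMatrix.orthogonal (lineMatrix-weighing a) i j)) ⟩
      ℝM.fromℕ σ *ᴿ (ℝM.fromℕ k *ᴿ ℝM.Iₘ i j)                  ≈⟨ Real.*-assoc _ _ _ ⟨
      (ℝM.fromℕ σ *ᴿ ℝM.fromℕ k) *ᴿ ℝM.Iₘ i j                  ≈⟨ Real.*-congʳ (Real.*-comm _ _) ⟩
      (ℝM.fromℕ k *ᴿ ℝM.fromℕ σ) *ᴿ ℝM.Iₘ i j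
        ≈⟨ Real.*-congʳ (SemiringMult.×1-homo-* Real.semiring k σ) ⟨
      ℝM.fromℕ (k ℕ.* σ) *ᴿ ℝM.Iₘ i j                          ∎

    private
      cancel-σ : ∀ {t} → t *ᴿ ℝM.fromℕ σ ≈ᴿ constᴿ 1ℚ → ∀ x → t *ᴿ (ℝM.fromℕ σ *ᴿ x) ≈ᴿ x
      cancel-σ {t} tσ≈1 x = Real.trans (Real.sym (Real.*-assoc _ _ _))
          (Real.trans (Real.*-congʳ tσ≈1) (Real.*-identityˡ x))

    -- If the matrices agree, so do their Gram products with the matrix of slope a, that is, σ
    -- `Z b a` = σ `Z a a`. Cancelling σ gives `Z b a` = k I, and `gram-injective` identifies the
    -- line matrices.
    lineWeighing-distinct : ∀ {a b} → a ≢ b → ¬ (fromRealₘ (lineWeighing a) ℂM.≈ₘ fromRealₘ (lineWeighing b))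
    lineWeighing-distinct {a} {b} a≢b eq = lineMatrix-distinct 1≤k o a≢b
      (gram-injective {X = lineMatrix a} {lineMatrix b} 1≤k
          (IsWeighingMatrix.orthogonal (lineMatrix-weighing a))
        λ i j → ≡.trans (fromℤᴿ-injective (Z≈ i j)) (IsWeighingMatrix.orthogonal (lineMatrix-weighing a) i j))
      where
      Z≈ : ∀ i j → fromℤᴿ (Z b a i j) ≈ᴿ fromℤᴿ (Z a a i j)
      Z≈ i j = let t , _ , tσ≈1 = inverseSqrt 1≤σ in begin
        fromℤᴿ (Z b a i j)                                                 ≈⟨ cancel-σ tσ≈1 _ ⟨
        t *ᴿ (ℝM.fromℕ σ *ᴿ fromℤᴿ (Z b a i j))
          ≈⟨ Real.*-congˡ (lineWeighing-gram b a i j) ⟨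
        t *ᴿ (lineWeighing b ℝM.*ₘ transpose (lineWeighing a)) i j
          ≈⟨ Real.*-congˡ (MatrixProperties.*ₘ-cong ℝ-commutativeRing
          {Y = transpose (lineWeighing a)} (λ k l → Real.sym (_≈ᴳ_.re≈ (eq k l))) (λ _ _ → Real.refl) i j) ⟩
        t *ᴿ (lineWeighing a ℝM.*ₘ transpose (lineWeighing a)) i j
          ≈⟨ Real.*-congˡ (lineWeighing-gram a a i j) ⟩
        t *ᴿ (ℝM.fromℕ σ *ᴿ fromℤᴿ (Z a a i j))                            ≈⟨ cancel-σ tσ≈1 _ ⟩
        fromℤᴿ (Z a a i j)                                                 ∎

    -- The quadratic form takes the value σ, the root of the parameter σ ^ 2. Multiplication by t =
    -- 1 / σ therefore leaves the integer matrix `Z a b` of weight k ^ 2.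
    lineWeighing-unbiased : ∀ {a b} → a ≢ b →
      QuasiUnbiased (k ℕ.^ 2) (ℝM.fromℕ (σ ℕ.^ 2)) (fromRealₘ (lineWeighing a)) (fromRealₘ (lineWeighing b))
    lineWeighing-unbiased {a} {b} a≢b = let t , isInverseSqrt , tσ≈1 = inverseSqrt 1≤σ in
      t , isInverseSqrt , IsUnitWeighingMatrix-cong
        {W = fromRealₘ (λ i j → fromℤᴿ (Z a b i j))}
        (λ i j → Complex.sym (Complex.trans (Complex.*-congˡ
            (fromRealₘ-ᴴ (lineWeighing a) (lineWeighing b) i j))
          (Complex.trans (Complex.sym (FromReal.*-homo _ _)) (FromReal.⟦⟧-cong
            (Real.trans (Real.*-congˡ (lineWeighing-gram a b i j)) (cancel-σ tσ≈1 _))))))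
        (fromRealₘ-weighing (λ i j → fromℤᴿ (Z a b i j)) (λ i j → Z a b i j , cross.entries i j , Real.refl)
          λ i j → Real.trans (Real.sym (Fromℤᴿ.*ₘ-homo (Z a b) (transpose (Z a b)) i j))
              (scalar (k ℕ.^ 2) {i} {j} (cross.orthogonal i j)))
      where module cross = IsWeighingMatrix (lineMatrix-cross-weighing a≢b)

    mutuallyQuasiUnbiased : MutuallyQuasiUnbiased n (k ℕ.* σ) (k ℕ.^ 2) (ℝM.fromℕ (σ ℕ.^ 2))
        (λ a → fromRealₘ (lineWeighing a))
    mutuallyQuasiUnbiased = record
      { unitWeighing = lineWeighing-weighing
      ; distinct     = λ a b → lineWeighing-distinct
      ; unbiased     = λ a b → lineWeighing-unbiased
      }

  unitDesign : Fin m → Matrix (Poly ℂ u) n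
  unitDesign a i j = complexify (lineDesign a i j)

  private
    open CommutativeRing ℂ[ u ] using (_≈_; _*_; *-congˡ; *-congʳ; *-cong; *-assoc; *-comm; *-identityˡ; trans; sym; setoid)
    open SetoidReasoning setoid
    Qᴿ : Poly ℝ u
    Qᴿ = quadraticForm ℝ-commutativeRing s
    Q Qₖ : Poly ℂ u
    Q  = quadraticForm ℂ-commutativeRing s
    Qₖ = quadraticForm ℂ-commutativeRing (λ i → k ℕ.* s i)

  unitDesign-gram : ∀ a b i j → ℂ[X]M._*ₘ_ u (unitDesign a) (unitDesign b ᴴᴾ) i j ≈ Q * con
      (fromReal (fromℤᴿ (Z a b i j)))
  unitDesign-gram a b i j = begin
    ℂ[X]M._*ₘ_ u (unitDesign a) (unitDesign b ᴴᴾ) i j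
      ≈⟨ complexify-ᴴ (lineDesign a) (lineDesign b) i j ⟩
    complexify (ℝ[X]M._*ₘ_ u (lineDesign a) (transpose (lineDesign b)) i j)
      ≈⟨ ⟦⟧-cong (lineDesign-gram a b i j) ⟩
    complexify Qᴿ * complexify (FromInteger.fromℤ ℝ[ u ] (Z a b i j))            ≈⟨ *-cong
      (quadraticForm-homo {R = ℝ-commutativeRing} {ℂ-commutativeRing} fromReal-hom u s)
          (complexify-fromℤ (Z a b i j)) ⟩
    Q * con (fromReal (fromℤᴿ (Z a b i j)))                                      ∎

  -- The quadratic form of the type is k Q, while the Gram products carry Q. Division by √α = k
  -- makes up for this, so the matrix W of the definition is `Z a b`.
  mutuallyUnbiased : 1 ℕ.≤ u → MutuallyUnbiased n (λ i → k ℕ.* s i) (ℝM.fromℕ (k ℕ.^ 2)) unitDesign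
  mutuallyUnbiased 1≤u = record
    { unitDesign = λ a → record
        { entries    = λ i j → complexify-monomial (lineDesign-monomial a i j)
        ; orthogonal = λ i j → begin
            ℂ[X]M._*ₘ_ u (unitDesign a) (unitDesign a ᴴᴾ) i j
              ≈⟨ unitDesign-gram a a i j ⟩
            Q * con (fromReal (fromℤᴿ (Z a a i j)))
              ≈⟨ *-congˡ (scalar i j (IsWeighingMatrix.orthogonal (lineMatrix-weighing a) i j)) ⟩
            Q * (ℂ[X]M.fromℕ u k * ℂ[X]M.Iₘ u i j)                         ≈⟨ *-assoc _ _ _ ⟨
            (Q * ℂ[X]M.fromℕ u k) * ℂ[X]M.Iₘ u i j
              ≈⟨ *-congʳ (trans (*-comm _ _) (sym (quadraticForm-scale ℂ-commutativeRing k s))) ⟩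
            Qₖ * ℂ[X]M.Iₘ u i j                                            ∎
        }
    -- Setting all variables to 1 carries equal designs to equal weighing matrices, which are
    -- already known to differ; u ≥ 1 makes `⊤` nonempty.
    ; distinct = λ a b a≢b eq → lineWeighing-distinct ⊤ (o′ , ∈⊤) a≢b λ i j →
        Complex.trans (Complex.sym (evaluateᶜ-fromReal (lineDesign a i j)))
          (Complex.trans (evaluateᶜ-cong (eq i j)) (evaluateᶜ-fromReal (lineDesign b i j)))
    ; unbiased = λ a b a≢b → let t , isInverseSqrt , tk≈1 = inverseSqrt 1≤k in
        t , fromRealₘ (λ i j → fromℤᴿ (Z a b i j)) , isInverseSqrt ,
        (λ i j → ternary-zero-or-unit (IsWeighingMatrix.entries (lineMatrix-cross-weighing a≢b) i j)
            Real.refl) ,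
        λ i j → begin
          ℂ[X]M._*ₘ_ u (unitDesign a) (unitDesign b ᴴᴾ) i j
            ≈⟨ unitDesign-gram a b i j ⟩
          Q * con (fromReal (fromℤᴿ (Z a b i j)))
            ≈⟨ *-congʳ (rescale tk≈1) ⟨
          (con (fromReal t) * Qₖ) * con (fromReal (fromℤᴿ (Z a b i j)))    ∎
    }
    where
    open Evaluate {u} ⊤ using (evaluateᶜ-fromReal; evaluateᶜ-cong)
    o′ : Fin u
    o′ = Fin.fromℕ< 1≤u
    module Fromℤᴾ = Hom {R = ℤ.+-*-commutativeRing} {ℂ[ u ]} (FromInteger.fromℤ-hom ℂ[ u ])
    con-fromℤ : ∀ z → con (fromReal (fromℤᴿ z)) ≈ FromInteger.fromℤ ℂ[ u ] z
    con-fromℤ z = trans (con-cong (fromℤ-homo {R = ℝ-commutativeRing} {ℂ-commutativeRing} fromReal-hom z))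
      (fromℤ-homo {R = ℂ-commutativeRing} {ℂ[ u ]} (con-hom ℂ-commutativeRing u) z)
    scalar : ∀ i j {z} → z ≡ ℤ.+ k ℤ.* ℤM.Iₘ i j → con (fromReal (fromℤᴿ z)) ≈ ℂ[X]M.fromℕ u k * ℂ[X]M.Iₘ u i j
    scalar i j ≡.refl = trans (con-fromℤ (ℤ.+ k ℤ.* ℤM.Iₘ i j))
        (trans (Fromℤᴾ.*-homo (ℤ.+ k) (ℤM.Iₘ i j)) (*-congˡ (Fromℤᴾ.Iₘ-homo i j)))
    rescale : ∀ {t} → t *ᴿ ℝM.fromℕ k ≈ᴿ constᴿ 1ℚ → con (fromReal t) * Qₖ ≈ Q
    rescale {t} tk≈1 = begin
      con (fromReal t) * Qₖ
        ≈⟨ *-congˡ (quadraticForm-scale ℂ-commutativeRing k s) ⟩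
      con (fromReal t) * (ℂ[X]M.fromℕ u k * Q)                ≈⟨ *-assoc _ _ _ ⟨
      (con (fromReal t) * ℂ[X]M.fromℕ u k) * Q
        ≈⟨ *-congʳ (*-congˡ (con-fromℤ (ℤ.+ k))) ⟨
      (con (fromReal t) * con (fromReal (ℝM.fromℕ k))) * Q    ≈⟨ *-congʳ (con-* _ _) ⟨
      con (fromReal t Complex.* fromReal (ℝM.fromℕ k)) * Q
        ≈⟨ *-congʳ (con-cong (FromReal.*-homo t (ℝM.fromℕ k))) ⟨
      con (fromReal (t *ᴿ ℝM.fromℕ k)) * Q
        ≈⟨ *-congʳ (con-cong (FromReal.⟦⟧-cong tk≈1)) ⟩
      con Complex.1# * Q                                      ≈⟨ *-identityˡ Q ⟩
      Q                                                       ∎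

open import Data.Nat.Base using (_*_; _^_; _≤_)

theorem6p2 : (q m k u : ℕ) (s : Vector ℕ u) →
    1 ≤ q → 1 ≤ m → 1 ≤ k → 1 ≤ u → (∀ i → 1 ≤ s i) →
    IsPrimePower q → m ≤ q →
    (∃ λ (W : Matrix ℤ m) → IsWeighingMatrix k W) →
    (∃ λ (D : Matrix (Poly ℝ u) m) → IsOrthogonalDesign s D) →
    (∃ λ (D : Vector (Matrix (Poly ℂ u) (m * q)) m) →
    MutuallyUnbiased (m * q) (λ i → k * s i) (ℝM.fromℕ (k ^ 2)) D)
    ×
    (∀ (S : Subset u) → Nonempty S →
    ∃ λ (W : Vector (Matrix ℂ (m * q)) m) →
    MutuallyQuasiUnbiased (m * q) (k * subsetSum S s) (k ^ 2)
    (ℝM.fromℕ (subsetSum S s ^ 2)) W)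
theorem6p2 q m k u s 1≤q 1≤m 1≤k 1≤u 1≤s q-primePower m≤q (W , isW) (D , isD) =
  (unitDesign , mutuallyUnbiased 1≤u) , λ S S-nonempty → _ , mutuallyQuasiUnbiased S S-nonempty
  where
  open Conclusion (linesOverDomain m≤q (finiteDomainOfPrimePower q-primePower)) (Fin.fromℕ< 1≤q) 1≤k 1≤s isW isD
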